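{- There exist a constant $c>1$ and a family of connected graphs $(G_n)$, indexed by infinitely many positive integers $n$, with $G_n$ having exactly $3n$ vertices, such that for all sufficiently large $n$ in the family $$W_{\{n-1,n,n+1\}}(G_n)\ \ge\ c^{\,n}\; W_{\{n,n,n\}}(G_n),$$ i.e. the total spanning tree weight of partitions of $G_n$ into $3$ pieces of sizes $\{n-1,n,n+1\}$ is exponentially higher than the total spanning tree weight of partitions of $G_n$ into $3$ pieces of size $n$. Further, such a family can be chosen so that each $G_n$ is an induced subgraph of the triangular lattice, $G_n$ is Hamiltonian, and the state space of ReCom without slack on $G_n$ (for $3$ pieces) is disconnected.
   Context: A (connected) $k$-partition of a graph $G=(V,E)$ is a partition of $V$ into $k$ nonempty parts, each of which induces a connected subgraph of $G$. The spanning tree weight of a partition $P$ is $\tau(P)=\prod_{i}\tau(G[V_i])$, the product over the parts $V_i$ of the number of spanning trees of the induced subgraph $G[V_i]$. For a multiset $S$ of three part sizes, $W_S(G)$ denotes the sum of $\tau(P)$ over all connected $3$-partitions $P$ of $G$ whose multiset of part sizes is $S$. The triangular lattice is the infinite graph whose vertices are the points of the planar triangular lattice, with edges between points at unit distance. ReCom without slack on a graph with $3n$ vertices: its state space is the set of connected $3$-partitions of the graph into parts of size exactly $n$; a move chooses two parts whose union $U$ induces a connected subgraph and replaces them by two other parts of size $n$, each inducing a connected subgraph, whose union is again $U$ (the third part is unchanged). The state space is disconnected if the graph on balanced partitions with edges given by such moves has more than one connected component. -}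

module Defs where

open import Data.Bool using (Bool; true; false; _∧_; _∨_; not; if_then_else_)
open import Data.Nat using (ℕ; zero; suc; _+_; _*_; _∸_; _^_; _≤_; _<_; _≡ᵇ_; _≤ᵇ_)
open import Data.Nat.DivMod using (_/_)
open import Data.Fin using (Fin; toℕ) renaming (zero to fz; suc to fs)
import Data.Fin.Properties as FinP
open import Data.List using (List; []; _∷_; map; concatMap; length; _++_; allFin)
open import Data.Nat.ListAction using (sum)
open import Data.Bool.ListAction using (all; any)
open import Data.Integer using (ℤ; +_; -[1+_]; _-_)
open import Data.Product using (Σ; Σ-syntax; ∃; ∃-syntax; _×_; _,_)
open import Data.Sum using (_⊎_)
open import Relation.Nullary using (¬_)
open import Relation.Nullary.Decidable using (⌊_⌋)
open import Relation.Binary.PropositionalEquality using (_≡_)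
open import Relation.Binary.Construct.Closure.ReflexiveTransitive using (Star)
open import Function using (_⇔_)
open import Function.Definitions using (Injective)

record Graph (m : ℕ) : Set where
  field
    adj    : Fin m → Fin m → Bool
    sym    : ∀ u v → adj u v ≡ adj v u
    irrefl : ∀ u → adj u u ≡ false
open Graph public

VSet : ℕ → Set
VSet m = Fin m → Bool

count : ∀ {m} → VSet m → ℕ
count {m} U = sum (map (λ v → if U v then 1 else 0) (allFin m))

reachStep : ∀ {m} → (Fin m → Fin m → Bool) → VSet m → VSet m → VSet m
reachStep {m} E U S v = S v ∨ (U v ∧ any (λ u → S u ∧ E u v) (allFin m))

reachIter : ∀ {m} → ℕ → (Fin m → Fin m → Bool) → VSet m → VSet m → VSet m
reachIter zero    E U S = S
reachIter (suc k) E U S = reachIter k E U (reachStep E U S)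

single : ∀ {m} → Fin m → VSet m
single u v = ⌊ u FinP.≟ v ⌋

-- the vertices of U reachable from u by a path inside U using E-edges
-- (m iterations suffice, a path has at most m vertices)
reachable : ∀ {m} → (Fin m → Fin m → Bool) → VSet m → Fin m → VSet m
reachable {m} E U u = reachIter m E U (single u)

connectedOnᵇ : ∀ {m} → (Fin m → Fin m → Bool) → VSet m → Bool
connectedOnᵇ {m} E U =
  all (λ u → all (λ v → not (U u ∧ U v) ∨ reachable E U u v) (allFin m)) (allFin m)

inducedConnectedᵇ : ∀ {m} → Graph m → VSet m → Bool
inducedConnectedᵇ G U = connectedOnᵇ (adj G) U

ConnectedGraph : ∀ {m} → Graph m → Set
ConnectedGraph G = inducedConnectedᵇ G (λ _ → true) ≡ true

Edge : ℕ → Set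
Edge m = Fin m × Fin m

inducedEdges : ∀ {m} → Graph m → VSet m → List (Edge m)
inducedEdges {m} G U =
  concatMap (λ u → concatMap (λ v →
     if ⌊ u FinP.<? v ⌋ ∧ U u ∧ U v ∧ adj G u v then (u , v) ∷ [] else [])
     (allFin m)) (allFin m)

sublists : ∀ {A : Set} → List A → List (List A)
sublists []       = [] ∷ []
sublists (x ∷ xs) = let r = sublists xs in r ++ map (x ∷_) r

edgeRel : ∀ {m} → List (Edge m) → Fin m → Fin m → Bool
edgeRel F u v = any (λ { (a , b) → (⌊ a FinP.≟ u ⌋ ∧ ⌊ b FinP.≟ v ⌋)
                                 ∨ (⌊ a FinP.≟ v ⌋ ∧ ⌊ b FinP.≟ u ⌋) }) F

isSpanningTreeᵇ : ∀ {m} → VSet m → List (Edge m) → Bool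
isSpanningTreeᵇ U F = (length F + 1 ≡ᵇ count U) ∧ connectedOnᵇ (edgeRel F) U

τ : ∀ {m} → Graph m → VSet m → ℕ
τ G U = length (Data.List.filterᵇ (isSpanningTreeᵇ U) (sublists (inducedEdges G U)))
  where import Data.List

-- 3-partitions, represented by labelings f : Fin m → Fin 3.
-- Each unordered partition into 3 nonempty parts corresponds to exactly
-- 3! = 6 labelings (the parts are distinct sets).

Labeling : ℕ → Set
Labeling m = Fin m → Fin 3

allLabelings : ∀ m → List (Labeling m)
allLabelings zero    = (λ ()) ∷ []
allLabelings (suc m) =
  concatMap (λ a → map (λ f → λ { fz → a ; (fs i) → f i }) (allLabelings m))
            (allFin 3)

part : ∀ {m} → Labeling m → Fin 3 → VSet m
part f i v = ⌊ f v FinP.≟ i ⌋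

i0 i1 i2 : Fin 3
i0 = fz
i1 = fs fz
i2 = fs (fs fz)

multisetEqᵇ : ℕ → ℕ → ℕ → ℕ → ℕ → ℕ → Bool
multisetEqᵇ s0 s1 s2 a b c =
     ((s0 ≡ᵇ a) ∧ (s1 ≡ᵇ b) ∧ (s2 ≡ᵇ c)) ∨ ((s0 ≡ᵇ a) ∧ (s1 ≡ᵇ c) ∧ (s2 ≡ᵇ b))
  ∨ ((s0 ≡ᵇ b) ∧ (s1 ≡ᵇ a) ∧ (s2 ≡ᵇ c)) ∨ ((s0 ≡ᵇ b) ∧ (s1 ≡ᵇ c) ∧ (s2 ≡ᵇ a))
  ∨ ((s0 ≡ᵇ c) ∧ (s1 ≡ᵇ a) ∧ (s2 ≡ᵇ b)) ∨ ((s0 ≡ᵇ c) ∧ (s1 ≡ᵇ b) ∧ (s2 ≡ᵇ a))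

goodPartᵇ : ∀ {m} → Graph m → Labeling m → Fin 3 → Bool
goodPartᵇ G f i = (1 ≤ᵇ count (part f i)) ∧ inducedConnectedᵇ G (part f i)

validᵇ : ∀ {m} → Graph m → ℕ → ℕ → ℕ → Labeling m → Bool
validᵇ G a b c f =
  goodPartᵇ G f i0 ∧ goodPartᵇ G f i1 ∧ goodPartᵇ G f i2
  ∧ multisetEqᵇ (count (part f i0)) (count (part f i1)) (count (part f i2)) a b c

τP : ∀ {m} → Graph m → Labeling m → ℕ
τP G f = τ G (part f i0) * τ G (part f i1) * τ G (part f i2)

-- sum over labelings (each partition counted 6 times)
Wlab : ∀ {m} → Graph m → ℕ → ℕ → ℕ → ℕ
Wlab {m} G a b c =
  sum (map (λ f → if validᵇ G a b c f then τP G f else 0) (allLabelings m))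

W : ∀ {m} → Graph m → ℕ → ℕ → ℕ → ℕ
W G a b c = Wlab G a b c / 6

Hamiltonian : ∀ {m} → Graph m → Set
Hamiltonian {m} G =
  Σ[ σ ∈ (Fin m → Fin m) ]
    Injective _≡_ _≡_ σ
    × (∀ i j → toℕ j ≡ suc (toℕ i) → adj G (σ i) (σ j) ≡ true)
    × (∀ i j → toℕ i ≡ 0 → suc (toℕ j) ≡ m → adj G (σ j) (σ i) ≡ true)

-- Triangular lattice in axial coordinates: (x , y) ↦ x·(1,0) + y·(1/2, √3/2);
-- points at unit distance differ by one of the six vectors below.

TriAdj : ℤ × ℤ → ℤ × ℤ → Set
TriAdj (x₁ , y₁) (x₂ , y₂) =
     (x₂ - x₁ ≡ + 1 × y₂ - y₁ ≡ + 0)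
  ⊎ (x₂ - x₁ ≡ -[1+ 0 ] × y₂ - y₁ ≡ + 0)
  ⊎ (x₂ - x₁ ≡ + 0 × y₂ - y₁ ≡ + 1)
  ⊎ (x₂ - x₁ ≡ + 0 × y₂ - y₁ ≡ -[1+ 0 ])
  ⊎ (x₂ - x₁ ≡ + 1 × y₂ - y₁ ≡ -[1+ 0 ])
  ⊎ (x₂ - x₁ ≡ -[1+ 0 ] × y₂ - y₁ ≡ + 1)

TriangularInduced : ∀ {m} → Graph m → Set
TriangularInduced {m} G =
  Σ[ e ∈ (Fin m → ℤ × ℤ) ]
    Injective _≡_ _≡_ e
    × (∀ u v → (adj G u v ≡ true) ⇔ TriAdj (e u) (e v))

balancedᵇ : ∀ {m} → Graph m → ℕ → Labeling m → Bool
balancedᵇ G n f = validᵇ G n n n f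

SamePartition : ∀ {m} → Labeling m → Labeling m → Set
SamePartition f g = ∀ u v → ⌊ f u FinP.≟ f v ⌋ ≡ ⌊ g u FinP.≟ g v ⌋

-- a ReCom move: part a of f equals part b of g (the unchanged part),
-- and the union of the other two parts of f (= complement of part a,
-- = union of the two new parts of g) induces a connected subgraph
ReComMove : ∀ {m} → Graph m → Labeling m → Labeling m → Set
ReComMove G f g =
  Σ[ a ∈ Fin 3 ] Σ[ b ∈ Fin 3 ]
    (∀ v → part f a v ≡ part g b v)
    × inducedConnectedᵇ G (λ v → not (part f a v)) ≡ true

ReComStep : ∀ {m} → Graph m → ℕ → Labeling m → Labeling m → Set
ReComStep G n f g =
  balancedᵇ G n f ≡ true × balancedᵇ G n g ≡ true
  × (ReComMove G f g ⊎ SamePartition f g)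

ReComDisconnected : ∀ {m} → Graph m → ℕ → Set
ReComDisconnected {m} G n =
  Σ[ f ∈ Labeling m ] Σ[ g ∈ Labeling m ]
    balancedᵇ G n f ≡ true × balancedᵇ G n g ≡ true
    × ¬ Star (ReComStep G n) f g

-- The family property of the theorem, with c = p / q rational, p > q ≥ 1
-- (c^n W₀ ≤ W₁  ⇔  p^n W₀ ≤ q^n W₁).

GoodFamily : (I : ℕ → Set) → (∀ n → I n → Graph (3 * n)) → Set
GoodFamily I G =
    (∀ n → I n → 1 ≤ n)
  × (∀ N → Σ[ n ∈ ℕ ] (N ≤ n × I n))
  × (∀ n (h : I n) → ConnectedGraph (G n h))
  × Σ[ p ∈ ℕ ] Σ[ q ∈ ℕ ] (1 ≤ q × q < p
      × Σ[ N ∈ ℕ ] (∀ n (h : I n) → N ≤ n →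
          p ^ n * W (G n h) n n n ≤ q ^ n * W (G n h) (n ∸ 1) n (n + 1)))

{-# OPTIONS --safe #-}

-- The graph is a long ladder on 6a = 3n vertices whose middle third has no rungs: two ladders ("lobes") of n + 1
-- vertices, with k + 1 rungs five steps apart, joined by two paths. A part of size n neither fits inside the open lobe
-- (n - 1 vertices) nor covers the lobe, so in a balanced partition the two ends of each lobe lie in different parts, and
-- the parts are three arcs of the outer cycle, separating the ends of at least k + 1 of the 2k + 2 rungs. Counting edge
-- sets by their size then bounds the weight of each of the O(n) balanced partitions by about C(31k , k), which grows
-- like 83^k. The partition into one open lobe, the other lobe and the rest has sizes n - 1, n + 1 and n and about 100^k
-- spanning forests: delete one of the ten rail edges in each cell. Moreover, in a balanced partition exactly one of the
-- two paths joins lobe ends of the same part, and a ReCom move cannot change which one it is.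
module Submission where

open import Defs hiding (sym; irrefl)
open import Data.Bool using (Bool; true; false; _∧_; _∨_; not; if_then_else_; T)
open import Data.Bool.ListAction using (all; any)
import Data.Bool.Properties as Bool
open import Data.Empty using (⊥; ⊥-elim)
open import Data.Fin using (Fin; toℕ; fromℕ<) renaming (zero to fz; suc to fs)
import Data.Fin.Properties as Fin
import Data.Integer as ℤ
import Data.Integer.Properties as ℤ
open import Data.List using (List; []; _∷_; map; concatMap; length; _++_; allFin; filterᵇ; applyUpTo; upTo; cartesianProduct; cartesianProductWith)
open import Data.List.Membership.Propositional using (_∈_; lose; find)
open import Data.List.Membership.Propositional.Properties
open import Data.List.Properties using (length-map; length-++; length-applyUpTo; length-tabulate; map-++)
open import Data.List.Relation.Unary.All as All using (All; []; _∷_)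
import Data.List.Relation.Unary.All.Properties as All
open import Data.List.Relation.Unary.AllPairs as AllPairs using (AllPairs; []; _∷_)
import Data.List.Relation.Unary.AllPairs.Properties as AllPairs
open import Data.List.Relation.Unary.Any as Any using (here; there)
open import Data.List.Relation.Unary.Unique.Propositional using (Unique)
import Data.List.Relation.Unary.Unique.Propositional.Properties as Unique
open import Data.Nat using (ℕ; zero; suc; _+_; _*_; _∸_; _^_; _≤_; _<_; _≤ᵇ_; _<ᵇ_; _≡ᵇ_; z≤n; s≤s; NonZero)
open import Data.Nat.DivMod using (m/n≤m; m*n/n≡m; /-monoˡ-≤)
open import Data.Nat.ListAction using (sum)
open import Data.Nat.ListAction.Properties using (sum-++)
open import Data.Nat.Properties
open import Algebra.Properties.CommutativeSemigroup +-commutativeSemigroup using (interchange)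
open import Data.Nat.Tactic.RingSolver using (solve-∀)
open import Data.Product using (Σ; Σ-syntax; ∃; _×_; _,_; proj₁; proj₂)
open import Data.Sum using (_⊎_; inj₁; inj₂; [_,_]′; swap)
open import Data.Unit using (⊤; tt)
open import Data.Vec as Vec using (Vec; []; _∷_; lookup; tabulate; replicate; zipWith)
open import Data.Vec.N-ary using (N-ary; _$ⁿ_)
open import Data.Vec.Properties using (tabulate∘lookup; tabulate-cong; ∷-injective)
open import Function using (_∘_; id; _⇔_; mk⇔; Equivalence)
open import Relation.Binary.Construct.Closure.ReflexiveTransitive as Star using (Star; ε; _◅_; _◅◅_)
open import Relation.Binary.Definitions using (tri<; tri≈; tri>)
open import Relation.Binary.PropositionalEquality
open import Relation.Nullary using (¬_; Dec; yes; no)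
open import Relation.Nullary.Decidable using (⌊_⌋; _×-dec_; _⊎-dec_; _→-dec_; ¬?; map′; does-⇔; isYes≗does; decidable-stable; toWitness)

-- Five is the least spacing that this count supports. With rungs `s` steps apart a cell has `2 * s`
-- rail edges, so the two lobes give about `(4 * s * s) ^ k` forests; a balanced partition has at
-- most about `(6 * s + 1) * k` edges inside its parts, of which all but about `k` are used, so its
-- weight is at most about C((6s + 1)k , k). At `s = 4` the bases are 64 against 67, at `s = 5` they
-- are 100 against 83. The difficulty is that a bound is needed for every position of the three
-- arcs. Moving them can spare most rungs of one lobe, but the rungs of the two lobes are cut in
-- complementary ranges: a rung is spared only where its partner in the other lobe is cut. In the
-- lattice, two rails close enough for rungs would acquire further induced edges between them. So
-- each rail bends away between consecutive rungs, and residues of the abscissas modulo 4 show that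
-- only the intended pairs meet, which is why `k` is taken divisible by 4.

-- Linear arithmetic over the naturals by checked Farkas certificates

module LinearArithmetic where

  infixl 7 _:*_
  infixl 6 _:+_
  infix  5 _:≤_ _:<_ _:≡_
  infixr 4 _⇒_
  infix  4 ⊢_

  data Expr (n : ℕ) : Set where
    var  : Fin n → Expr n
    con  : ℕ → Expr n
    _:+_ : Expr n → Expr n → Expr n
    _:*_ : ℕ → Expr n → Expr n

  data Rel (n : ℕ) : Set where
    _:≤_ _:<_ _:≡_ : Expr n → Expr n → Rel n
    :⊥ : Rel n

  data Sequent (n : ℕ) : Set where
    ⊢_  : Rel n → Sequent n
    _⇒_ : Rel n → Sequent n → Sequent n

  module _ {n : ℕ} (ρ : Vec ℕ n) where

    ⟦_⟧ᴱ : Expr n → ℕ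
    ⟦ var i ⟧ᴱ    = lookup ρ i
    ⟦ con c ⟧ᴱ    = c
    ⟦ e :+ e′ ⟧ᴱ  = ⟦ e ⟧ᴱ + ⟦ e′ ⟧ᴱ
    ⟦ c :* e ⟧ᴱ   = c * ⟦ e ⟧ᴱ

    ⟦_⟧ᴿ : Rel n → Set
    ⟦ e :≤ e′ ⟧ᴿ = ⟦ e ⟧ᴱ ≤ ⟦ e′ ⟧ᴱ
    ⟦ e :< e′ ⟧ᴿ = ⟦ e ⟧ᴱ < ⟦ e′ ⟧ᴱ
    ⟦ e :≡ e′ ⟧ᴿ = ⟦ e ⟧ᴱ ≡ ⟦ e′ ⟧ᴱ
    ⟦ :⊥ ⟧ᴿ      = ⊥

    ⟦_⟧ : Sequent n → Set
    ⟦ ⊢ r ⟧   = ⟦ r ⟧ᴿ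
    ⟦ r ⇒ s ⟧ = ⟦ r ⟧ᴿ → ⟦ s ⟧

  Ineq : ℕ → Set
  Ineq n = Expr n × Expr n

  -- The head is the constant term, the tail holds the coefficients. The two sides of an inequality
  -- stay separate forms, so that the verified part involves no subtraction.
  Form : ℕ → Set
  Form n = Vec ℕ (suc n)

  addF : ∀ {n} → Form n → Form n → Form n
  addF = zipWith _+_

  scaleF : ∀ {n} → ℕ → Form n → Form n
  scaleF c = Vec.map (c *_)

  unit : ∀ {n} → Fin n → Vec ℕ n
  unit fz     = 1 ∷ replicate _ 0
  unit (fs i) = 0 ∷ unit i

  form : ∀ {n} → Expr n → Form n
  form (var i)   = 0 ∷ unit i
  form (con c)   = c ∷ replicate _ 0
  form (e :+ e′) = addF (form e) (form e′)
  form (c :* e)  = scaleF c (form e)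

  dot : ∀ {n} → Vec ℕ n → Vec ℕ n → ℕ
  dot []       []       = 0
  dot (x ∷ xs) (y ∷ ys) = x * y + dot xs ys

  dot-+ : ∀ {n} (u v w : Vec ℕ n) → dot (zipWith _+_ u v) w ≡ dot u w + dot v w
  dot-+ [] [] [] = refl
  dot-+ (a ∷ u) (b ∷ v) (c ∷ w) rewrite dot-+ u v w | *-distribʳ-+ c a b =
    interchange (a * c) (b * c) (dot u w) (dot v w)

  dot-* : ∀ {n} c (u w : Vec ℕ n) → dot (Vec.map (c *_) u) w ≡ c * dot u w
  dot-* c [] [] = sym (*-zeroʳ c)
  dot-* c (a ∷ u) (b ∷ w) rewrite dot-* c u w | *-assoc c a b = sym (*-distribˡ-+ c (a * b) (dot u w))

  dot-0 : ∀ {n} (w : Vec ℕ n) → dot (replicate n 0) w ≡ 0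
  dot-0 []      = refl
  dot-0 (_ ∷ w) = dot-0 w

  dot-unit : ∀ {n} i (w : Vec ℕ n) → dot (unit i) w ≡ lookup w i
  dot-unit fz (x ∷ w) rewrite dot-0 w = trans (+-identityʳ _) (+-identityʳ _)
  dot-unit (fs i) (x ∷ w) = dot-unit i w

  form-correct : ∀ {n} (ρ : Vec ℕ n) e → dot (form e) (1 ∷ ρ) ≡ ⟦ ρ ⟧ᴱ e
  form-correct ρ (var i)   = dot-unit i ρ
  form-correct ρ (con c) rewrite dot-0 ρ = trans (+-identityʳ _) (*-identityʳ c)
  form-correct ρ (e :+ e′) = trans (dot-+ (form e) (form e′) _) (cong₂ _+_ (form-correct ρ e) (form-correct ρ e′))
  form-correct ρ (c :* e)  = trans (dot-* c (form e) _) (cong (c *_) (form-correct ρ e))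

  Hold : ∀ {n} → Vec ℕ n → List (Ineq n) → Set
  Hold ρ []             = ⊤
  Hold ρ ((l , r) ∷ hs) = (⟦ ρ ⟧ᴱ l ≤ ⟦ ρ ⟧ᴱ r) × Hold ρ hs

  combine : ∀ {n} → List (Ineq n) → List ℕ → Form n × Form n
  combine ((l , r) ∷ hs) (c ∷ cs) with combine hs cs
  ... | L , R = addF (scaleF c (form l)) L , addF (scaleF c (form r)) R
  combine _ _ = replicate _ 0 , replicate _ 0

  combine-≤ : ∀ {n} (ρ : Vec ℕ n) hs cs → Hold ρ hs →
              dot (proj₁ (combine hs cs)) (1 ∷ ρ) ≤ dot (proj₂ (combine hs cs)) (1 ∷ ρ)
  combine-≤ ρ []       _        _ = ≤-refl
  combine-≤ ρ (_ ∷ _)  []       _ = ≤-refl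
  combine-≤ ρ ((l , r) ∷ hs) (c ∷ cs) (h , hs′) with combine hs cs | combine-≤ ρ hs cs hs′
  ... | L , R | ih = subst₂ _≤_ (sym (eq l L)) (sym (eq r R)) (+-mono-≤ (*-monoʳ-≤ c h) ih)
    where
    eq : ∀ e E → dot (addF (scaleF c (form e)) E) (1 ∷ ρ) ≡ c * ⟦ ρ ⟧ᴱ e + dot E (1 ∷ ρ)
    eq e E = trans (dot-+ (scaleF c (form e)) E _)
                   (cong (_+ dot E (1 ∷ ρ)) (trans (dot-* c (form e) _) (cong (c *_) (form-correct ρ e))))

  dominates : ∀ {n} → Vec ℕ n → Vec ℕ n → Bool
  dominates []       []       = true
  dominates (x ∷ xs) (y ∷ ys) = (y ≤ᵇ x) ∧ dominates xs ys

  absurd? : ∀ {n} → Form n × Form n → Bool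
  absurd? (l ∷ L , r ∷ R) = (r <ᵇ l) ∧ dominates L R

  ∧-T : ∀ {a b} → T (a ∧ b) → T a × T b
  ∧-T {true} t = tt , t

  dominates-sound : ∀ {n} (u v w : Vec ℕ n) → T (dominates u v) → dot v w ≤ dot u w
  dominates-sound [] [] [] _ = z≤n
  dominates-sound (x ∷ u) (y ∷ v) (z ∷ w) t with ∧-T {y ≤ᵇ x} t
  ... | p , q = +-mono-≤ (*-monoˡ-≤ z (≤ᵇ⇒≤ y x p)) (dominates-sound u v w q)

  absurd-sound : ∀ {n} (ρ : Vec ℕ n) (P : Form n × Form n) → T (absurd? P) →
                 dot (proj₂ P) (1 ∷ ρ) < dot (proj₁ P) (1 ∷ ρ)
  absurd-sound ρ (l ∷ L , r ∷ R) t with ∧-T {r <ᵇ l} t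
  ... | p , q rewrite *-identityʳ l | *-identityʳ r = +-mono-<-≤ (<ᵇ⇒< r l p) (dominates-sound L R ρ q)

  -- Fourier–Motzkin elimination, used only to find the multipliers of a Farkas certificate; nothing about it is proved.

  Row : Set
  Row = List ℤ.ℤ × List ℕ

  addL : List ℤ.ℤ → List ℤ.ℤ → List ℤ.ℤ
  addL (x ∷ xs) (y ∷ ys) = (x ℤ.+ y) ∷ addL xs ys
  addL xs [] = xs
  addL [] ys = ys

  addN : List ℕ → List ℕ → List ℕ
  addN (x ∷ xs) (y ∷ ys) = (x + y) ∷ addN xs ys
  addN xs [] = xs
  addN [] ys = ys

  nth : ℕ → List ℤ.ℤ → ℤ.ℤ
  nth _       []       = ℤ.0ℤ
  nth zero    (x ∷ xs) = x
  nth (suc i) (x ∷ xs) = nth i xs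

  pos? neg? zero? : ℕ → Row → Bool
  pos? i (r , _) with nth i r
  ... | ℤ.+ (suc _) = true
  ... | _ = false
  neg? i (r , _) with nth i r
  ... | ℤ.-[1+ _ ] = true
  ... | _ = false
  zero? i r = not (pos? i r ∨ neg? i r)

  support : List ℕ → ℕ
  support []           = 0
  support (zero ∷ xs)  = support xs
  support (suc _ ∷ xs) = suc (support xs)

  cancel : ℕ → Row → Row → Row
  cancel i (p , c) (q , d) =
    addL (map (ℤ._*_ (ℤ.+ b)) p) (map (ℤ._*_ (ℤ.+ a)) q) , addN (map (b *_) c) (map (a *_) d)
    where
    a = ℤ.∣ nth i p ∣
    b = ℤ.∣ nth i q ∣

  -- The bound on the support discards combinations made redundant by others (Kohler's rule).
  eliminate : ℕ → ℕ → List Row → List Row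
  eliminate bound i rows =
    filterᵇ (zero? i) rows ++
    filterᵇ (λ r → support (proj₂ r) ≤ᵇ bound)
      (concatMap (λ p → map (cancel i p) (filterᵇ (neg? i) rows)) (filterᵇ (pos? i) rows))

  cost : List Row → ℕ → ℕ
  cost rows i = length (filterᵇ (pos? i) rows) * length (filterᵇ (neg? i) rows)

  cheapest : List Row → ℕ → List ℕ → ℕ × List ℕ
  cheapest rows i []       = i , []
  cheapest rows i (j ∷ js) with cheapest rows j js
  ... | m , rest = if cost rows i ≤ᵇ cost rows m then (i , j ∷ js) else (m , i ∷ rest)

  refute : ℕ → ℕ → List ℕ → List Row → List Row
  refute (suc fuel) bound (i ∷ is) rows with cheapest rows i is
  ... | m , rest = refute fuel (suc bound) rest (eliminate bound m rows)
  refute _ _ _ rows = filterᵇ (pos? 0) rows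

  indicator : ℕ → ℕ → List ℕ
  indicator zero    _       = []
  indicator (suc n) zero    = 1 ∷ indicator n n
  indicator (suc n) (suc i) = 0 ∷ indicator n i

  number : ∀ {A : Set} → ℕ → List A → List (ℕ × A)
  number i []       = []
  number i (x ∷ xs) = (i , x) ∷ number (suc i) xs

  certificate : ∀ {n} → List (Ineq n) → List ℕ
  -- The first elimination combines at most two of the original rows, and each further one raises
  -- the bound by one.
  certificate {n} hs with refute n 2 vars rows
    where
    vars = map suc (upTo n)
    total = length hs + n
    rows = map (λ { (i , (l , r)) →
                   Vec.toList (zipWith (λ x y → ℤ.+ x ℤ.- ℤ.+ y) (form l) (form r)) , indicator total i })
               (number 0 hs)
        -- These rows say that each variable is nonnegative. Their multipliers stand after those of
        -- `hs`, where `combine` no longer reads; they reappear as the slack that `dominates`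
        -- tolerates.
        ++ map (λ { (i , v) → map (λ w → if w ≡ᵇ v then ℤ.-1ℤ else ℤ.0ℤ) (0 ∷ vars) , indicator total i })
               (number (length hs) vars)
  ... | (_ , c) ∷ _ = c
  ... | [] = []

  inconsistent : ∀ {n} → List (Ineq n) → Bool
  inconsistent hs = absurd? (combine hs (certificate hs))

  inconsistent-sound : ∀ {n} (ρ : Vec ℕ n) hs → T (inconsistent hs) → Hold ρ hs → ⊥
  inconsistent-sound ρ hs t h =
    <⇒≱ (absurd-sound ρ (combine hs (certificate hs)) t) (combine-≤ ρ hs (certificate hs) h)

  assume : ∀ {n} → Rel n → List (Ineq n) → List (Ineq n)
  assume (e :≤ e′) hs = (e , e′) ∷ hs
  assume (e :< e′) hs = (con 1 :+ e , e′) ∷ hs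
  assume (e :≡ e′) hs = (e , e′) ∷ (e′ , e) ∷ hs
  assume :⊥        hs = (con 1 , con 0) ∷ hs

  -- The negated conclusion is refuted together with the hypotheses. Integrality enters only in that
  -- strict inequalities are made weak by adding `con 1`.
  valid : ∀ {n} → List (Ineq n) → Sequent n → Bool
  valid hs (r ⇒ s)       = valid (assume r hs) s
  valid hs (⊢ (e :≤ e′)) = inconsistent ((con 1 :+ e′ , e) ∷ hs)
  valid hs (⊢ (e :< e′)) = inconsistent ((e′ , e) ∷ hs)
  valid hs (⊢ (e :≡ e′)) = inconsistent ((con 1 :+ e′ , e) ∷ hs) ∧ inconsistent ((con 1 :+ e , e′) ∷ hs)
  valid hs (⊢ :⊥)        = inconsistent hs

  valid-sound : ∀ {n} (ρ : Vec ℕ n) hs s → T (valid hs s) → Hold ρ hs → ⟦ ρ ⟧ s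
  valid-sound ρ hs ((e :≤ e′) ⇒ s) t h p = valid-sound ρ _ s t (p , h)
  valid-sound ρ hs ((e :< e′) ⇒ s) t h p = valid-sound ρ _ s t (p , h)
  valid-sound ρ hs ((e :≡ e′) ⇒ s) t h p = valid-sound ρ _ s t (≤-reflexive p , ≤-reflexive (sym p) , h)
  valid-sound ρ hs (:⊥ ⇒ s) t h ()
  valid-sound ρ hs (⊢ (e :≤ e′)) t h = ≮⇒≥ λ lt → inconsistent-sound ρ _ t (lt , h)
  valid-sound ρ hs (⊢ (e :< e′)) t h = ≰⇒> λ le → inconsistent-sound ρ _ t (le , h)
  valid-sound ρ hs (⊢ (e :≡ e′)) t h with ∧-T {inconsistent ((con 1 :+ e′ , e) ∷ hs)} t
  ... | t₁ , t₂ = ≤-antisym (≮⇒≥ λ lt → inconsistent-sound ρ _ t₁ (lt , h))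
                            (≮⇒≥ λ lt → inconsistent-sound ρ _ t₂ (lt , h))
  valid-sound ρ hs (⊢ :⊥) t h = inconsistent-sound ρ hs t h

  abstract

    -- At each use the sequent is a closed term, so the implicit `T` of a Boolean evaluates to the
    -- unit type and is filled in by computation. The hypotheses of the sequent become the arguments
    -- that follow `ρ`.
    linear : ∀ n (f : N-ary n (Expr n) (Sequent n)) {_ : T (valid [] (f $ⁿ tabulate var))} →
             (ρ : Vec ℕ n) → ⟦ ρ ⟧ (f $ⁿ tabulate var)
    linear n f {t} ρ = valid-sound ρ [] (f $ⁿ tabulate var) t tt

open LinearArithmetic using (con; _:+_; _:*_; _:≤_; _:<_; _:≡_; :⊥; _⇒_; ⊢_; linear)

-- Booleans and decisions

⌊⌋-true : ∀ {P : Set} (d : Dec P) → P → ⌊ d ⌋ ≡ true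
⌊⌋-true (yes _) _ = refl
⌊⌋-true (no ¬p) p = ⊥-elim (¬p p)

⌊⌋-sound : ∀ {P : Set} (d : Dec P) → ⌊ d ⌋ ≡ true → P
⌊⌋-sound (yes p) _ = p

⌊⌋-false : ∀ {P : Set} (d : Dec P) → ¬ P → ⌊ d ⌋ ≡ false
⌊⌋-false (yes p) ¬p = ⊥-elim (¬p p)
⌊⌋-false (no _)  _  = refl

∧-true : ∀ {a b} → a ≡ true → b ≡ true → a ∧ b ≡ true
∧-true refl refl = refl

∧-split : ∀ {a b} → a ∧ b ≡ true → a ≡ true × b ≡ true
∧-split {true} p = refl , p

∨-split : ∀ {a b} → a ∨ b ≡ true → a ≡ true ⊎ b ≡ true
∨-split {true}  _ = inj₁ refl
∨-split {false} p = inj₂ p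

∨-trueʳ : ∀ {a b} → b ≡ true → a ∨ b ≡ true
∨-trueʳ {true}  _ = refl
∨-trueʳ {false} p = p

≡true⇒T : ∀ {b} → b ≡ true → T b
≡true⇒T refl = tt

T⇒≡true : ∀ {b} → T b → b ≡ true
T⇒≡true {true} _ = refl

module _ {A : Set} (p : A → Bool) where

  all-true : ∀ xs → (∀ {x} → x ∈ xs → p x ≡ true) → all p xs ≡ true
  all-true []       h = refl
  all-true (x ∷ xs) h = ∧-true (h (here refl)) (all-true xs (h ∘ there))

  all-lookup : ∀ {xs x} → all p xs ≡ true → x ∈ xs → p x ≡ true
  all-lookup e (here refl) = proj₁ (∧-split e)
  all-lookup e (there i)   = all-lookup (proj₂ (∧-split e)) i

  any-true : ∀ {xs x} → x ∈ xs → p x ≡ true → any p xs ≡ true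
  any-true (here refl) e rewrite e = refl
  any-true {y ∷ _} (there i) e = ∨-trueʳ {p y} (any-true i e)

  any-witness : ∀ xs → any p xs ≡ true → ∃ λ x → x ∈ xs × p x ≡ true
  any-witness (x ∷ xs) e with ∨-split {p x} e
  ... | inj₁ px = x , here refl , px
  ... | inj₂ e′ with any-witness xs e′
  ...   | y , i , py = y , there i , py

-- Counting

-- The pigeonhole principle, for a coding relation `R` under which one code cannot belong to two
-- distinct elements. Distinctness is a parameter because labelings are functions and can be told
-- apart only pointwise.
injection-length : ∀ {A C : Set} (R : A → C → Set) (D : A → A → Set) →
  (∀ {x y c} → R x c → R y c → ¬ D x y) → ∀ xs cs → AllPairs D xs →
  (∀ {x} → x ∈ xs → ∃ λ c → c ∈ cs × R x c) → length xs ≤ length cs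
injection-length R D inj []       cs _ _ = z≤n
injection-length R D inj (x ∷ xs) cs (d ∷ ds) code with code (here refl)
... | c , c∈ , rc with ∈-∃++ c∈
... | ls , rs , refl = subst (suc (length xs) ≤_) (sym eq)
        (s≤s (injection-length R D inj xs (ls ++ rs) ds code′))
  where
  eq : length (ls ++ c ∷ rs) ≡ suc (length (ls ++ rs))
  eq rewrite length-++ ls {c ∷ rs} | length-++ ls {rs} = +-suc _ _
  code′ : ∀ {y} → y ∈ xs → ∃ λ e → e ∈ ls ++ rs × R y e
  code′ {y} y∈ with code (there y∈)
  ... | e , e∈ , re with ∈-++⁻ ls e∈
  ...   | inj₁ i           = e , ∈-++⁺ˡ i , re
  ...   | inj₂ (here refl) = ⊥-elim (inj rc re (All.lookup d y∈))
  ...   | inj₂ (there i)   = e , ∈-++⁺ʳ ls i , re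

sum-map-≤ : ∀ {A : Set} (f g : A → ℕ) xs → (∀ {x} → x ∈ xs → f x ≤ g x) → sum (map f xs) ≤ sum (map g xs)
sum-map-≤ f g []       h = z≤n
sum-map-≤ f g (x ∷ xs) h = +-mono-≤ (h (here refl)) (sum-map-≤ f g xs (h ∘ there))

sum-map-< : ∀ {A : Set} (f g : A → ℕ) {y} xs → (∀ {x} → x ∈ xs → f x ≤ g x) → y ∈ xs → f y < g y →
            sum (map f xs) < sum (map g xs)
sum-map-< f g (x ∷ xs) h (here refl) lt = +-mono-<-≤ lt (sum-map-≤ f g xs (h ∘ there))
sum-map-< f g (x ∷ xs) h (there i)   lt = +-mono-≤-< (h (here refl)) (sum-map-< f g xs (h ∘ there) i lt)

∈⇒≤sum : ∀ {A : Set} (f : A → ℕ) {x} xs → x ∈ xs → f x ≤ sum (map f xs)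
∈⇒≤sum f (x ∷ xs) (here refl) = m≤m+n _ _
∈⇒≤sum f (x ∷ xs) (there i)   = ≤-trans (∈⇒≤sum f xs i) (m≤n+m _ _)

bit : Bool → ℕ
bit b = if b then 1 else 0

bit-mono : ∀ {a b} → (a ≡ true → b ≡ true) → bit a ≤ bit b
bit-mono {false} h = z≤n
bit-mono {true}  h rewrite h refl = ≤-refl

sum-bits : ∀ {A : Set} (p : A → Bool) xs → sum (map (bit ∘ p) xs) ≡ length (filterᵇ p xs)
sum-bits p []       = refl
sum-bits p (x ∷ xs) with p x
... | true  = cong suc (sum-bits p xs)
... | false = sum-bits p xs

module _ {m : ℕ} (U : VSet m) where

  members : List (Fin m)
  members = filterᵇ U (allFin m)

  count≡length : count U ≡ length members
  count≡length = sum-bits U (allFin m)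

  members-unique : Unique members
  members-unique = Unique.filter⁺ _ (Unique.allFin⁺ m)

  count-≤ : (xs : List ℕ) → (∀ v → U v ≡ true → toℕ v ∈ xs) → count U ≤ length xs
  count-≤ xs h rewrite count≡length =
    injection-length (λ v x → toℕ v ≡ x) _≢_ (λ { p q v≢w → v≢w (Fin.toℕ-injective (trans p (sym q))) })
      members xs members-unique λ {v} i → toℕ v , h v (T⇒≡true (proj₂ (∈-filter⁻ _ {xs = allFin m} i))) , refl

  count-≥ : (xs : List ℕ) → Unique xs → (∀ {x} → x ∈ xs → ∃ λ v → toℕ v ≡ x × U v ≡ true) → length xs ≤ count U
  count-≥ xs u h rewrite count≡length =
    injection-length (λ x v → toℕ v ≡ x) _≢_ (λ { p q x≢y → x≢y (trans (sym p) q) }) xs members u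
      λ i → let (v , e , t) = h i in v , ∈-filter⁺ _ (∈-allFin v) (≡true⇒T t) , e

interval : ℕ → ℕ → List ℕ
interval s d = applyUpTo (s +_) d

interval-unique : ∀ s d → Unique (interval s d)
interval-unique s d = Unique.applyUpTo⁺₁ (s +_) d λ i<j _ e → <⇒≢ i<j (+-cancelˡ-≡ s _ _ e)

∈-interval⁺ : ∀ {x} s d → s ≤ x → x < s + d → x ∈ interval s d
∈-interval⁺ {x} s d p q = subst (_∈ interval s d) (m+[n∸m]≡n p)
  (∈-applyUpTo⁺ (s +_) (+-cancelˡ-< s _ _ (subst (_< s + d) (sym (m+[n∸m]≡n p)) q)))

∈-interval⁻ : ∀ {x} s d → x ∈ interval s d → s ≤ x × x < s + d
∈-interval⁻ s d i with ∈-applyUpTo⁻ (s +_) i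
... | j , j<d , refl = m≤m+n s j , +-monoʳ-< s j<d

length-interval : ∀ s d → length (interval s d) ≡ d
length-interval s d = length-applyUpTo (s +_) d

module _ {m : ℕ} (U : VSet m) (s d : ℕ) where

  count-≤-interval : (∀ v → U v ≡ true → s ≤ toℕ v × toℕ v < s + d) → count U ≤ d
  count-≤-interval h = subst (count U ≤_) (length-interval s d)
    (count-≤ U _ λ v t → ∈-interval⁺ s d (proj₁ (h v t)) (proj₂ (h v t)))

  count-≥-interval : s + d ≤ m → (∀ v → s ≤ toℕ v → toℕ v < s + d → U v ≡ true) → d ≤ count U
  count-≥-interval s+d≤m h = subst (_≤ count U) (length-interval s d)
    (count-≥ U _ (interval-unique s d) λ {x} i → let (p , q) = ∈-interval⁻ s d i ; x<m = <-≤-trans q s+d≤m in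
      fromℕ< x<m , Fin.toℕ-fromℕ< x<m ,
      h (fromℕ< x<m) (subst (s ≤_) (sym (Fin.toℕ-fromℕ< x<m)) p) (subst (_< s + d) (sym (Fin.toℕ-fromℕ< x<m)) q))

module _ {A : Set} (t : ℕ) where

  weight : List (List A) → ℕ
  weight = sum ∘ map (λ S → t ^ length S)

  weight-∷ : ∀ x Ss → weight (map (x ∷_) Ss) ≡ t * weight Ss
  weight-∷ x []       = sym (*-zeroʳ t)
  weight-∷ x (S ∷ Ss) rewrite weight-∷ x Ss = sym (*-distribˡ-+ t (t ^ length S) (weight Ss))

  weight-sublists : ∀ xs → weight (sublists xs) ≡ suc t ^ length xs
  weight-sublists []       = refl
  weight-sublists (x ∷ xs)
    rewrite map-++ (λ S → t ^ length S) (sublists xs) (map (x ∷_) (sublists xs))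
          | sum-++ (map (λ S → t ^ length S) (sublists xs)) (map (λ S → t ^ length S) (map (x ∷_) (sublists xs)))
          | weight-∷ x (sublists xs) | weight-sublists xs = refl

  -- The generating function (1 + t)^N of the sublists by length dominates each of its terms.
  sublists-of-length : ∀ (p : List A → Bool) ℓ xs → (∀ S → p S ≡ true → length S ≡ ℓ) →
                       length (filterᵇ p (sublists xs)) * t ^ ℓ ≤ suc t ^ length xs
  sublists-of-length p ℓ xs h = ≤-trans (go (sublists xs)) (≤-reflexive (weight-sublists xs))
    where
    go : ∀ Ss → length (filterᵇ p Ss) * t ^ ℓ ≤ weight Ss
    go []       = z≤n
    go (S ∷ Ss) with p S in e
    ... | false = ≤-trans (go Ss) (m≤n+m _ _)
    ... | true  = +-mono-≤ (≤-reflexive (cong (t ^_) (sym (h S e)))) (go Ss)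

filter∈sublists : ∀ {A : Set} (p : A → Bool) xs → filterᵇ p xs ∈ sublists xs
filter∈sublists p []       = here refl
filter∈sublists p (x ∷ xs) with p x
... | true  = ∈-++⁺ʳ (sublists xs) (∈-map⁺ (x ∷_) (filter∈sublists p xs))
... | false = ∈-++⁺ˡ (filter∈sublists p xs)

-- Connectivity

module _ {m : ℕ} (E : Fin m → Fin m → Bool) (U : VSet m) where

  Closed : (Fin m → Set) → Set
  Closed R = ∀ u v → R u → U u ≡ true → U v ≡ true → E u v ≡ true → R v

  Link : Fin m → Fin m → Set
  Link u v = U u ≡ true × U v ≡ true × E u v ≡ true

  reachStep-elim : ∀ S v → reachStep E U S v ≡ true →
                   S v ≡ true ⊎ (U v ≡ true × ∃ λ u → S u ≡ true × E u v ≡ true)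
  reachStep-elim S v e with ∨-split {S v} e
  ... | inj₁ s = inj₁ s
  ... | inj₂ r with ∧-split {U v} r
  ... | Uv , a with any-witness (λ u → S u ∧ E u v) (allFin m) a
  ... | u , _ , su = inj₂ (Uv , u , ∧-split {S u} su)

  reachStep-mono : ∀ S v → S v ≡ true → reachStep E U S v ≡ true
  reachStep-mono S v s rewrite s = refl

  reachStep-intro : ∀ S u v → S u ≡ true → U v ≡ true → E u v ≡ true → reachStep E U S v ≡ true
  reachStep-intro S u v s t e =
    ∨-trueʳ {S v} (∧-true t (any-true (λ u → S u ∧ E u v) (∈-allFin u) (∧-true s e)))

  reachIter-mono : ∀ k S v → S v ≡ true → reachIter k E U S v ≡ true
  reachIter-mono zero    S v s = s
  reachIter-mono (suc k) S v s = reachIter-mono k _ v (reachStep-mono S v s)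

  reachIter-⊆ : (R : Fin m → Set) → Closed R → ∀ k S → (∀ v → S v ≡ true → U v ≡ true × R v) →
                ∀ v → reachIter k E U S v ≡ true → R v
  reachIter-⊆ R cl zero    S h v e = proj₂ (h v e)
  reachIter-⊆ R cl (suc k) S h v e = reachIter-⊆ R cl k (reachStep E U S) h′ v e
    where
    h′ : ∀ v → reachStep E U S v ≡ true → U v ≡ true × R v
    h′ v e with reachStep-elim S v e
    ... | inj₁ s = h v s
    ... | inj₂ (t , u , s , e′) = t , cl u v (proj₂ (h u s)) (proj₁ (h u s)) t e′

  -- The induction principle contained in the Boolean test. Connectivity of the parts enters the
  -- structure theory of balanced partitions in this form.
  connected⇒closed : connectedOnᵇ E U ≡ true → (R : Fin m → Set) → Closed R →
                     ∀ u v → U u ≡ true → U v ≡ true → R u → R v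
  connected⇒closed c R cl u v Uu Uv r = reachIter-⊆ R cl m (single u) base v reach
    where
    row = all-lookup _ c (∈-allFin u)
    reach : reachable E U u v ≡ true
    reach with all-lookup (λ v → not (U u ∧ U v) ∨ reachable E U u v) row (∈-allFin v)
    ... | e rewrite Uu | Uv = e
    base : ∀ w → single u w ≡ true → U w ≡ true × R w
    base w e with ⌊⌋-sound (u Fin.≟ w) e
    ... | refl = Uu , r

  Saturated : VSet m → Set
  Saturated S = ∀ u v → S u ≡ true → U v ≡ true → E u v ≡ true → S v ≡ true

  saturated-step : ∀ S → Saturated S → Saturated (reachStep E U S)
  saturated-step S sat u v su Uv e with reachStep-elim S u su
  ... | inj₁ s = reachStep-mono S v (sat u v s Uv e)
  ... | inj₂ (Uu , w , s , e′) = reachStep-mono S v (sat u v (sat w u s Uu e′) Uv e)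

  saturated-iter : ∀ k S → Saturated S → Saturated (reachIter k E U S)
  saturated-iter zero    S sat = sat
  saturated-iter (suc k) S sat = saturated-iter k _ (saturated-step S sat)

  -- A round that reaches nothing new leaves a set closed under edges for good, and every other
  -- round adds a vertex.
  grow : ∀ k S → Saturated (reachIter k E U S) ⊎ (k + count S ≤ count (reachIter k E U S))
  grow zero    S = inj₂ ≤-refl
  grow (suc k) S with Fin.any? (λ u → Fin.any? (λ v → (S u Bool.≟ true) ×-dec (U v Bool.≟ true) ×-dec (E u v Bool.≟ true) ×-dec (S v Bool.≟ false)))
  ... | no ¬ex = inj₁ (saturated-iter (suc k) S sat)
    where
    sat : Saturated S
    sat u v s t e with S v in eq
    ... | true  = refl
    ... | false = ⊥-elim (¬ex (u , v , s , t , e , eq))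
  ... | yes (u , v , s , t , e , ¬s) with grow k (reachStep E U S)
  ...   | inj₁ sat = inj₁ sat
  ...   | inj₂ le = inj₂ (≤-trans (≤-reflexive (sym (+-suc k _))) (≤-trans (+-monoʳ-≤ k bigger) le))
    where
    bigger : count S < count (reachStep E U S)
    bigger = sum-map-< (bit ∘ S) (bit ∘ reachStep E U S) (allFin m) (λ {x} _ → bit-mono (reachStep-mono S x)) (∈-allFin v)
      (subst₂ (λ a b → bit a < bit b) (sym ¬s) (sym (reachStep-intro S u v s t e)) (s≤s z≤n))

  count≤m : ∀ S → count S ≤ m
  count≤m S = count-≤-interval S 0 m λ v _ → z≤n , Fin.toℕ<n v

  reachable-saturated : ∀ u → Saturated (reachable E U u)
  reachable-saturated u with grow m (single u)
  ... | inj₁ sat = sat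
  -- The start contains one vertex, so `m` rounds that all add a vertex would reach `m + 1` of them.
  ... | inj₂ le = ⊥-elim (<⇒≱ (≤-trans (subst (_≤ m + count (single u)) (+-comm m 1) (+-monoʳ-≤ m one)) le) (count≤m _))
    where
    one : 1 ≤ count (single u)
    one = ≤-trans (≤-reflexive (cong bit (sym (⌊⌋-true (u Fin.≟ u) refl)))) (∈⇒≤sum (bit ∘ single u) (allFin m) (∈-allFin u))

  paths⇒connected : (∀ u v → U u ≡ true → U v ≡ true → Star Link u v) → connectedOnᵇ E U ≡ true
  paths⇒connected paths = all-true _ (allFin m) λ {u} _ → all-true _ (allFin m) λ {v} _ → lemma u v
    where
    follow : ∀ {u v w} → Star Link v w → reachable E U u v ≡ true → reachable E U u w ≡ true
    follow ε r = r
    follow {u} ((_ , t , e) ◅ p) r = follow p (reachable-saturated u _ _ r t e)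
    lemma : ∀ u v → not (U u ∧ U v) ∨ reachable E U u v ≡ true
    lemma u v with U u in Uu | U v in Uv
    ... | false | _     = refl
    ... | true  | false = refl
    ... | true  | true  = follow (paths u v Uu Uv) (reachIter-mono m _ u (⌊⌋-true (u Fin.≟ u) refl))

  root⇒connected : (∀ u v → E u v ≡ true → E v u ≡ true) → (r : Fin m) → (∀ v → U v ≡ true → Star Link v r) →
                   connectedOnᵇ E U ≡ true
  root⇒connected E-sym r to = paths⇒connected λ u v Uu Uv → to u Uu ◅◅ Star.reverse flip (to v Uv)
    where
    flip : ∀ {x y} → Link x y → Link y x
    flip (a , b , e) = b , a , E-sym _ _ e

-- Labelings, valid partitions and bounds for their total weight

module _ {m : ℕ} (f : Labeling m) where

  part-true : ∀ {i} v → f v ≡ i → part f i v ≡ true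
  part-true v e = ⌊⌋-true (f v Fin.≟ _) e

  part-sound : ∀ {i} v → part f i v ≡ true → f v ≡ i
  part-sound v e = ⌊⌋-sound (f v Fin.≟ _) e

module _ {A B : Set} {L : List A} {h₀ h₁ h₂ : A → B} {x : A} (i : x ∈ L) where

  in-block₀ : h₀ x ∈ map h₀ L ++ map h₁ L ++ map h₂ L ++ []
  in-block₀ = ∈-++⁺ˡ (∈-map⁺ h₀ i)

  in-block₁ : h₁ x ∈ map h₀ L ++ map h₁ L ++ map h₂ L ++ []
  in-block₁ = ∈-++⁺ʳ (map h₀ L) (∈-++⁺ˡ (∈-map⁺ h₁ i))

  in-block₂ : h₂ x ∈ map h₀ L ++ map h₁ L ++ map h₂ L ++ []
  in-block₂ = ∈-++⁺ʳ (map h₀ L) (∈-++⁺ʳ (map h₁ L) (∈-++⁺ˡ (∈-map⁺ h₂ i)))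

-- Labelings are functions, so the list can only be shown to contain a pointwise equal copy of `f`.
allLabelings-complete : ∀ m (f : Labeling m) → ∃ λ g → g ∈ allLabelings m × (∀ v → g v ≡ f v)
allLabelings-complete zero    f = _ , here refl , λ ()
allLabelings-complete (suc m) f with allLabelings-complete m (f ∘ fs) | f fz in e
... | g , g∈ , eq | fz         = _ , in-block₀ g∈ , λ { fz → sym e ; (fs v) → eq v }
... | g , g∈ , eq | fs fz      = _ , in-block₁ g∈ , λ { fz → sym e ; (fs v) → eq v }
... | g , g∈ , eq | fs (fs fz) = _ , in-block₂ g∈ , λ { fz → sym e ; (fs v) → eq v }

Differ : ∀ {m} → Labeling m → Labeling m → Set
Differ f g = ¬ (∀ v → f v ≡ g v)

module _ {m : ℕ} {L : List (Labeling m)} where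

  map-distinct : (h : Labeling m → Labeling (suc m)) → (∀ f v → h f (fs v) ≡ f v) →
                 AllPairs Differ L → AllPairs Differ (map h L)
  map-distinct h tail ds =
    AllPairs.map⁺ (AllPairs.map (λ {f} {g} d e → d λ v → trans (sym (tail f v)) (trans (e (fs v)) (tail g v))) ds)

  map-apart : (h h′ : Labeling m → Labeling (suc m)) → (∀ f g → h f fz ≢ h′ g fz) →
              All (λ f → All (Differ f) (map h′ L)) (map h L)
  map-apart h h′ apart = All.map⁺ (All.tabulate λ _ → All.map⁺ (All.tabulate λ _ e → apart _ _ (e fz)))

allLabelings-distinct : ∀ m → AllPairs Differ (allLabelings m)
allLabelings-distinct zero    = [] ∷ []
allLabelings-distinct (suc m) =
  AllPairs.++⁺ (map-distinct _ (λ _ _ → refl) ds)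
    (AllPairs.++⁺ (map-distinct _ (λ _ _ → refl) ds)
      (AllPairs.++⁺ (map-distinct _ (λ _ _ → refl) ds) [] (All.tabulate λ _ → []))
      (join (map-apart _ _ λ f g ()) (All.tabulate λ _ → [])))
    (join (map-apart _ _ λ f g ()) (join (map-apart _ _ λ f g ()) (All.tabulate λ _ → [])))
  where
  ds = allLabelings-distinct m
  join : ∀ {P : Labeling (suc m) → Labeling (suc m) → Set} {xs ys zs} →
         All (λ f → All (P f) ys) xs → All (λ f → All (P f) zs) xs → All (λ f → All (P f) (ys ++ zs)) xs
  join ps qs = All.zipWith (λ { (p , q) → All.++⁺ p q }) (ps , qs)

≡ᵇ-sound : ∀ {a b} → (a ≡ᵇ b) ≡ true → a ≡ b
≡ᵇ-sound {a} {b} e = ≡ᵇ⇒≡ a b (≡true⇒T e)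

≡ᵇ-refl : ∀ a → (a ≡ᵇ a) ≡ true
≡ᵇ-refl a = T⇒≡true (≡⇒≡ᵇ a a refl)

conj₃ : ∀ {a b c} → a ∧ b ∧ c ≡ true → a ≡ true × b ≡ true × c ≡ true
conj₃ e with ∧-split e
... | p , r = p , ∧-split r

multisetEq-const : ∀ s₀ s₁ s₂ n → multisetEqᵇ s₀ s₁ s₂ n n n ≡ true → s₀ ≡ n × s₁ ≡ n × s₂ ≡ n
multisetEq-const s₀ s₁ s₂ n e with (s₀ ≡ᵇ n) ∧ (s₁ ≡ᵇ n) ∧ (s₂ ≡ᵇ n) in eq
... | true  = let (p , q , r) = conj₃ {s₀ ≡ᵇ n} eq in ≡ᵇ-sound p , ≡ᵇ-sound q , ≡ᵇ-sound r
multisetEq-const s₀ s₁ s₂ n () | false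

multisetEq-refl : ∀ s₀ s₁ s₂ → multisetEqᵇ s₀ s₁ s₂ s₀ s₁ s₂ ≡ true
multisetEq-refl s₀ s₁ s₂ rewrite ≡ᵇ-refl s₀ | ≡ᵇ-refl s₁ | ≡ᵇ-refl s₂ = refl

module _ {m : ℕ} (G : Graph m) (f : Labeling m) where

  IsPart : ℕ → Fin 3 → Set
  IsPart n i = count (part f i) ≡ n × inducedConnectedᵇ G (part f i) ≡ true

  good⇒connected : ∀ i → goodPartᵇ G f i ≡ true → inducedConnectedᵇ G (part f i) ≡ true
  good⇒connected i e = proj₂ (∧-split {1 ≤ᵇ count (part f i)} e)

  balanced⇒parts : ∀ n → balancedᵇ G n f ≡ true → ∀ i → IsPart n i
  balanced⇒parts n e i with ∧-split {goodPartᵇ G f i0} e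
  ... | g₀ , e₁ with ∧-split {goodPartᵇ G f i1} e₁
  ... | g₁ , e₂ with ∧-split {goodPartᵇ G f i2} e₂
  ... | g₂ , e₃ with multisetEq-const (count (part f i0)) (count (part f i1)) (count (part f i2)) n e₃
  balanced⇒parts n e fz | g₀ , _ | g₁ , _ | g₂ , _ | c₀ , c₁ , c₂ = c₀ , good⇒connected _ g₀
  balanced⇒parts n e (fs fz) | g₀ , _ | g₁ , _ | g₂ , _ | c₀ , c₁ , c₂ = c₁ , good⇒connected _ g₁
  balanced⇒parts n e (fs (fs fz)) | g₀ , _ | g₁ , _ | g₂ , _ | c₀ , c₁ , c₂ = c₂ , good⇒connected _ g₂

  part⇒good : ∀ n i → 1 ≤ n → IsPart n i → goodPartᵇ G f i ≡ true
  part⇒good n i 1≤n (refl , c) = ∧-true (T⇒≡true (≤⇒≤ᵇ 1≤n)) c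

  parts⇒valid : ∀ a b c → 1 ≤ a → 1 ≤ b → 1 ≤ c → IsPart a i0 → IsPart b i1 → IsPart c i2 → validᵇ G a b c f ≡ true
  parts⇒valid a b c 1≤a 1≤b 1≤c p@(ea , _) q@(eb , _) r@(ec , _) =
    ∧-true (part⇒good a i0 1≤a p) (∧-true (part⇒good b i1 1≤b q) (∧-true (part⇒good c i2 1≤c r) sizes))
    where
    sizes : multisetEqᵇ (count (part f i0)) (count (part f i1)) (count (part f i2)) a b c ≡ true
    sizes rewrite ea | eb | ec = multisetEq-refl a b c

sum-select-≤ : ∀ {A : Set} (p : A → Bool) (w : A → ℕ) t b xs → (∀ x → p x ≡ true → w x * t ≤ b) →
               sum (map (λ x → if p x then w x else 0) xs) * t ≤ length (filterᵇ p xs) * b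
sum-select-≤ p w t b []       h = z≤n
sum-select-≤ p w t b (x ∷ xs) h with p x in e
... | false = sum-select-≤ p w t b xs h
... | true  = ≤-trans (≤-reflexive (*-distribʳ-+ t (w x) _)) (+-mono-≤ (h x e) (sum-select-≤ p w t b xs h))

module _ {m : ℕ} (G : Graph m) (a b c : ℕ) where

  -- The terms and the number of nonzero terms are bounded separately: valid labelings in the list
  -- differ pairwise and each is decoded from some code. The factor `t` stays on the left because
  -- the bound for a single term is a quotient.
  Wlab-≤ : ∀ {C : Set} t B (decode : C → Labeling m) (codes : List C) →
           (∀ f → validᵇ G a b c f ≡ true → τP G f * t ≤ B) →
           (∀ f → validᵇ G a b c f ≡ true → ∃ λ k → k ∈ codes × (∀ v → f v ≡ decode k v)) →
           Wlab G a b c * t ≤ length codes * B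
  Wlab-≤ t B decode codes bound code = ≤-trans
    (sum-select-≤ (validᵇ G a b c) (τP G) t B (allLabelings m) bound)
    (*-monoˡ-≤ B (injection-length (λ f k → ∀ v → f v ≡ decode k v) Differ
      (λ p q d → d λ v → trans (p v) (sym (q v))) _ codes
      (AllPairs.filter⁺ _ (allLabelings-distinct m))
      λ {f} i → code f (T⇒≡true (proj₂ (∈-filter⁻ _ {xs = allLabelings m} i)))))

  Wlab-≥ : ∀ f → f ∈ allLabelings m → validᵇ G a b c f ≡ true → τP G f ≤ Wlab G a b c
  Wlab-≥ f i e = ≤-trans (≤-reflexive (sym (cong (λ b → if b then τP G f else 0) e)))
    (∈⇒≤sum (λ f → if validᵇ G a b c f then τP G f else 0) (allLabelings m) i)

count-parts : ∀ {m} (f : Labeling m) → count (part f i0) + count (part f i1) + count (part f i2) ≡ m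
count-parts {m} f = trans (go (allFin m)) (length-tabulate id)
  where
  go : ∀ xs → sum (map (bit ∘ part f i0) xs) + sum (map (bit ∘ part f i1) xs) + sum (map (bit ∘ part f i2) xs) ≡ length xs
  go [] = refl
  go (x ∷ xs) with f x
  ... | fz         = cong suc (go xs)
  ... | fs fz      = trans (cong (_+ sum (map (bit ∘ part f i2) xs)) (+-suc (sum (map (bit ∘ part f i0) xs)) _)) (cong suc (go xs))
  ... | fs (fs fz) = trans (+-suc (sum (map (bit ∘ part f i0) xs) + sum (map (bit ∘ part f i1) xs)) _) (cong suc (go xs))

-- The graph

module Edges (k a : ℕ) (a≡ : a ≡ 5 * k + 1) where

  1≤a : 1 ≤ a
  1≤a = subst (1 ≤_) (sym a≡) (m≤n+m 1 (5 * k))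

  2a≤6a : 2 * a ≤ 6 * a
  2a≤6a = linear 1 (λ a → con 1 :≤ a ⇒ ⊢ 2 :* a :≤ 6 :* a) (a ∷ []) 1≤a
  2a<3a : 2 * a < 3 * a
  2a<3a = linear 1 (λ a → con 1 :≤ a ⇒ ⊢ 2 :* a :< 3 :* a) (a ∷ []) 1≤a
  3a<5a : 3 * a < 5 * a
  3a<5a = linear 1 (λ a → con 1 :≤ a ⇒ ⊢ 3 :* a :< 5 :* a) (a ∷ []) 1≤a
  5a<6a : 5 * a < 6 * a
  5a<6a = linear 1 (λ a → con 1 :≤ a ⇒ ⊢ 5 :* a :< 6 :* a) (a ∷ []) 1≤a
  3a<6a : 3 * a < 6 * a
  3a<6a = linear 1 (λ a → con 1 :≤ a ⇒ ⊢ 3 :* a :< 6 :* a) (a ∷ []) 1≤a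
  2a<6a : 2 * a < 6 * a
  2a<6a = linear 1 (λ a → con 1 :≤ a ⇒ ⊢ 2 :* a :< 6 :* a) (a ∷ []) 1≤a
  0<6a : 0 < 6 * a
  0<6a = linear 1 (λ a → con 1 :≤ a ⇒ ⊢ con 0 :< 6 :* a) (a ∷ []) 1≤a
  5a≡ : 5 * a ≡ 3 * a + 2 * a
  5a≡ = *-distribʳ-+ a 3 2

  -- The vertices 0 .. 6a - 1 are numbered along a Hamilton cycle. The lobes are [0 , 2a] and [3a , 5a]; in each of them
  -- chord q joins the vertices at distance 5q from the two ends. Rotation by 3a is a symmetry exchanging the lobes.
  data Edge< (u v : ℕ) : Set where
    rail   : v ≡ suc u → Edge< u v
    wrap   : u ≡ 0 → suc v ≡ 6 * a → Edge< u v
    chordL : ∀ q → q ≤ k → u ≡ 5 * q → u + v ≡ 2 * a → Edge< u v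
    chordR : ∀ q → q ≤ k → u ≡ 3 * a + 5 * q → u + v ≡ 8 * a → Edge< u v

  Adj : ℕ → ℕ → Set
  Adj u v = Edge< u v ⊎ Edge< v u

  edge? : ∀ u v → Dec (Edge< u v)
  edge? u v = map′ to from
    (v ≟ suc u ⊎-dec (u ≟ 0 ×-dec suc v ≟ 6 * a)
      ⊎-dec anyUpTo? (λ q → u ≟ 5 * q ×-dec u + v ≟ 2 * a) (suc k)
      ⊎-dec anyUpTo? (λ q → u ≟ 3 * a + 5 * q ×-dec u + v ≟ 8 * a) (suc k))
    where
    to : _ → Edge< u v
    to (inj₁ e) = rail e
    to (inj₂ (inj₁ (e , e′))) = wrap e e′
    to (inj₂ (inj₂ (inj₁ (q , s≤s l , e , e′)))) = chordL q l e e′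
    to (inj₂ (inj₂ (inj₂ (q , s≤s l , e , e′)))) = chordR q l e e′
    from : Edge< u v → _
    from (rail e) = inj₁ e
    from (wrap e e′) = inj₂ (inj₁ (e , e′))
    from (chordL q l e e′) = inj₂ (inj₂ (inj₁ (q , s≤s l , e , e′)))
    from (chordR q l e e′) = inj₂ (inj₂ (inj₂ (q , s≤s l , e , e′)))

  adj? : ∀ u v → Dec (Adj u v)
  adj? u v = edge? u v ⊎-dec edge? v u

  edge-< : ∀ {u v} → Edge< u v → u < v
  edge-< {u} {v} (rail refl) = ≤-refl
  edge-< {u} {v} (wrap e e′) = linear 4 (λ a k u v → a :≡ 5 :* k :+ con 1 ⇒ u :≡ con 0 ⇒ con 1 :+ v :≡ 6 :* a ⇒ ⊢ u :< v)
          (a ∷ k ∷ u ∷ v ∷ []) a≡ e e′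
  edge-< {u} {v} (chordL q l e e′) = linear 5 (λ a k q u v → a :≡ 5 :* k :+ con 1 ⇒ q :≤ k ⇒ u :≡ 5 :* q ⇒ u :+ v :≡ 2 :* a ⇒ ⊢ u :< v)
          (a ∷ k ∷ q ∷ u ∷ v ∷ []) a≡ l e e′
  edge-< {u} {v} (chordR q l e e′) = linear 5 (λ a k q u v → a :≡ 5 :* k :+ con 1 ⇒ q :≤ k ⇒ u :≡ 3 :* a :+ 5 :* q ⇒ u :+ v :≡ 8 :* a ⇒ ⊢ u :< v)
          (a ∷ k ∷ q ∷ u ∷ v ∷ []) a≡ l e e′

  adj-irrefl : ∀ {u} → ¬ Adj u u
  adj-irrefl (inj₁ e) = <-irrefl refl (edge-< e)
  adj-irrefl (inj₂ e) = <-irrefl refl (edge-< e)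

  isYes-⇔ : ∀ {A B : Set} (p : Dec A) (q : Dec B) → (A → B) → (B → A) → ⌊ p ⌋ ≡ ⌊ q ⌋
  isYes-⇔ p q f g = trans (isYes≗does p) (trans (does-⇔ (mk⇔ f g) p q) (sym (isYes≗does q)))

  graph : ∀ m → Graph m
  graph m = record
    { adj    = λ u v → ⌊ adj? (toℕ u) (toℕ v) ⌋
    ; sym    = λ u v → isYes-⇔ (adj? (toℕ u) (toℕ v)) (adj? (toℕ v) (toℕ u)) swap swap
    ; irrefl = λ u → ⌊⌋-false (adj? (toℕ u) (toℕ u)) adj-irrefl
    }

  module _ {m : ℕ} {u v : Fin m} where

    adj-true : Adj (toℕ u) (toℕ v) → adj (graph m) u v ≡ true
    adj-true = ⌊⌋-true (adj? (toℕ u) (toℕ v))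

    adj-sound : adj (graph m) u v ≡ true → Adj (toℕ u) (toℕ v)
    adj-sound = ⌊⌋-sound (adj? (toℕ u) (toℕ v))

-- Balanced partitions consist of three arcs of the Hamilton cycle

module Structure (k a : ℕ) (a≡ : a ≡ 5 * k + 1) where

  open Edges k a a≡

  abstract

    exhaust : ∀ (x y z w : Fin 3) → x ≢ y → y ≢ z → x ≢ z → w ≡ x ⊎ w ≡ y ⊎ w ≡ z
    exhaust = toWitness {a? = Fin.all? λ x → Fin.all? λ y → Fin.all? λ z → Fin.all? λ w →
      ¬? (x Fin.≟ y) →-dec ¬? (y Fin.≟ z) →-dec ¬? (x Fin.≟ z) →-dec
      (w Fin.≟ x ⊎-dec w Fin.≟ y ⊎-dec w Fin.≟ z)} tt

  third : ∀ (x y : Fin 3) → ∃ λ z → z ≢ x × z ≢ y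
  third fz fz = fs fz , (λ ()) , (λ ())
  third fz (fs fz) = fs (fs fz) , (λ ()) , (λ ())
  third fz (fs (fs fz)) = fs fz , (λ ()) , (λ ())
  third (fs fz) fz = fs (fs fz) , (λ ()) , (λ ())
  third (fs fz) (fs fz) = fz , (λ ()) , (λ ())
  third (fs fz) (fs (fs fz)) = fz , (λ ()) , (λ ())
  third (fs (fs fz)) fz = fs fz , (λ ()) , (λ ())
  third (fs (fs fz)) (fs fz) = fz , (λ ()) , (λ ())
  third (fs (fs fz)) (fs (fs fz)) = fz , (λ ()) , (λ ())

  module _ (P : ℕ → Set) (P? : ∀ v → Dec (P v)) where

    first-failure : ∀ s d → P s → ¬ P (s + d) →
                    ∃ λ p → s < p × p ≤ s + d × (∀ v → s ≤ v → v < p → P v) × ¬ P p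
    first-failure s zero    ps ¬pe = ⊥-elim (¬pe (subst P (sym (+-identityʳ s)) ps))
    first-failure s (suc d) ps ¬pe with P? (suc s)
    ... | no ¬p = suc s , ≤-refl , subst (suc s ≤_) (sym (+-suc s d)) (s≤s (m≤m+n s d)) , run , ¬p
      where
      run : ∀ v → s ≤ v → v < suc s → P v
      run v s≤v (s≤s v≤s) = subst P (≤-antisym s≤v v≤s) ps
    ... | yes q with first-failure (suc s) d q (¬pe ∘ subst P (sym (+-suc s d)))
    ...   | p , s<p , p≤ , h , ¬pp = p , <-trans ≤-refl s<p , subst (p ≤_) (sym (+-suc s d)) p≤ , run , ¬pp
      where
      run : ∀ v → s ≤ v → v < p → P v
      run v s≤v v<p with m≤n⇒m<n∨m≡n s≤v
      ... | inj₁ s<v  = h v s<v v<p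
      ... | inj₂ refl = ps

    last-failure : ∀ s d → ¬ P s → P (s + d) →
                   ∃ λ q → s ≤ q × q < s + d × ¬ P q × (∀ v → q < v → v ≤ s + d → P v)
    last-failure s zero    ¬ps pe = ⊥-elim (¬ps (subst P (+-identityʳ s) pe))
    last-failure s (suc d) ¬ps pe with P? (s + d)
    ... | no ¬p = s + d , m≤m+n s d , ≤-reflexive (sym (+-suc s d)) , ¬p , run
      where
      run : ∀ v → s + d < v → v ≤ s + suc d → P v
      run v lt le = subst P (≤-antisym (subst (_≤ v) (sym (+-suc s d)) lt) le) pe
    ... | yes pd with last-failure s d ¬ps pd
    ...   | q , s≤q , q< , ¬pq , h = q , s≤q , <-trans q< (≤-reflexive (sym (+-suc s d))) , ¬pq , run
      where
      run : ∀ v → q < v → v ≤ s + suc d → P v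
      run v q<v le with m≤n⇒m<n∨m≡n le
      ... | inj₁ lt   = h v q<v (≤-pred (subst (v <_) (+-suc s d) lt))
      ... | inj₂ refl = pe

  -- The edges inside a colour class that leave an open interval (s , t) with these endpoints pass through s or t.
  data Right (t : ℕ) : Set where
    middle : 2 * a ≤ t → t ≤ 3 * a → Right t
    far    : 5 * a ≤ t → Right t

  data Left (s : ℕ) : Set where
    origin : s ≡ 0 → Left s
    later  : Right s → Left s

  right-≥ : ∀ {t} → Right t → 2 * a ≤ t
  right-≥ (middle p _) = p
  right-≥ {t} (far p)  = linear 2 (λ a t → 5 :* a :≤ t ⇒ ⊢ 2 :* a :≤ t) (a ∷ t ∷ []) p

  left-pos : ∀ {s} → Left s → s ≢ 0 → 2 * a ≤ s
  left-pos (origin e) ne = ⊥-elim (ne e)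
  left-pos (later r)  _  = right-≥ r

  -- A balanced labeling seen as a colouring of the naturals. By `period`, `6 * a` is a second name
  -- of vertex 0, so that the path from `5 * a` back to 0 is an interval with two ends, like the
  -- other segments.
  record Balanced (F : ℕ → Fin 3) : Set₁ where
    field
      closed  : ∀ x (S : ℕ → Set) →
                (∀ {u v} → u < 6 * a → v < 6 * a → F u ≡ x → F v ≡ x → Adj u v → S u → S v) →
                ∀ {u v} → u < 6 * a → v < 6 * a → F u ≡ x → F v ≡ x → S u → S v
      class-≤ : ∀ x s d → (∀ {v} → v < 6 * a → F v ≡ x → s ≤ v × v < s + d) → 2 * a ≤ d
      class-≥ : ∀ x s d → s + d ≤ 6 * a → (∀ {v} → s ≤ v → v < s + d → F v ≡ x) → d ≤ 2 * a
      period  : F (6 * a) ≡ F 0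

  record Arcs (F : ℕ → Fin 3) : Set where
    field
      x y z : Fin 3
      x≢y   : x ≢ y
      y≢z   : y ≢ z
      x≢z   : x ≢ z
      p     : ℕ
      1≤p   : 1 ≤ p
      p≤2a  : p ≤ 2 * a
      arc₀  : ∀ {v} → v < p → F v ≡ x
      arc₁  : ∀ {v} → p ≤ v → v < p + 2 * a → F v ≡ y
      arc₂  : ∀ {v} → p + 2 * a ≤ v → v < p + 4 * a → F v ≡ z
      arc₃  : ∀ {v} → p + 4 * a ≤ v → v < 6 * a → F v ≡ x

  module _ {F : ℕ → Fin 3} (bal : Balanced F) where
    open Balanced bal

    cyclic : ∀ {x t} → t ≤ 6 * a → F t ≢ x → ∀ {v} → v < 6 * a → F v ≡ x → v ≢ t × (t ≡ 6 * a → v ≢ 0)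
    cyclic t≤ ne v< Fv = (λ { refl → ne Fv }) , λ { refl refl → ne (trans period Fv) }

    -- Connectivity holds the class in place: it could leave the interval only through an endpoint,
    -- and both endpoints have other colours.
    trap : ∀ s t {x} → Left s → Right t → t ≤ 6 * a → F s ≢ x → F t ≢ x →
           ∀ {u v} → s < u → u < t → v < 6 * a → F u ≡ x → F v ≡ x → s < v × v < t
    trap s t {x} L R t≤ Fs Ft {u₀} {v₀} s<u₀ u₀<t v₀< Fu₀ Fv₀ =
      closed x (λ v → s < v × v < t) step (<-≤-trans u₀<t t≤) v₀< Fu₀ Fv₀ (s<u₀ , u₀<t)
      where
      step : ∀ {u v} → u < 6 * a → v < 6 * a → F u ≡ x → F v ≡ x → Adj u v → s < u × u < t → s < v × v < t
      step {u} {v} u< v< Fu Fv e (s<u , u<t) = go e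
        where
        v≢t = proj₁ (cyclic t≤ Ft v< Fv)
        v≢s : v ≢ s
        v≢s refl = Fs Fv
        go : Adj u v → s < v × v < t
        go (inj₁ (rail refl)) = <-trans s<u ≤-refl , ≤∧≢⇒< u<t v≢t
        go (inj₁ (wrap e _)) = ⊥-elim (n≮0 (subst (s <_) e s<u))
        -- From `s = 0` the upper end of the chord stays below `2 * a`, hence below `t`. Any other
        -- `s` lies at or beyond `2 * a`, where no chord of the left lobe begins.
        go (inj₁ (chordL q l e e′)) with s ≟ 0
        ... | yes refl =
          linear 5 (λ a k q u v → a :≡ 5 :* k :+ con 1 ⇒ q :≤ k ⇒ u :≡ 5 :* q ⇒ u :+ v :≡ 2 :* a ⇒ ⊢ con 0 :< v)
                  (a ∷ k ∷ q ∷ u ∷ v ∷ []) a≡ l e e′ ,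
          linear 4 (λ a t u v → u :+ v :≡ 2 :* a ⇒ con 0 :< u ⇒ 2 :* a :≤ t ⇒ ⊢ v :< t) (a ∷ t ∷ u ∷ v ∷ []) e′ s<u (right-≥ R)
        ... | no ne = ⊥-elim (linear 5 (λ a k q u s → a :≡ 5 :* k :+ con 1 ⇒ q :≤ k ⇒ u :≡ 5 :* q ⇒ s :< u ⇒ 2 :* a :≤ s ⇒ ⊢ :⊥)
                (a ∷ k ∷ q ∷ u ∷ s ∷ []) a≡ l e s<u (left-pos L ne))
        go (inj₁ (chordR q l e e′)) =
          <-trans s<u (edge-< (chordR q l e e′)) , ≤∧≢⇒< (v≤t R) v≢t
          where
          v≤t : Right t → v ≤ t
          v≤t (middle _ t≤3a) = ⊥-elim (linear 4 (λ a t u q → u :≡ 3 :* a :+ 5 :* q ⇒ u :< t ⇒ t :≤ 3 :* a ⇒ ⊢ :⊥)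
                  (a ∷ t ∷ u ∷ q ∷ []) e u<t t≤3a)
          v≤t (far 5a≤t) = linear 5 (λ a t u v q → u :≡ 3 :* a :+ 5 :* q ⇒ u :+ v :≡ 8 :* a ⇒ 5 :* a :≤ t ⇒ ⊢ v :≤ t)
                  (a ∷ t ∷ u ∷ v ∷ q ∷ []) e e′ 5a≤t
        go (inj₂ (rail refl)) = ≤∧≢⇒< (≤-pred s<u) (v≢s ∘ sym) , <-trans ≤-refl u<t
        -- Here `u` is the last vertex, which forces `t = 6 * a`; by `period` vertex 0 then has the
        -- colour of `t`, so it is not in the class.
        go (inj₂ (wrap refl e′)) = ⊥-elim (proj₂ (cyclic t≤ Ft v< Fv) (≤-antisym t≤ (subst (_≤ t) e′ u<t)) refl)
        go (inj₂ (chordL q l e e′)) with s ≟ 0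
        ... | yes refl = n≢0⇒n>0 v≢s , <-trans (edge-< (chordL q l e e′)) u<t
        ... | no ne = ⊥-elim (linear 4 (λ a u v s → v :+ u :≡ 2 :* a ⇒ s :< u ⇒ 2 :* a :≤ s ⇒ ⊢ :⊥)
                (a ∷ u ∷ v ∷ s ∷ []) e′ s<u (left-pos L ne))
        go (inj₂ (chordR q l e e′)) = ≤∧≢⇒< (s≤v L) (v≢s ∘ sym) , <-trans (edge-< (chordR q l e e′)) u<t
          where
          s≤v : Left s → s ≤ v
          s≤v (origin refl) = z≤n
          s≤v (later (middle _ s≤3a)) = linear 4 (λ a s v q → v :≡ 3 :* a :+ 5 :* q ⇒ s :≤ 3 :* a ⇒ ⊢ s :≤ v)
                  (a ∷ s ∷ v ∷ q ∷ []) e s≤3a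
          s≤v (later (far 5a≤s)) = linear 5 (λ a s v q u → v :≡ 3 :* a :+ 5 :* q ⇒ v :+ u :≡ 8 :* a ⇒ s :< u ⇒ 5 :* a :≤ s ⇒ ⊢ s :≤ v)
                  (a ∷ s ∷ v ∷ q ∷ u ∷ []) e e′ s<u 5a≤s

    -- Fewer than `2 * a` vertices lie strictly between `s` and `t`, too few for a whole class
    -- trapped there.
    no-escape : ∀ s t {x} → Left s → Right t → t ≤ 6 * a → t ≤ s + 2 * a → F s ≢ x → F t ≢ x →
                ∀ {u} → s < u → u < t → F u ≢ x
    no-escape s t {x} L R t≤ short Fs Ft {u} s<u u<t Fu =
      linear 4 (λ a s t d → con 1 :+ s :+ d :≡ t ⇒ t :≤ s :+ 2 :* a ⇒ 2 :* a :≤ d ⇒ ⊢ :⊥) (a ∷ s ∷ t ∷ t ∸ suc s ∷ [])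
        gap short (class-≤ x (suc s) (t ∸ suc s) λ {v} v< Fv →
          let (s<v , v<t) = trap s t L R t≤ Fs Ft s<u u<t v< Fu Fv in s<v , subst (v <_) (sym gap) v<t)
      where
      gap : suc s + (t ∸ suc s) ≡ t
      gap = m+[n∸m]≡n (<-trans s<u u<t)

    monochrome : ∀ s t {x} → Left s → Right t → t ≤ 6 * a → t ≤ s + 2 * a → F s ≡ x → F t ≡ x →
                 ∀ {v} → s ≤ v → v ≤ t → F v ≡ x
    monochrome s t {x} L R t≤ short Fs Ft {v} s≤v v≤t with F v Fin.≟ x | m≤n⇒m<n∨m≡n s≤v | m≤n⇒m<n∨m≡n v≤t
    ... | yes e | _ | _ = e
    ... | no ne | inj₂ refl | _ = Fs
    ... | no ne | _ | inj₂ refl = Ft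
    ... | no ne | inj₁ s<v | inj₁ v<t =
      ⊥-elim (no-escape s t L R t≤ short (λ e → ne (trans (sym e) Fs)) (λ e → ne (trans (sym e) Ft)) s<v v<t refl)

    two-coloured : ∀ s t {x y} → Left s → Right t → t ≤ 6 * a → t ≤ s + 2 * a → x ≢ y → F s ≡ x → F t ≡ y →
                   ∀ {v} → s ≤ v → v ≤ t → F v ≡ x ⊎ F v ≡ y
    two-coloured s t {x} {y} L R t≤ short x≢y Fs Ft {v} s≤v v≤t
      with F v Fin.≟ x | F v Fin.≟ y | m≤n⇒m<n∨m≡n s≤v | m≤n⇒m<n∨m≡n v≤t
    ... | yes e | _ | _ | _ = inj₁ e
    ... | _ | yes e | _ | _ = inj₂ e
    ... | _ | _ | inj₂ refl | _ = inj₁ Fs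
    ... | _ | _ | _ | inj₂ refl = inj₂ Ft
    ... | no nx | no ny | inj₁ s<v | inj₁ v<t =
      ⊥-elim (no-escape s t L R t≤ short (λ e → nx (trans (sym e) Fs)) (λ e → ny (trans (sym e) Ft)) s<v v<t refl)

    lobe-ends : ∀ s t → Left s → Right t → t < 6 * a → t ≡ s + 2 * a → F s ≢ F t
    lobe-ends s t L R t< t≡ e =
      <-irrefl refl (class-≥ (F s) s (suc (2 * a)) (subst (_≤ 6 * a) (trans (cong suc t≡) (sym (+-suc s (2 * a)))) t<)
        λ {v} s≤v v< → monochrome s t L R (<⇒≤ t<) (≤-reflexive t≡) refl (sym e) s≤v
          (subst (v ≤_) (sym t≡) (≤-pred (subst (v <_) (+-suc s (2 * a)) v<))))

    -- From an inner vertex of a lobe one can only take a rail step or reflect in the middle of the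
    -- lobe. With `β` as the start of the lobe the same description, and all arguments resting on
    -- it, serve both lobes.
    lobe-neighbour : ∀ {β} → β ≡ 0 ⊎ β ≡ 3 * a → ∀ {u v} → β < v → v < β + 2 * a → Adj u v →
                     β ≤ u × u ≤ β + 2 * a × (v ≡ suc u ⊎ u ≡ suc v ⊎ u + v ≡ β + (β + 2 * a))
    lobe-neighbour _ {u} β<v v<e (inj₁ (rail refl)) = ≤-pred β<v , <⇒≤ (<-trans ≤-refl v<e) , inj₁ refl
    lobe-neighbour _ {u} β<v v<e (inj₂ (rail refl)) = <⇒≤ (<-trans β<v ≤-refl) , v<e , inj₂ (inj₁ refl)
    lobe-neighbour (inj₁ refl) {u} {v} β<v v<e (inj₁ (wrap _ e)) = ⊥-elim (linear 2 (λ a v → v :< 2 :* a ⇒ con 1 :+ v :≡ 6 :* a ⇒ ⊢ :⊥)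
            (a ∷ v ∷ []) v<e e)
    lobe-neighbour (inj₂ refl) {u} {v} β<v v<e (inj₁ (wrap _ e)) = ⊥-elim (linear 2 (λ a v → con 1 :≤ a ⇒ v :< 3 :* a :+ 2 :* a ⇒ con 1 :+ v :≡ 6 :* a ⇒ ⊢ :⊥)
            (a ∷ v ∷ []) 1≤a v<e e)
    lobe-neighbour _ {u} β<v v<e (inj₂ (wrap refl e)) with β<v
    ... | ()
    lobe-neighbour (inj₁ refl) {u} {v} β<v v<e (inj₁ (chordL q l e e′)) = z≤n , m+n≤o⇒m≤o u (≤-reflexive e′) , inj₂ (inj₂ e′)
    lobe-neighbour (inj₁ refl) {u} {v} β<v v<e (inj₂ (chordL q l e e′)) = z≤n , m+n≤o⇒n≤o v (≤-reflexive e′) , inj₂ (inj₂ (trans (+-comm u v) e′))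
    lobe-neighbour (inj₁ refl) {u} {v} β<v v<e (inj₁ (chordR q l e e′)) = ⊥-elim (linear 5 (λ a k q u v → a :≡ 5 :* k :+ con 1 ⇒ q :≤ k ⇒ u :≡ 3 :* a :+ 5 :* q ⇒ u :+ v :≡ 8 :* a ⇒ v :< 2 :* a ⇒ ⊢ :⊥)
            (a ∷ k ∷ q ∷ u ∷ v ∷ []) a≡ l e e′ v<e)
    lobe-neighbour (inj₁ refl) {u} {v} β<v v<e (inj₂ (chordR q l e e′)) = ⊥-elim (linear 3 (λ a q v → v :≡ 3 :* a :+ 5 :* q ⇒ v :< 2 :* a ⇒ ⊢ :⊥)
            (a ∷ q ∷ v ∷ []) e v<e)
    lobe-neighbour (inj₂ refl) {u} {v} β<v v<e (inj₁ (chordL q l e e′)) = ⊥-elim (linear 3 (λ a u v → u :+ v :≡ 2 :* a ⇒ 3 :* a :< v ⇒ ⊢ :⊥)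
            (a ∷ u ∷ v ∷ []) e′ β<v)
    lobe-neighbour (inj₂ refl) {u} {v} β<v v<e (inj₂ (chordL q l e e′)) = ⊥-elim (linear 3 (λ a u v → v :+ u :≡ 2 :* a ⇒ 3 :* a :< v ⇒ ⊢ :⊥)
            (a ∷ u ∷ v ∷ []) e′ β<v)
    lobe-neighbour (inj₂ refl) {u} {v} β<v v<e (inj₁ (chordR q l e e′)) =
      linear 3 (λ a q u → u :≡ 3 :* a :+ 5 :* q ⇒ ⊢ 3 :* a :≤ u) (a ∷ q ∷ u ∷ []) e ,
      linear 3 (λ a u v → u :+ v :≡ 8 :* a ⇒ 3 :* a :< v ⇒ ⊢ u :≤ 3 :* a :+ 2 :* a) (a ∷ u ∷ v ∷ []) e′ β<v ,
      inj₂ (inj₂ (linear 3 (λ a u v → u :+ v :≡ 8 :* a ⇒ ⊢ u :+ v :≡ 3 :* a :+ (3 :* a :+ 2 :* a)) (a ∷ u ∷ v ∷ []) e′))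
    lobe-neighbour (inj₂ refl) {u} {v} β<v v<e (inj₂ (chordR q l e e′)) =
      linear 3 (λ a u v → v :+ u :≡ 8 :* a ⇒ v :< 3 :* a :+ 2 :* a ⇒ ⊢ 3 :* a :≤ u) (a ∷ u ∷ v ∷ []) e′ v<e ,
      linear 4 (λ a q u v → v :≡ 3 :* a :+ 5 :* q ⇒ v :+ u :≡ 8 :* a ⇒ ⊢ u :≤ 3 :* a :+ 2 :* a) (a ∷ q ∷ u ∷ v ∷ []) e e′ ,
      inj₂ (inj₂ (linear 3 (λ a u v → v :+ u :≡ 8 :* a ⇒ ⊢ u :+ v :≡ 3 :* a :+ (3 :* a :+ 2 :* a)) (a ∷ u ∷ v ∷ []) e′))

    Switch : ℕ → ℕ → Set
    Switch s t = ∃ λ p → s < p × p ≤ t × (∀ {v} → s ≤ v → v < p → F v ≡ F s) × (∀ {v} → p ≤ v → v ≤ t → F v ≡ F t)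

    -- Let p and q be the first vertex not coloured like β and the last not coloured like β + 2a. If p ≤ q, both colours
    -- must enter [p , q] through chords; reflecting in the middle of the lobe, one colour needs p + q large, the other small.
    lobe-switch : ∀ {β} → β ≡ 0 ⊎ β ≡ 3 * a → Left β → Right (β + 2 * a) → β + 2 * a < 6 * a → Switch β (β + 2 * a)
    lobe-switch {β} base L R e<
      with first-failure (λ v → F v ≡ F β) (λ v → F v Fin.≟ F β) β (2 * a) refl (lobe-ends β (β + 2 * a) L R e< refl ∘ sym)
         | last-failure (λ v → F v ≡ F (β + 2 * a)) (λ v → F v Fin.≟ F (β + 2 * a)) β (2 * a) (lobe-ends β (β + 2 * a) L R e< refl) refl
    ... | p , β<p , p≤e , before , Fp≢ | q , β≤q , q<e , Fq≢ , after = p , β<p , p≤e , (λ {v} → before v) , λ p≤v → after _ (<-≤-trans q<p p≤v)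
      where
      e = β + 2 * a
      x≢y = lobe-ends β (β + 2 * a) L R e< refl
      colours : ∀ {v} → β ≤ v → v ≤ e → F v ≡ F β ⊎ F v ≡ F e
      colours = two-coloured β e L R (<⇒≤ e<) ≤-refl x≢y refl refl
      Fp : F p ≡ F e
      Fp = [ (λ c → ⊥-elim (Fp≢ c)) , id ]′ (colours (<⇒≤ β<p) p≤e)
      Fq : F q ≡ F β
      Fq = [ id , (λ c → ⊥-elim (Fq≢ c)) ]′ (colours β≤q (<⇒≤ q<e))
      Outside : ℕ → Set
      Outside v = v < p ⊎ q < v
      decide : ∀ v → Outside v ⊎ (p ≤ v × v ≤ q)
      decide v with v <? p | q <? v
      ... | yes l | _     = inj₁ (inj₁ l)
      ... | _     | yes l = inj₁ (inj₂ l)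
      ... | no ¬l | no ¬m = inj₂ (≮⇒≥ ¬l , ≮⇒≥ ¬m)
      inside : ∀ {u v} → p ≤ v → v ≤ q → Adj u v →
               β ≤ u × u ≤ e × (v ≡ suc u ⊎ u ≡ suc v ⊎ u + v ≡ β + e)
      inside p≤v v≤q = lobe-neighbour base (<-≤-trans β<p p≤v) (≤-<-trans v≤q q<e)
      contradiction-x : p ≤ q → p + q ≤ β + e → ⊥
      contradiction-x p≤q p+q≤ with closed (F β) Outside step (≤-<-trans (m≤m+n β (2 * a)) e<) (<-trans q<e e<) refl Fq (inj₁ β<p)
        where
        step : ∀ {u v} → u < 6 * a → v < 6 * a → F u ≡ F β → F v ≡ F β → Adj u v → Outside u → Outside v
        step {u} {v} _ _ Fu Fv uv out with decide v
        ... | inj₁ o = o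
        ... | inj₂ (p≤v , v≤q) with inside p≤v v≤q uv | out
        ...   | β≤u , u≤e , _ | inj₂ q<u = ⊥-elim (x≢y (trans (sym Fu) (after u q<u u≤e)))
        ...   | _ , _ , inj₁ refl | inj₁ u<p = ⊥-elim (Fp≢ (subst (λ w → F w ≡ F β) (≤-antisym u<p p≤v) Fv))
        ...   | _ , _ , inj₂ (inj₁ refl) | inj₁ u<p = ⊥-elim (<⇒≱ u<p (<⇒≤ (s≤s p≤v)))
        ...   | _ , _ , inj₂ (inj₂ s) | inj₁ u<p = ⊥-elim (<⇒≱ (+-mono-<-≤ u<p v≤q) (subst (p + q ≤_) (sym s) p+q≤))
      ... | inj₁ q<p = <⇒≱ q<p p≤q
      ... | inj₂ q<q = <-irrefl refl q<q
      contradiction-y : p ≤ q → β + e ≤ p + q → ⊥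
      contradiction-y p≤q ≤p+q with closed (F e) Outside step e< (≤-<-trans p≤e e<) refl Fp (inj₂ q<e)
        where
        step : ∀ {u v} → u < 6 * a → v < 6 * a → F u ≡ F e → F v ≡ F e → Adj u v → Outside u → Outside v
        step {u} {v} _ _ Fu Fv uv out with decide v
        ... | inj₁ o = o
        ... | inj₂ (p≤v , v≤q) with inside p≤v v≤q uv | out
        ...   | β≤u , u≤e , _ | inj₁ u<p = ⊥-elim (x≢y (trans (sym (before u β≤u u<p)) Fu))
        ...   | _ , _ , inj₁ refl | inj₂ q<u = ⊥-elim (<⇒≱ q<u (<⇒≤ v≤q))
        ...   | _ , _ , inj₂ (inj₁ refl) | inj₂ q<u = ⊥-elim (Fq≢ (subst (λ w → F w ≡ F e) (≤-antisym v≤q (≤-pred q<u)) Fv))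
        ...   | _ , _ , inj₂ (inj₂ s) | inj₂ q<u = ⊥-elim (<⇒≱ (+-mono-<-≤ q<u p≤v) (subst (_≤ q + p) (sym s) (subst (β + e ≤_) (+-comm p q) ≤p+q)))
      ... | inj₁ p<p = <-irrefl refl p<p
      ... | inj₂ q<p = <⇒≱ q<p p≤q
      q<p : q < p
      q<p = ≰⇒> λ p≤q → [ contradiction-x p≤q , contradiction-y p≤q ]′ (≤-total (p + q) (β + e))

    -- On a path between the lobes every vertex qualifies as a left endpoint for `trap`. If the
    -- colour of `s` came back after the first change at `p`, that vertex would be trapped between
    -- `p` and `t`, although `s` has the same colour and lies outside.
    path-switch : ∀ {s t} → (∀ {r} → s ≤ r → r ≤ t → Left r) → Right t → s < t → t ≤ 6 * a → t ≤ s + 2 * a → F s ≢ F t →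
                  Switch s t
    path-switch {s} {t} L R s<t t≤ short x≢y
      with first-failure (λ v → F v ≡ F s) (λ v → F v Fin.≟ F s) s (t ∸ s) refl (subst (λ t → F t ≢ F s) (sym (m+[n∸m]≡n (<⇒≤ s<t))) (x≢y ∘ sym))
    ... | p , s<p , p≤t′ , before , Fp = p , s<p , p≤t , (λ {v} → before v) , after
      where
      p≤t = subst (p ≤_) (m+[n∸m]≡n (<⇒≤ s<t)) p≤t′
      after : ∀ {v} → p ≤ v → v ≤ t → F v ≡ F t
      after {v} p≤v v≤t with two-coloured s t (L ≤-refl (<⇒≤ s<t)) R t≤ short x≢y refl refl (<⇒≤ (<-≤-trans s<p p≤v)) v≤t
      ... | inj₂ e = e
      ... | inj₁ e with m≤n⇒m<n∨m≡n p≤v | m≤n⇒m<n∨m≡n v≤t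
      ...   | inj₂ refl | _ = ⊥-elim (Fp e)
      ...   | _ | inj₂ refl = refl
      ...   | inj₁ p<v | inj₁ v<t = ⊥-elim (<⇒≱ s<p (<⇒≤ (proj₁ (trap p t (L (<⇒≤ s<p) p≤t) R t≤ Fp (x≢y ∘ sym) p<v v<t (<-≤-trans s<t t≤) e refl))))

    L0 : Left 0
    L0 = origin refl
    R2 : Right (2 * a)
    R2 = middle ≤-refl (<⇒≤ 2a<3a)
    R3 : Right (3 * a)
    R3 = middle (<⇒≤ 2a<3a) ≤-refl
    R5 : Right (5 * a)
    R5 = far ≤-refl
    R6 : Right (6 * a)
    R6 = far (<⇒≤ 5a<6a)
    L2 : Left (2 * a)
    L2 = later R2
    L3 : Left (3 * a)
    L3 = later R3
    L5 : Left (5 * a)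
    L5 = later R5

    3a≤2a+2a : 3 * a ≤ 2 * a + 2 * a
    3a≤2a+2a = linear 1 (λ a → ⊢ 3 :* a :≤ 2 :* a :+ 2 :* a) (a ∷ [])
    6a≤5a+2a : 6 * a ≤ 5 * a + 2 * a
    6a≤5a+2a = linear 1 (λ a → ⊢ 6 :* a :≤ 5 :* a :+ 2 :* a) (a ∷ [])

    F0≢F2a : F 0 ≢ F (2 * a)
    F0≢F2a = lobe-ends 0 (2 * a) L0 R2 2a<6a refl

    F3a≢F5a : F (3 * a) ≢ F (5 * a)
    F3a≢F5a = lobe-ends (3 * a) (5 * a) L3 R5 5a<6a 5a≡

    -- The four lobe ends divide the cycle into segments too short to hold a class, so a colour
    -- missing at all four ends would have no vertex at all.
    corners-see-all : ∀ z → F 0 ≢ z → F (2 * a) ≢ z → F (3 * a) ≢ z → F (5 * a) ≢ z → ⊥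
    corners-see-all z n₀ n₂ n₃ n₅ =
      n≮0 (<-≤-trans (≤-trans 1≤a (m≤m+n a _)) (class-≤ z 0 0 λ v< Fv → ⊥-elim (absent v< Fv)))
      where
      absent : ∀ {v} → v < 6 * a → F v ≢ z
      absent {v} v< with v ≟ 0
      ... | yes refl = n₀
      ... | no v≢0 with <-cmp v (2 * a)
      ... | tri< l _ _ = no-escape 0 (2 * a) L0 R2 2a≤6a ≤-refl n₀ n₂ (n≢0⇒n>0 v≢0) l
      ... | tri≈ _ refl _ = n₂
      ... | tri> _ _ g₂ with <-cmp v (3 * a)
      ... | tri< l _ _ = no-escape (2 * a) (3 * a) L2 R3 (<⇒≤ 3a<6a) 3a≤2a+2a n₂ n₃ g₂ l
      ... | tri≈ _ refl _ = n₃
      ... | tri> _ _ g₃ with <-cmp v (5 * a)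
      ...   | tri< l _ _ = no-escape (3 * a) (5 * a) L3 R5 (<⇒≤ 5a<6a) (≤-reflexive 5a≡) n₃ n₅ g₃ l
      ...   | tri≈ _ refl _ = n₅
      ...   | tri> _ _ g₅ = no-escape (5 * a) (6 * a) L5 R6 ≤-refl 6a≤5a+2a n₅ (λ e → n₀ (trans (sym period) e)) g₅ v<

    data Corners : Set where
      top    : F 0 ≡ F (5 * a) → F 0 ≢ F (3 * a) → F (2 * a) ≢ F (3 * a) → Corners
      bottom : F (2 * a) ≡ F (3 * a) → F 0 ≢ F (5 * a) → F (2 * a) ≢ F (5 * a) → Corners

    -- All three colours occur among the four lobe ends, so just one pair of ends agrees. It is not
    -- a diagonal pair, 0 with `3 * a` or `2 * a` with `5 * a`: one of the two would lie in an
    -- interval that traps its class and the other outside.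
    corners : Corners
    corners with third (F 0) (F (2 * a))
    ... | z , z≢x , z≢y with F (3 * a) Fin.≟ z | F (5 * a) Fin.≟ z
    ... | no n₃ | no n₅ = ⊥-elim (corners-see-all z (z≢x ∘ sym) (z≢y ∘ sym) n₃ n₅)
    ... | yes refl | _ with exhaust (F 0) (F (2 * a)) _ (F (5 * a)) F0≢F2a (z≢y ∘ sym) (z≢x ∘ sym)
    ...   | inj₁ e = top (sym e) (z≢x ∘ sym) (z≢y ∘ sym)
    ...   | inj₂ (inj₂ e) = ⊥-elim (F3a≢F5a (sym e))
    ...   | inj₂ (inj₁ e) = ⊥-elim (<-asym 3a<5a (proj₂
              (trap 0 (3 * a) L0 R3 (<⇒≤ 3a<6a) F0≢F2a z≢y (≤-trans 1≤a (m≤m+n a _)) 2a<3a 5a<6a refl e)))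
    corners | z , z≢x , z≢y | no n₃ | yes refl with exhaust (F 0) (F (2 * a)) _ (F (3 * a)) F0≢F2a (z≢y ∘ sym) (z≢x ∘ sym)
    ...   | inj₂ (inj₁ e) = bottom (sym e) (z≢x ∘ sym) (z≢y ∘ sym)
    ...   | inj₂ (inj₂ e) = ⊥-elim (n₃ e)
    ...   | inj₁ e = ⊥-elim (n≮0 (proj₁
              (trap (2 * a) (5 * a) L2 R5 (<⇒≤ 5a<6a) (F0≢F2a ∘ sym) z≢x 2a<3a 3a<5a 0<6a e refl)))

    -- Each lobe contributes one change of colour. Of the two paths, the one joining ends of equal
    -- colour is monochrome and the other contributes the third change.
    arcs-from : Switch 0 (2 * a) → Switch (3 * a) (3 * a + 2 * a) → Arcs F
    arcs-from (p , 0<p , p≤2a , runx , runy) (p′ , 3a<p′ , p′≤ , runz , runw) = go corners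
      where
      -- Counting the colour classes of y and z fixes the two later switches.
      assemble : ∀ x y z q r → x ≢ y → y ≢ z → x ≢ z → p ≤ q → q ≤ r → r ≤ 6 * a → (∀ {v} → v < p → F v ≡ x) →
                 (∀ {v} → p ≤ v → v < q → F v ≡ y) → (∀ {v} → q ≤ v → v < r → F v ≡ z) →
                 (∀ {v} → r ≤ v → v < 6 * a → F v ≡ x) → Arcs F
      assemble x y z q r x≢y y≢z x≢z p≤q q≤r r≤ hx hy hz hx′ = record
        { x = x ; y = y ; z = z ; x≢y = x≢y ; y≢z = y≢z ; x≢z = x≢z ; p = p ; 1≤p = 0<p ; p≤2a = p≤2a
        ; arc₀ = hx
        ; arc₁ = λ p≤v v< → hy p≤v (subst (_ <_) (sym q≡) v<)
        ; arc₂ = λ le lt → hz (subst (_≤ _) (sym q≡) le) (subst (_ <_) (sym r≡) lt)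
        ; arc₃ = λ le lt → hx′ (subst (_≤ _) (sym r≡) le) lt
        }
        where
        p+ : p + (q ∸ p) ≡ q
        p+ = m+[n∸m]≡n p≤q
        q+ : q + (r ∸ q) ≡ r
        q+ = m+[n∸m]≡n q≤r
        piece : ∀ v → v < 6 * a → (F v ≡ x) ⊎ (p ≤ v × v < q × F v ≡ y) ⊎ (q ≤ v × v < r × F v ≡ z)
        piece v v< with v <? p | v <? q | v <? r
        ... | yes l | _ | _ = inj₁ (hx l)
        ... | no g | yes l | _ = inj₂ (inj₁ (≮⇒≥ g , l , hy (≮⇒≥ g) l))
        ... | _ | no g | yes l = inj₂ (inj₂ (≮⇒≥ g , l , hz (≮⇒≥ g) l))
        ... | _ | _ | no g = inj₁ (hx′ (≮⇒≥ g) v<)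
        iny : ∀ {v} → v < 6 * a → F v ≡ y → p ≤ v × v < p + (q ∸ p)
        iny {v} v< e with piece v v<
        ... | inj₁ c = ⊥-elim (x≢y (trans (sym c) e))
        ... | inj₂ (inj₁ (l , m , _)) = l , subst (v <_) (sym p+) m
        ... | inj₂ (inj₂ (_ , _ , c)) = ⊥-elim (y≢z (trans (sym e) c))
        inz : ∀ {v} → v < 6 * a → F v ≡ z → q ≤ v × v < q + (r ∸ q)
        inz {v} v< e with piece v v<
        ... | inj₁ c = ⊥-elim (x≢z (trans (sym c) e))
        ... | inj₂ (inj₁ (_ , _ , c)) = ⊥-elim (y≢z (trans (sym c) e))
        ... | inj₂ (inj₂ (l , m , _)) = l , subst (v <_) (sym q+) m
        dy : q ∸ p ≡ 2 * a
        dy = ≤-antisym (class-≥ y p _ (subst (_≤ 6 * a) (sym p+) (≤-trans q≤r r≤)) λ l m → hy l (subst (_ <_) p+ m)) (class-≤ y p _ iny)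
        dz : r ∸ q ≡ 2 * a
        dz = ≤-antisym (class-≥ z q _ (subst (_≤ 6 * a) (sym q+) r≤) λ l m → hz l (subst (_ <_) q+ m)) (class-≤ z q _ inz)
        q≡ : q ≡ p + 2 * a
        q≡ = trans (sym p+) (cong (p +_) dy)
        r≡ : r ≡ p + 4 * a
        r≡ = linear 6 (λ a p q r d e → q :≡ p :+ 2 :* a ⇒ q :+ e :≡ r ⇒ e :≡ 2 :* a ⇒ ⊢ r :≡ p :+ 4 :* a)
                (a ∷ p ∷ q ∷ r ∷ 0 ∷ r ∸ q ∷ []) q≡ q+ dz
      p′≤5a : p′ ≤ 5 * a
      p′≤5a = subst (p′ ≤_) (sym 5a≡) p′≤
      runw′ : ∀ {v} → p′ ≤ v → v ≤ 5 * a → F v ≡ F (5 * a)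
      runw′ {v} l m = trans (runw l (subst (v ≤_) 5a≡ m)) (cong F (sym 5a≡))
      go : Corners → Arcs F
      go (top e n₀₃ n₂₃) with path-switch {2 * a} {3 * a} (λ l m → later (middle l m)) R3 2a<3a (<⇒≤ 3a<6a) 3a≤2a+2a n₂₃
      ... | r , 2a<r , r≤3a , runy′ , runz′ =
        assemble (F 0) (F (2 * a)) (F (3 * a)) r p′ F0≢F2a n₂₃ n₀₃
          (≤-trans p≤2a (<⇒≤ 2a<r)) (≤-trans r≤3a (<⇒≤ 3a<p′)) (≤-trans p′≤5a (<⇒≤ 5a<6a)) (runx z≤n)
          (λ {v} l m → [ (λ v≤ → runy l v≤) , (λ v≥ → runy′ v≥ m) ]′ (≤-total v (2 * a)))
          (λ {v} l m → [ (λ v≤ → runz′ l v≤) , (λ v≥ → runz v≥ m) ]′ (≤-total v (3 * a)))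
          (λ {v} l m → [ (λ v≤ → trans (runw′ l v≤) (sym e)) , (λ v≥ → monochrome (5 * a) (6 * a) L5 R6 ≤-refl 6a≤5a+2a (sym e) period v≥ (<⇒≤ m)) ]′ (≤-total v (5 * a)))
      go (bottom e n₀₅ n₂₅) with path-switch {5 * a} {6 * a} (λ l m → later (far l)) R6 5a<6a ≤-refl 6a≤5a+2a (λ e′ → n₀₅ (trans (sym period) (sym e′)))
      ... | r , 5a<r , r≤6a , runz′ , runx′ =
        assemble (F 0) (F (2 * a)) (F (5 * a)) p′ r F0≢F2a n₂₅ n₀₅
          (≤-trans p≤2a (<⇒≤ (<-trans 2a<3a 3a<p′))) (≤-trans p′≤5a (<⇒≤ 5a<r)) r≤6a (runx z≤n)
          (λ {v} l m → [ (λ v≤ → runy l v≤)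
                       , (λ v≥ → [ (λ v≤ → monochrome (2 * a) (3 * a) L2 R3 (<⇒≤ 3a<6a) 3a≤2a+2a refl (sym e) v≥ v≤) , (λ v≥ → trans (runz v≥ m) (sym e)) ]′ (≤-total v (3 * a))) ]′
                       (≤-total v (2 * a)))
          (λ {v} l m → [ (λ v≤ → runw′ l v≤) , (λ v≥ → runz′ v≥ m) ]′ (≤-total v (5 * a)))
          (λ {v} l m → trans (runx′ l (<⇒≤ m)) period)

    arcs : Arcs F
    arcs = arcs-from (lobe-switch (inj₁ refl) L0 R2 2a<6a)
                     (lobe-switch (inj₂ refl) L3 (subst Right 5a≡ R5) (subst (_< 6 * a) 5a≡ 5a<6a))

  module _ {F : ℕ → Fin 3} (A : Arcs F) where
    open Arcs A

    -- Chord q of one lobe is paired with chord k - q of the other.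
    one-chord-cut : ∀ q → q ≤ k → F (5 * q) ≡ F (2 * a ∸ 5 * q) → F (4 * a ∸ suc (5 * q)) ≢ F (4 * a + suc (5 * q))
    -- The left chord is uncut when `p ≤ 5 * q` or `2 * a ∸ 5 * q < p`. In the former range the
    -- upper end of the right chord already lies in the last stretch, of colour `x`; in the latter
    -- `p + 2 * a` has passed its lower end but `p + 4 * a` has not yet been reached by its upper
    -- end.
    one-chord-cut q q≤k uncutL uncutR = [ caseL₁ , caseL₂ ]′ (≤-<-connex p (5 * q))
      where
      l = 2 * a ∸ 5 * q
      h = 4 * a ∸ suc (5 * q)
      l+ : l + 5 * q ≡ 2 * a
      l+ = m∸n+n≡m (linear 3 (λ a k q → a :≡ 5 :* k :+ con 1 ⇒ q :≤ k ⇒ ⊢ 5 :* q :≤ 2 :* a) (a ∷ k ∷ q ∷ []) a≡ q≤k)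
      h+ : h + suc (5 * q) ≡ 4 * a
      h+ = m∸n+n≡m (linear 3 (λ a k q → a :≡ 5 :* k :+ con 1 ⇒ q :≤ k ⇒ ⊢ con 1 :+ 5 :* q :≤ 4 :* a) (a ∷ k ∷ q ∷ []) a≡ q≤k)
      hi = 4 * a + suc (5 * q)
      p≤h : p ≤ h
      p≤h = linear 5 (λ a k q p h → a :≡ 5 :* k :+ con 1 ⇒ q :≤ k ⇒ h :+ (con 1 :+ 5 :* q) :≡ 4 :* a ⇒ p :≤ 2 :* a ⇒ ⊢ p :≤ h)
              (a ∷ k ∷ q ∷ p ∷ h ∷ []) a≡ q≤k h+ p≤2a
      caseL₁ : p ≤ 5 * q → ⊥
      caseL₁ p≤ = h≢x (trans uncutR (arc₃
          (linear 3 (λ a q p → p :≤ 5 :* q ⇒ ⊢ p :+ 4 :* a :≤ 4 :* a :+ (con 1 :+ 5 :* q)) (a ∷ q ∷ p ∷ []) p≤)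
          (linear 3 (λ a k q → a :≡ 5 :* k :+ con 1 ⇒ q :≤ k ⇒ ⊢ 4 :* a :+ (con 1 :+ 5 :* q) :< 6 :* a) (a ∷ k ∷ q ∷ []) a≡ q≤k)))
        where
        h≢x : F h ≢ x
        h≢x with ≤-<-connex (p + 2 * a) h
        ... | inj₂ lt = λ e → x≢y (trans (sym e) (arc₁ p≤h lt))
        ... | inj₁ le = λ e → x≢z (trans (sym e) (arc₂ le
          (linear 4 (λ a q p h → h :+ (con 1 :+ 5 :* q) :≡ 4 :* a ⇒ ⊢ h :< p :+ 4 :* a) (a ∷ q ∷ p ∷ h ∷ []) h+)))
      caseL₂ : 5 * q < p → ⊥
      caseL₂ q<p with ≤-<-connex p l
      ... | inj₁ p≤l = x≢y (trans (sym (arc₀ q<p)) (trans uncutL (arc₁ p≤l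
          (linear 4 (λ a q p l → l :+ 5 :* q :≡ 2 :* a ⇒ con 1 :≤ p ⇒ ⊢ l :< p :+ 2 :* a) (a ∷ q ∷ p ∷ l ∷ []) l+ 1≤p))))
      ... | inj₂ l<p = y≢z (trans (sym (arc₁ p≤h
          (linear 5 (λ a q p l h → l :+ 5 :* q :≡ 2 :* a ⇒ h :+ (con 1 :+ 5 :* q) :≡ 4 :* a ⇒ l :< p ⇒ ⊢ h :< p :+ 2 :* a)
                  (a ∷ q ∷ p ∷ l ∷ h ∷ []) l+ h+ l<p)))
          (trans uncutR (arc₂
            (linear 3 (λ a q p → p :≤ 2 :* a ⇒ ⊢ p :+ 2 :* a :≤ 4 :* a :+ (con 1 :+ 5 :* q)) (a ∷ q ∷ p ∷ []) p≤2a)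
            (linear 5 (λ a k q p l → a :≡ 5 :* k :+ con 1 ⇒ q :≤ k ⇒ l :+ 5 :* q :≡ 2 :* a ⇒ l :< p ⇒ ⊢ 4 :* a :+ (con 1 :+ 5 :* q) :< p :+ 4 :* a)
                    (a ∷ k ∷ q ∷ p ∷ l ∷ []) a≡ q≤k l+ l<p))))

-- From labelings to colourings; the invariant of ReCom moves

module Balance (k a : ℕ) (a≡ : a ≡ 5 * k + 1) (m : ℕ) (m≡ : m ≡ 6 * a) where

  open Edges k a a≡
  open Structure k a a≡

  G : Graph m
  G = graph m

  0<m : 0 < m
  0<m = subst (0 <_) (sym m≡) 0<6a

  vertex : ∀ {i} → i < 6 * a → Fin m
  vertex {i} i< = fromℕ< (subst (i <_) (sym m≡) i<)

  toℕ-vertex : ∀ {i} (i< : i < 6 * a) → toℕ (vertex i<) ≡ i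
  toℕ-vertex {i} i< = Fin.toℕ-fromℕ< (subst (i <_) (sym m≡) i<)

  toℕ<6a : ∀ (v : Fin m) → toℕ v < 6 * a
  toℕ<6a v = subst (toℕ v <_) m≡ (Fin.toℕ<n v)

  -- The default value beyond the last vertex is the colour of vertex 0, as `period` demands.
  extend : Labeling m → ℕ → Fin 3
  extend f v with v <? m
  ... | yes v<m = f (fromℕ< v<m)
  ... | no _    = f (fromℕ< 0<m)

  extend-toℕ : ∀ f v → extend f (toℕ v) ≡ f v
  extend-toℕ f v with toℕ v <? m
  ... | yes v<m = cong f (Fin.fromℕ<-toℕ v v<m)
  ... | no ≮    = ⊥-elim (≮ (Fin.toℕ<n v))

  extend-vertex : ∀ f {i} (i< : i < 6 * a) → extend f i ≡ f (vertex i<)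
  extend-vertex f i< = trans (cong (extend f) (sym (toℕ-vertex i<))) (extend-toℕ f (vertex i<))

  module _ (f : Labeling m) (f-bal : balancedᵇ G (2 * a) f ≡ true) where

    private
      F = extend f
      parts = balanced⇒parts G f (2 * a) f-bal

    balanced : Balanced F
    balanced = record { closed = closed ; class-≤ = class-≤ ; class-≥ = class-≥ ; period = period }
      where
      closed : ∀ x (S : ℕ → Set) →
               (∀ {u v} → u < 6 * a → v < 6 * a → F u ≡ x → F v ≡ x → Adj u v → S u → S v) →
               ∀ {u v} → u < 6 * a → v < 6 * a → F u ≡ x → F v ≡ x → S u → S v
      closed x S step {u} {v} u< v< Fu Fv Su = subst S (toℕ-vertex v<)
        (connected⇒closed (adj G) (part f x) (proj₂ (parts x)) (S ∘ toℕ) step′ (vertex u<) (vertex v<)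
          (part-true f _ (trans (sym (extend-vertex f u<)) Fu)) (part-true f _ (trans (sym (extend-vertex f v<)) Fv))
          (subst S (sym (toℕ-vertex u<)) Su))
        where
        step′ : Closed (adj G) (part f x) (S ∘ toℕ)
        step′ u v Su Uu Uv e = step (toℕ<6a u) (toℕ<6a v)
          (trans (extend-toℕ f u) (part-sound f u Uu)) (trans (extend-toℕ f v) (part-sound f v Uv)) (adj-sound e) Su
      class-≤ : ∀ x s d → (∀ {v} → v < 6 * a → F v ≡ x → s ≤ v × v < s + d) → 2 * a ≤ d
      class-≤ x s d h = subst (_≤ d) (proj₁ (parts x))
        (count-≤-interval (part f x) s d λ v Uv → h (toℕ<6a v) (trans (extend-toℕ f v) (part-sound f v Uv)))
      class-≥ : ∀ x s d → s + d ≤ 6 * a → (∀ {v} → s ≤ v → v < s + d → F v ≡ x) → d ≤ 2 * a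
      class-≥ x s d s+d≤ h = subst (d ≤_) (proj₁ (parts x))
        (count-≥-interval (part f x) s d (subst (s + d ≤_) (sym m≡) s+d≤)
          λ v s≤v v< → part-true f v (trans (sym (extend-toℕ f v)) (h s≤v v<)))
      period : F (6 * a) ≡ F 0
      period with 6 * a <? m | 0 <? m
      ... | yes lt | _     = ⊥-elim (<-irrefl (sym m≡) lt)
      ... | no _   | yes _ = refl
      ... | no _   | no ≮  = ⊥-elim (≮ 0<m)

  -- The two kinds of balanced partitions: one part contains both vertices 0 and 5a, or one contains both 2a and 3a.
  -- A ReCom move keeps one part, hence it keeps the kind.
  Top : Labeling m → Set
  Top f = extend f 0 ≡ extend f (5 * a)

  top-invariant : ∀ {f g} → ReComStep G (2 * a) f g → Top f → Top g
  top-invariant {f} {g} (fb , gb , move) t with corners (balanced f fb) | corners (balanced g gb)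
  ... | _ | top t′ _ _ = t′
  ... | bottom _ ne _ | bottom _ _ _ = ⊥-elim (ne t)
  ... | top _ n₀₃ n₂₃ | bottom e′ n′₀₅ n′₂₅ = ⊥-elim (go move)
    where
    transfer : ∀ {c d i} → (∀ v → part f c v ≡ part g d v) → (i< : i < 6 * a) → extend f i ≡ c → extend g i ≡ d
    transfer {c} {d} h i< e = trans (extend-vertex g i<) (part-sound g _ (trans (sym (h (vertex i<)))
      (part-true f _ (trans (sym (extend-vertex f i<)) e))))
    transfer⁻ : ∀ {c d i} → (∀ v → part f c v ≡ part g d v) → (i< : i < 6 * a) → extend g i ≡ d → extend f i ≡ c
    transfer⁻ {c} {d} h i< e = trans (extend-vertex f i<) (part-sound f _ (trans (h (vertex i<))
      (part-true g _ (trans (sym (extend-vertex g i<)) e))))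
    go : ReComMove G f g ⊎ SamePartition f g → ⊥
    go (inj₂ same) = n′₀₅ (trans (extend-vertex g 0<6a) (trans (⌊⌋-sound (_ Fin.≟ _) (trans (sym (same (vertex 0<6a) (vertex 5a<6a)))
      (⌊⌋-true (_ Fin.≟ _) (trans (sym (extend-vertex f 0<6a)) (trans t (extend-vertex f 5a<6a)))))) (sym (extend-vertex g 5a<6a))))
    -- The kept part has the colour of 0, of `2 * a` or of `3 * a` in `f`. If that of 0, it also
    -- contains `5 * a`, and 0 and `5 * a` would agree in `g`. Otherwise it contains exactly one of
    -- `2 * a` and `3 * a`, while every part of `g` contains both or neither.
    go (inj₁ (c , d , h , _)) with exhaust _ _ _ c (F0≢F2a (balanced f fb)) n₂₃ n₀₃
    ... | inj₁ e = n′₀₅ (trans (transfer h 0<6a (sym e)) (sym (transfer h 5a<6a (trans (sym t) (sym e)))))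
    ... | inj₂ (inj₁ e) = n₂₃ (trans (sym e) (sym (transfer⁻ h 3a<6a (trans (sym e′) (transfer h 2a<6a (sym e))))))
    ... | inj₂ (inj₂ e) = n₂₃ (sym (trans (sym e) (sym (transfer⁻ h 2a<6a (trans e′ (transfer h 3a<6a (sym e)))))))

  top-star : ∀ {f g} → Star (ReComStep G (2 * a)) f g → Top f → Top g
  top-star ε t = t
  top-star (s ◅ ss) t = top-star ss (top-invariant s t)

-- The upper bound for the weight of balanced partitions

module Upper (k a : ℕ) (a≡ : a ≡ 5 * k + 1) (m : ℕ) (m≡ : m ≡ 6 * a) where

  open Edges k a a≡
  open Structure k a a≡
  open Balance k a a≡ m m≡

  module _ {A B : Set} (p : A → Bool) (g : A → B) where

    select : List A → List B
    select = concatMap (λ x → if p x then g x ∷ [] else [])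

    ∈-select⁻ : ∀ xs {y} → y ∈ select xs → ∃ λ x → x ∈ xs × p x ≡ true × y ≡ g x
    ∈-select⁻ (x ∷ xs) i with p x in e
    ∈-select⁻ (x ∷ xs) (here refl) | true = x , here refl , e , refl
    ∈-select⁻ (x ∷ xs) (there i) | true = let (x′ , j , r) = ∈-select⁻ xs i in x′ , there j , r
    ∈-select⁻ (x ∷ xs) i | false = let (x′ , j , r) = ∈-select⁻ xs i in x′ , there j , r

    ∈-select⁺ : ∀ {xs x} → x ∈ xs → p x ≡ true → g x ∈ select xs
    ∈-select⁺ {x ∷ xs} (here refl) e rewrite e = here refl
    ∈-select⁺ {x ∷ xs} (there i) e = ∈-++⁺ʳ (if p x then g x ∷ [] else []) (∈-select⁺ i e)

    select-unique : (∀ {x y} → g x ≡ g y → x ≡ y) → ∀ {xs} → Unique xs → Unique (select xs)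
    select-unique inj [] = []
    select-unique inj {x ∷ xs} (d ∷ ds) with p x
    ... | false = select-unique inj ds
    ... | true  = All.tabulate (λ {y} i e → let (x′ , j , _ , e′) = ∈-select⁻ xs i in
                    All.lookup d j (inj (trans e e′))) ∷ select-unique inj ds

  concatMap-unique : ∀ {A B : Set} (h : A → List B) (key : B → A) (xs : List A) → Unique xs →
    (∀ x → Unique (h x)) → (∀ x {y} → y ∈ h x → key y ≡ x) → Unique (concatMap h xs)
  concatMap-unique h key []       _        _ _ = []
  concatMap-unique h key (x ∷ xs) (d ∷ ds) u r =
    Unique.++⁺ (u x) (concatMap-unique h key xs ds u r) λ { (i , j) →
      let (x′ , x′∈ , j′) = find (∈-concatMap⁻ h {xs = xs} j) in
      All.lookup d x′∈ (trans (sym (r x i)) (r x′ j′)) }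

  module _ (U : VSet m) where

    private
      row : Fin m → List (Edge m)
      row u = concatMap (λ v → if ⌊ u Fin.<? v ⌋ ∧ U u ∧ U v ∧ adj G u v then (u , v) ∷ [] else []) (allFin m)

    inducedEdges-unique : Unique (inducedEdges G U)
    inducedEdges-unique = concatMap-unique row proj₁ (allFin m) (Unique.allFin⁺ m)
      (λ u → select-unique _ (u ,_) (λ { refl → refl }) (Unique.allFin⁺ m))
      λ u i → let (_ , _ , _ , e) = ∈-select⁻ _ (u ,_) (allFin m) i in cong proj₁ e

    ∈-inducedEdges⁻ : ∀ {e} → e ∈ inducedEdges G U →
      U (proj₁ e) ≡ true × U (proj₂ e) ≡ true × Edge< (toℕ (proj₁ e)) (toℕ (proj₂ e))
    ∈-inducedEdges⁻ i with find (∈-concatMap⁻ row {xs = allFin m} i)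
    ... | u , _ , j with ∈-select⁻ _ (u ,_) (allFin m) j
    ... | v , _ , t , refl with ∧-split {⌊ u Fin.<? v ⌋} t
    ... | u<v , t₁ with ∧-split {U u} t₁
    ... | Uu , t₂ with ∧-split {U v} t₂
    ... | Uv , uv = Uu , Uv , [ id , (λ e → ⊥-elim (<-asym (edge-< e) (⌊⌋-sound (u Fin.<? v) u<v))) ]′ (adj-sound uv)

    ∈-inducedEdges⁺ : ∀ {u v} → U u ≡ true → U v ≡ true → Edge< (toℕ u) (toℕ v) → (u , v) ∈ inducedEdges G U
    ∈-inducedEdges⁺ {u} {v} Uu Uv e = ∈-concatMap⁺ row (lose (∈-allFin u) (∈-select⁺ _ (u ,_) (∈-allFin v)
      (∧-true (⌊⌋-true (u Fin.<? v) (edge-< e)) (∧-true Uu (∧-true Uv (adj-true (inj₁ e)))))))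

  -- An injective code for the edges inside parts: edges of the Hamilton cycle, then one symbol for each pair of opposite chords.

  module _ {F : ℕ → Fin 3} (A : Arcs F) where

    data PartCode (u v : ℕ) : ℕ ⊎ ℕ → Set where
      c-rail   : v < 6 * a → v ≡ suc u → PartCode u v (inj₁ u)
      c-wrap   : u ≡ 0 → suc v ≡ 6 * a → PartCode u v (inj₁ v)
      c-chordL : ∀ q → q ≤ k → u ≡ 5 * q → u + v ≡ 2 * a → F u ≡ F v → PartCode u v (inj₂ q)
      c-chordR : ∀ q → q ≤ k → u + suc (5 * q) ≡ 4 * a → u + v ≡ 8 * a → F u ≡ F v → PartCode u v (inj₂ q)

    partCodes : List (ℕ ⊎ ℕ)
    partCodes = map inj₁ (interval 0 (6 * a)) ++ map inj₂ (interval 0 (suc k))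

    length-partCodes : length partCodes ≡ 6 * a + suc k
    length-partCodes rewrite length-++ (map {B = ℕ ⊎ ℕ} inj₁ (interval 0 (6 * a))) {map inj₂ (interval 0 (suc k))}
      | length-map {B = ℕ ⊎ ℕ} inj₁ (interval 0 (6 * a)) | length-map {A = ℕ} {B = ℕ ⊎ ℕ} inj₂ (interval 0 (suc k))
      | length-interval 0 (6 * a) | length-interval 0 (suc k) = refl

    clash : ∀ {u v u′ v′ q} → q ≤ k → u ≡ 5 * q → u + v ≡ 2 * a → F u ≡ F v →
            u′ + suc (5 * q) ≡ 4 * a → u′ + v′ ≡ 8 * a → F u′ ≡ F v′ → ⊥
    clash {u} {v} {u′} {v′} {q} q≤k refl s Fuv s′ t′ Fuv′ = one-chord-cut A q q≤k
      (trans Fuv (cong F (trans (sym (m+n∸m≡n u v)) (cong (_∸ u) s))))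
      (trans (cong F (trans (cong (_∸ suc (5 * q)) (sym s′)) (m+n∸n≡m u′ (suc (5 * q))))) (trans Fuv′ (cong F
        (linear 4 (λ a q u v → u :+ (con 1 :+ 5 :* q) :≡ 4 :* a ⇒ u :+ v :≡ 8 :* a ⇒ ⊢ v :≡ 4 :* a :+ (con 1 :+ 5 :* q))
                (a ∷ q ∷ u′ ∷ v′ ∷ []) s′ t′))))

    partCode-injective : ∀ {u v u′ v′ c} → PartCode u v c → PartCode u′ v′ c → u ≡ u′ × v ≡ v′
    partCode-injective (c-rail _ e) (c-rail _ e′) = refl , trans e (sym e′)
    partCode-injective (c-rail l e) (c-wrap _ e′) = ⊥-elim (<-irrefl refl (subst (_< 6 * a) (trans e e′) l))
    partCode-injective (c-wrap _ e′) (c-rail l e) = ⊥-elim (<-irrefl refl (subst (_< 6 * a) (trans e e′) l))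
    partCode-injective (c-wrap e s) (c-wrap e′ s′) = trans e (sym e′) , refl
    partCode-injective {u} {v} {u′} {v′} (c-chordL q _ e s _) (c-chordL q _ e′ s′ _) with trans e (sym e′)
    ... | refl = refl , +-cancelˡ-≡ u _ _ (trans s (sym s′))
    partCode-injective {u} {v} {u′} {v′} (c-chordR q _ e s _) (c-chordR q _ e′ s′ _) with +-cancelʳ-≡ (suc (5 * q)) u u′ (trans e (sym e′))
    ... | refl = refl , +-cancelˡ-≡ u _ _ (trans s (sym s′))
    partCode-injective (c-chordL q l e s F≡) (c-chordR q l′ e′ s′ F≡′) = ⊥-elim (clash l e s F≡ e′ s′ F≡′)
    partCode-injective (c-chordR q l′ e′ s′ F≡′) (c-chordL q l e s F≡) = ⊥-elim (clash l e s F≡ e′ s′ F≡′)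

    partCode : ∀ {u v} → v < 6 * a → Edge< u v → F u ≡ F v → ∃ λ c → c ∈ partCodes × PartCode u v c
    partCode {u} {v} v< (rail e) _ =
      inj₁ u , ∈-++⁺ˡ (∈-map⁺ inj₁ (∈-interval⁺ 0 (6 * a) z≤n (<-trans (≤-reflexive (sym e)) v<))) , c-rail v< e
    partCode {u} {v} v< (wrap e e′) _ = inj₁ v , ∈-++⁺ˡ (∈-map⁺ inj₁ (∈-interval⁺ 0 (6 * a) z≤n v<)) , c-wrap e e′
    partCode v< (chordL q l e s) F≡ =
      inj₂ q , ∈-++⁺ʳ (map inj₁ (interval 0 (6 * a))) (∈-map⁺ inj₂ (∈-interval⁺ 0 (suc k) z≤n (s≤s l))) , c-chordL q l e s F≡
    partCode {u} v< (chordR q l e s) F≡ =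
      -- A right chord receives the symbol of its partner, the left chord with the complementary
      -- number.
      inj₂ (k ∸ q) , ∈-++⁺ʳ (map inj₁ (interval 0 (6 * a))) (∈-map⁺ inj₂ (∈-interval⁺ 0 (suc k) z≤n (s≤s (m∸n≤m k q)))) ,
      c-chordR (k ∸ q) (m∸n≤m k q)
        (linear 5 (λ a k q u r → a :≡ 5 :* k :+ con 1 ⇒ r :+ q :≡ k ⇒ u :≡ 3 :* a :+ 5 :* q ⇒ ⊢ u :+ (con 1 :+ 5 :* r) :≡ 4 :* a)
                (a ∷ k ∷ q ∷ u ∷ k ∸ q ∷ []) a≡ (m∸n+n≡m l) e)
        s F≡

  module _ (f : Labeling m) (f-bal : balancedᵇ G (2 * a) f ≡ true) where

    private
      E : Fin 3 → List (Edge m)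
      E i = inducedEdges G (part f i)
      all-edges = E i0 ++ E i1 ++ E i2

      ∈E : ∀ i {e} → e ∈ E i → f (proj₁ e) ≡ i × f (proj₂ e) ≡ i × Edge< (toℕ (proj₁ e)) (toℕ (proj₂ e))
      ∈E i j = let (p , q , r) = ∈-inducedEdges⁻ (part f i) j in part-sound f _ p , part-sound f _ q , r

      disjoint : ∀ {i j} → i ≢ j → ∀ {e} → ¬ (e ∈ E i × e ∈ E j)
      disjoint {i} {j} i≢j (p , q) = i≢j (trans (sym (proj₁ (∈E i p))) (proj₁ (∈E j q)))

      unique : Unique all-edges
      unique = Unique.++⁺ (inducedEdges-unique (part f i0))
        (Unique.++⁺ (inducedEdges-unique (part f i1)) (inducedEdges-unique (part f i2)) (disjoint {i1} {i2} λ ()))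
        λ { (p , q) → [ (λ r → disjoint {i0} {i1} (λ ()) (p , r)) , (λ r → disjoint {i0} {i2} (λ ()) (p , r)) ]′ (∈-++⁻ (E i1) q) }

      within : ∀ {e} → e ∈ all-edges → f (proj₁ e) ≡ f (proj₂ e) × Edge< (toℕ (proj₁ e)) (toℕ (proj₂ e))
      within {e} i with ∈-++⁻ (E i0) i
      ... | inj₁ j = let (p , q , r) = ∈E i0 j in trans p (sym q) , r
      ... | inj₂ j with ∈-++⁻ (E i1) j
      ...   | inj₁ l = let (p , q , r) = ∈E i1 l in trans p (sym q) , r
      ...   | inj₂ l = let (p , q , r) = ∈E i2 l in trans p (sym q) , r

      A = arcs (balanced f f-bal)

    edge-bound : length (E i0) + (length (E i1) + length (E i2)) ≤ 6 * a + suc k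
    edge-bound = subst₂ _≤_ (trans (length-++ (E i0)) (cong (length (E i0) +_) (length-++ (E i1)))) (length-partCodes A)
      (injection-length (λ e c → PartCode A (toℕ (proj₁ e)) (toℕ (proj₂ e)) c) _≢_
        (λ { {u , v} {u′ , v′} p q ne → let (r , s) = partCode-injective A p q in
             ne (cong₂ _,_ (Fin.toℕ-injective r) (Fin.toℕ-injective s)) })
        all-edges (partCodes A) unique
        λ { {u , v} i → let (e , r) = within i in
            partCode A (toℕ<6a v) r (trans (extend-toℕ f u) (trans e (sym (extend-toℕ f v)))) })

    module _ (t : ℕ) where

      private
        N = 2 * a ∸ 1

      -- Of a spanning tree only its number of edges is remembered, one less than the `2 * a`
      -- vertices of the part; connectivity is given away.
      τ-bound : ∀ i → τ G (part f i) * t ^ N ≤ suc t ^ length (E i)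
      τ-bound i = sublists-of-length t (isSpanningTreeᵇ (part f i)) N (E i) λ S e →
        trans (sym (m+n∸n≡m (length S) 1)) (cong (_∸ 1) (trans
          (≡ᵇ-sound {length S + 1} (proj₁ (∧-split {length S + 1 ≡ᵇ count (part f i)} {connectedOnᵇ (edgeRel S) (part f i)} e)))
          (proj₁ (balanced⇒parts G f (2 * a) f-bal i))))

      -- The exponents of the three bounds add up, so only the total number of edges inside the
      -- parts matters, not their distribution over the parts.
      τP-bound : τP G f * (t ^ N * t ^ N * t ^ N) ≤ suc t ^ (6 * a + suc k)
      τP-bound = ≤-trans (≤-reflexive (regroup (τ G (part f i0)) (τ G (part f i1)) (τ G (part f i2)) (t ^ N)))
        (≤-trans (*-mono-≤ (*-mono-≤ (τ-bound i0) (τ-bound i1)) (τ-bound i2))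
        (≤-trans (≤-reflexive powers) (^-monoʳ-≤ (suc t) edge-bound)))
        where
        regroup : ∀ x y z p → x * y * z * (p * p * p) ≡ (x * p) * (y * p) * (z * p)
        regroup x y z p = trans ([m*n]*[o*p]≡[m*o]*[n*p] (x * y) z (p * p) p)
                                (cong (_* (z * p)) ([m*n]*[o*p]≡[m*o]*[n*p] x y p p))
        powers : suc t ^ length (E i0) * suc t ^ length (E i1) * suc t ^ length (E i2)
               ≡ suc t ^ (length (E i0) + (length (E i1) + length (E i2)))
        powers = trans (*-assoc (suc t ^ length (E i0)) _ _)
          (trans (cong (suc t ^ length (E i0) *_) (sym (^-distribˡ-+-* (suc t) (length (E i1)) (length (E i2)))))
                 (sym (^-distribˡ-+-* (suc t) (length (E i0)) _)))

  ArcCode : Set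
  ArcCode = Fin 3 × Fin 3 × Fin 3 × ℕ

  arcColour : ArcCode → ℕ → Fin 3
  arcColour (x , y , z , p) i =
    if ⌊ i <? p ⌋ then x else if ⌊ i <? p + 2 * a ⌋ then y else if ⌊ i <? p + 4 * a ⌋ then z else x

  arcLabeling : ArcCode → Labeling m
  arcLabeling c v = arcColour c (toℕ v)

  length-cartesianProduct : ∀ {A B : Set} (xs : List A) (ys : List B) →
                            length (cartesianProduct xs ys) ≡ length xs * length ys
  length-cartesianProduct []       ys = refl
  length-cartesianProduct (x ∷ xs) ys = trans (length-++ (map (x ,_) ys))
    (cong₂ _+_ (length-map (x ,_) ys) (length-cartesianProduct xs ys))

  -- Three colours and the first change determine a labeling by arcs. Codes with repeated colours
  -- are kept as well; the longer list only costs a constant factor.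
  arcCodes : List ArcCode
  arcCodes = cartesianProduct (allFin 3) (cartesianProduct (allFin 3) (cartesianProduct (allFin 3) (interval 0 (suc (2 * a)))))

  colour-triples : ∀ (ns : List ℕ) →
    length (cartesianProduct (allFin 3) (cartesianProduct (allFin 3) (cartesianProduct (allFin 3) ns))) ≡ 27 * length ns
  colour-triples ns =
    trans (length-cartesianProduct (allFin 3) (cartesianProduct (allFin 3) ns₁)) (trans (cong (3 *_)
      (trans (length-cartesianProduct (allFin 3) ns₁) (cong (3 *_) (length-cartesianProduct (allFin 3) ns))))
      (linear 1 (λ b → ⊢ 3 :* (3 :* (3 :* b)) :≡ 27 :* b) (length ns ∷ [])))
    where
    ns₁ = cartesianProduct (allFin 3) ns

  length-arcCodes : length arcCodes ≡ 27 * suc (2 * a)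
  length-arcCodes = trans (colour-triples (interval 0 (suc (2 * a)))) (cong (27 *_) (length-interval 0 (suc (2 * a))))

  arcs⇒code : ∀ f → Arcs (extend f) → ∃ λ c → c ∈ arcCodes × (∀ v → f v ≡ arcLabeling c v)
  arcs⇒code f A =
    (x , y , z , p) ,
    ∈-cartesianProduct⁺ (∈-allFin x) (∈-cartesianProduct⁺ (∈-allFin y) (∈-cartesianProduct⁺ (∈-allFin z)
      (∈-interval⁺ 0 (suc (2 * a)) z≤n (s≤s p≤2a)))) ,
    λ v → trans (sym (extend-toℕ f v)) (agree v)
    where
    open Arcs A
    agree : ∀ v → extend f (toℕ v) ≡ arcLabeling (x , y , z , p) v
    agree v with toℕ v <? p | toℕ v <? p + 2 * a | toℕ v <? p + 4 * a
    ... | yes l | _ | _ = arc₀ l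
    ... | no g | yes l | _ = arc₁ (≮⇒≥ g) l
    ... | no _ | no g | yes l = arc₂ (≮⇒≥ g) l
    ... | no _ | no _ | no g = arc₃ (≮⇒≥ g) (toℕ<6a v)

  balanced-weight : ∀ t → let N = 2 * a ∸ 1 in
    Wlab G (2 * a) (2 * a) (2 * a) * (t ^ N * t ^ N * t ^ N) ≤ length arcCodes * suc t ^ (6 * a + suc k)
  balanced-weight t = Wlab-≤ G (2 * a) (2 * a) (2 * a) (t ^ N * t ^ N * t ^ N) (suc t ^ (6 * a + suc k)) arcLabeling arcCodes
    (λ f e → τP-bound f e t) (λ f e → arcs⇒code f (arcs (balanced f e)))
    where
    N = 2 * a ∸ 1

-- Walks along the cycle; existence of balanced partitions

module Paths (k a : ℕ) (a≡ : a ≡ 5 * k + 1) (m : ℕ) (m≡ : m ≡ 6 * a) where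

  open Edges k a a≡
  open Balance k a a≡ m m≡
  open Upper k a a≡ m m≡

  module _ {R : ℕ → ℕ → Set} where

    chain-down : ∀ s d → (∀ i → s ≤ i → i < s + d → R (suc i) i) → ∀ {v} → s ≤ v → v ≤ s + d → Star R v s
    chain-down s d step {v} s≤v v≤ with m≤n⇒m<n∨m≡n s≤v
    ... | inj₂ refl = ε
    chain-down s d step {suc v} s≤v v≤ | inj₁ (s≤s s≤v′) = step v s≤v′ v≤ ◅ chain-down s d step s≤v′ (<⇒≤ v≤)

    chain-up : ∀ s d → (∀ i → s ≤ i → i < s + d → R i (suc i)) → ∀ {v} → s ≤ v → v ≤ s + d → Star R v (s + d)
    chain-up s zero step {v} s≤v v≤ = subst (λ w → Star R w (s + 0)) (≤-antisym (subst (_≤ v) (sym (+-identityʳ s)) s≤v) v≤) ε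
    chain-up s (suc d) step {v} s≤v v≤ with m≤n⇒m<n∨m≡n v≤
    ... | inj₂ refl = ε
    ... | inj₁ v< = subst (Star R v) (sym (+-suc s d))
      (chain-up s d (λ i l h → step i l (<-trans h last)) s≤v (≤-pred (subst (v <_) (+-suc s d) v<)) ◅◅
        step (s + d) (m≤m+n s d) last ◅ ε)
      where
      last : s + d < s + suc d
      last = ≤-reflexive (sym (+-suc s d))

  module _ (E : Fin m → Fin m → Bool) (U : VSet m) (R : ℕ → ℕ → Set)
           (bounded : ∀ {i j} → R i j → j < 6 * a)
           (sound : ∀ u v → R (toℕ u) (toℕ v) → Link E U u v) where

    lift-star : ∀ {i j} → Star R i j → ∀ u v → toℕ u ≡ i → toℕ v ≡ j → Star (Link E U) u v
    lift-star ε u v p q with Fin.toℕ-injective (trans p (sym q))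
    ... | refl = ε
    lift-star (_◅_ {j = j} r rs) u v refl q = sound u w (subst (R (toℕ u)) (sym w≡) r) ◅ lift-star rs w v w≡ q
      where
      w = vertex (bounded r)
      w≡ : toℕ w ≡ j
      w≡ = toℕ-vertex (bounded r)

    star⇒connected : (∀ u v → E u v ≡ true → E v u ≡ true) → ∀ {r} → r < 6 * a →
                     (∀ v → U v ≡ true → Star R (toℕ v) r) → connectedOnᵇ E U ≡ true
    star⇒connected E-sym r< to = root⇒connected E U E-sym (vertex r<)
      λ v Uv → lift-star (to v Uv) v (vertex r<) refl (toℕ-vertex r<)

  top : ℕ
  top = 6 * a ∸ 1

  suc-top : suc top ≡ 6 * a
  suc-top = m+[n∸m]≡n {1} 0<6a

  top< : top < 6 * a
  top< = ≤-reflexive suc-top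

  adj-flip : ∀ (u v : Fin m) → adj G u v ≡ true → adj G v u ≡ true
  adj-flip u v e = adj-true (swap (adj-sound e))

  module _ (f : Labeling m) (F : ℕ → Fin 3) (f≗F : ∀ v → f v ≡ F (toℕ v)) where

    record Inside (x : Fin 3) (i j : ℕ) : Set where
      constructor inside
      field
        i<  : i < 6 * a
        j<  : j < 6 * a
        F-i : F i ≡ x
        F-j : F j ≡ x
        i~j : Adj i j

    in-part : ∀ {x} v → F (toℕ v) ≡ x → part f x v ≡ true
    in-part v e = part-true f v (trans (f≗F v) e)

    in-part⁻ : ∀ {x} v → part f x v ≡ true → F (toℕ v) ≡ x
    in-part⁻ v e = trans (sym (f≗F v)) (part-sound f v e)

    part-connected : ∀ x {r} → r < 6 * a → (∀ {i} → i < 6 * a → F i ≡ x → Star (Inside x) i r) →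
                     inducedConnectedᵇ G (part f x) ≡ true
    part-connected x r< to = star⇒connected (adj G) (part f x) (Inside x) Inside.j<
      (λ { u v (inside _ _ p q e) → in-part u p , in-part v q , adj-true e }) adj-flip r<
      λ v e → to (toℕ<6a v) (in-part⁻ v e)

    interval-count : ∀ x s d → s + d ≤ 6 * a → (∀ {i} → s ≤ i → i < s + d → F i ≡ x) →
                     (∀ {i} → i < 6 * a → F i ≡ x → s ≤ i × i < s + d) → count (part f x) ≡ d
    interval-count x s d le to from = ≤-antisym
      (count-≤-interval (part f x) s d λ v e → from (toℕ<6a v) (in-part⁻ v e))
      (count-≥-interval (part f x) s d (subst (s + d ≤_) (sym m≡) le) λ v l h → in-part v (to l h))

    interval-connected : ∀ x s d → s + d < 6 * a → (∀ {i} → s ≤ i → i ≤ s + d → F i ≡ x) →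
                         (∀ {i} → i < 6 * a → F i ≡ x → s ≤ i × i ≤ s + d) → inducedConnectedᵇ G (part f x) ≡ true
    interval-connected x s d lt to from = part-connected x (≤-<-trans (m≤m+n s d) lt) λ i< e →
      chain-down s d (λ i l h → inside (≤-<-trans h lt) (<-trans h lt) (to (≤-trans l (n≤1+n i)) h) (to l (<⇒≤ h)) (inj₂ (rail refl)))
        (proj₁ (from i< e)) (proj₂ (from i< e))

  graph-connected : ConnectedGraph G
  graph-connected = star⇒connected (adj G) (λ _ → true) (λ i j → j < 6 * a × Adj i j) proj₁
    (λ { u v (_ , e) → refl , refl , adj-true e }) adj-flip 0<6a
    λ v _ → chain-down 0 (toℕ v) (λ i _ h → <-trans h (toℕ<6a v) , inj₂ (rail refl)) z≤n ≤-refl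

  module _ (p : ℕ) (1≤p : 1 ≤ p) (p≤2a : p ≤ 2 * a) where

    private
      F = arcColour (i0 , i1 , i2 , p)
      f = arcLabeling (i0 , i1 , i2 , p)

      F₀ : ∀ {i} → i < p → F i ≡ i0
      F₀ {i} l with i <? p
      ... | yes _ = refl
      ... | no g  = ⊥-elim (g l)

      F₁ : ∀ {i} → p ≤ i → i < p + 2 * a → F i ≡ i1
      F₁ {i} l h with i <? p | i <? p + 2 * a
      ... | yes g | _     = ⊥-elim (<⇒≱ g l)
      ... | no _  | yes _ = refl
      ... | no _  | no g  = ⊥-elim (g h)

      F₂ : ∀ {i} → p + 2 * a ≤ i → i < p + 4 * a → F i ≡ i2
      F₂ {i} l h with i <? p | i <? p + 2 * a | i <? p + 4 * a
      ... | yes g | _     | _     = ⊥-elim (<⇒≱ g (≤-trans (m≤m+n p _) l))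
      ... | no _  | yes g | _     = ⊥-elim (<⇒≱ g l)
      ... | no _  | no _  | yes _ = refl
      ... | no _  | no _  | no g  = ⊥-elim (g h)

      p+2a≤p+4a : p + 2 * a ≤ p + 4 * a
      p+2a≤p+4a = linear 2 (λ a p → ⊢ p :+ 2 :* a :≤ p :+ 4 :* a) (a ∷ p ∷ [])

      F₃ : ∀ {i} → p + 4 * a ≤ i → F i ≡ i0
      F₃ {i} l with i <? p | i <? p + 2 * a | i <? p + 4 * a
      ... | yes g | _     | _     = refl
      ... | no _  | yes g | _     = ⊥-elim (<⇒≱ g (≤-trans p+2a≤p+4a l))
      ... | no _  | no _  | yes g = ⊥-elim (<⇒≱ g l)
      ... | no _  | no _  | no _  = refl

      F⁻ : ∀ i → (i < p ⊎ p + 4 * a ≤ i) × F i ≡ i0 ⊎ (p ≤ i × i < p + 2 * a) × F i ≡ i1 ⊎ (p + 2 * a ≤ i × i < p + 4 * a) × F i ≡ i2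
      F⁻ i with ≤-<-connex p i
      ... | inj₂ l = inj₁ (inj₁ l , F₀ l)
      ... | inj₁ l with ≤-<-connex (p + 2 * a) i
      ...   | inj₂ h = inj₂ (inj₁ ((l , h) , F₁ l h))
      ...   | inj₁ l′ with ≤-<-connex (p + 4 * a) i
      ...     | inj₂ h = inj₂ (inj₂ ((l′ , h) , F₂ l′ h))
      ...     | inj₁ l″ = inj₁ (inj₂ l″ , F₃ l″)

      F₀⁻ : ∀ {i} → F i ≡ i0 → i < p ⊎ p + 4 * a ≤ i
      F₀⁻ {i} e with F⁻ i
      ... | inj₁ (r , _) = r
      ... | inj₂ (inj₁ (_ , e′)) with trans (sym e) e′
      ...   | ()
      F₀⁻ {i} e | inj₂ (inj₂ (_ , e′)) with trans (sym e) e′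
      ...   | ()

      F₁⁻ : ∀ {i} → F i ≡ i1 → p ≤ i × i < p + 2 * a
      F₁⁻ {i} e with F⁻ i
      ... | inj₂ (inj₁ (r , _)) = r
      ... | inj₁ (_ , e′) with trans (sym e) e′
      ...   | ()
      F₁⁻ {i} e | inj₂ (inj₂ (_ , e′)) with trans (sym e) e′
      ...   | ()

      F₂⁻ : ∀ {i} → F i ≡ i2 → p + 2 * a ≤ i × i < p + 4 * a
      F₂⁻ {i} e with F⁻ i
      ... | inj₂ (inj₂ (r , _)) = r
      ... | inj₁ (_ , e′) with trans (sym e) e′
      ...   | ()
      F₂⁻ {i} e | inj₂ (inj₁ (_ , e′)) with trans (sym e) e′
      ...   | ()

      p+2a≤ : p + 2 * a ≤ 6 * a
      p+2a≤ = linear 2 (λ a p → p :≤ 2 :* a ⇒ ⊢ p :+ 2 :* a :≤ 6 :* a) (a ∷ p ∷ []) p≤2a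
      p+4a≤ : p + 4 * a ≤ 6 * a
      p+4a≤ = linear 2 (λ a p → p :≤ 2 :* a ⇒ ⊢ p :+ 4 :* a :≤ 6 :* a) (a ∷ p ∷ []) p≤2a
      p+2a+2a : p + 2 * a + 2 * a ≡ p + 4 * a
      p+2a+2a = linear 2 (λ a p → ⊢ p :+ 2 :* a :+ 2 :* a :≡ p :+ 4 :* a) (a ∷ p ∷ [])

      D = 2 * a ∸ 1
      suc-D : suc D ≡ 2 * a
      suc-D = m+[n∸m]≡n {1} (≤-trans 1≤a (m≤m+n a _))

      arc-end : ∀ {i} s → i ≤ s + D → i < s + 2 * a
      arc-end {i} s l = subst (λ w → i < s + w) suc-D (subst (suc i ≤_) (sym (+-suc s D)) (s≤s l))
      arc-end⁻ : ∀ {i} s → i < s + 2 * a → i ≤ s + D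
      arc-end⁻ {i} s l = ≤-pred (subst (suc i ≤_) (+-suc s D) (subst (λ w → i < s + w) (sym suc-D) l))

      count₁ : count (part f i1) ≡ 2 * a
      count₁ = interval-count f F (λ _ → refl) i1 p (2 * a) p+2a≤ F₁ λ _ → F₁⁻

      count₂ : count (part f i2) ≡ 2 * a
      count₂ = interval-count f F (λ _ → refl) i2 (p + 2 * a) (2 * a) (subst (_≤ 6 * a) (sym p+2a+2a) p+4a≤)
        (λ {i} l h → F₂ l (subst (i <_) p+2a+2a h)) λ {i} _ e → let (l , h) = F₂⁻ e in l , subst (i <_) (sym p+2a+2a) h

      count₀ : count (part f i0) ≡ 2 * a
      count₀ = linear 4 (λ a c₀ c₁ c₂ → c₀ :+ c₁ :+ c₂ :≡ 6 :* a ⇒ c₁ :≡ 2 :* a ⇒ c₂ :≡ 2 :* a ⇒ ⊢ c₀ :≡ 2 :* a)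
        (a ∷ count (part f i0) ∷ count (part f i1) ∷ count (part f i2) ∷ []) (trans (count-parts f) m≡) count₁ count₂

      conn₁ : inducedConnectedᵇ G (part f i1) ≡ true
      conn₁ = interval-connected f F (λ _ → refl) i1 p D (<-≤-trans (arc-end p ≤-refl) p+2a≤) (λ l h → F₁ l (arc-end p h))
        λ _ e → let (l , h) = F₁⁻ e in l , arc-end⁻ p h

      conn₂ : inducedConnectedᵇ G (part f i2) ≡ true
      conn₂ = interval-connected f F (λ _ → refl) i2 (p + 2 * a) D
        (<-≤-trans (arc-end (p + 2 * a) ≤-refl) (subst (_≤ 6 * a) (sym p+2a+2a) p+4a≤))
        (λ {i} l h → F₂ l (subst (i <_) p+2a+2a (arc-end (p + 2 * a) h)))
        λ {i} _ e → let (l , h) = F₂⁻ e in l , arc-end⁻ (p + 2 * a) (subst (i <_) (sym p+2a+2a) h)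

      conn₀ : inducedConnectedᵇ G (part f i0) ≡ true
      conn₀ = part-connected f F (λ _ → refl) i0 0<6a λ i< e → [ lower , (λ l → upper l i<) ]′ (F₀⁻ e)
        where
        lower : ∀ {i} → i < p → Star (Inside f F (λ _ → refl) i0) i 0
        lower {i} i<p = chain-down 0 i (λ j _ h → inside (<-≤-trans (≤-<-trans h i<p) p≤6a) (<-≤-trans (<-trans h i<p) p≤6a)
            (F₀ (≤-<-trans h i<p)) (F₀ (<-trans h i<p)) (inj₂ (rail refl))) z≤n ≤-refl
          where
          p≤6a = ≤-trans p≤2a 2a≤6a
        upper : ∀ {i} → p + 4 * a ≤ i → i < 6 * a → Star (Inside f F (λ _ → refl) i0) i 0
        upper {i} l h = subst (Star _ i) end
            (chain-up i (top ∸ i) (λ j i≤j j< → inside (<-trans j< e<) (≤-<-trans j< e<)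
              (F₃ (≤-trans l i≤j)) (F₃ (≤-trans l (≤-trans i≤j (n≤1+n j)))) (inj₁ (rail refl))) ≤-refl (m≤m+n i _))
            ◅◅ inside top< 0<6a (F₃ (≤-trans l i≤top)) (F₀ 1≤p) (inj₂ (wrap refl suc-top)) ◅ ε
          where
          i≤top : i ≤ top
          i≤top = ≤-pred (subst (suc i ≤_) (sym suc-top) h)
          end : i + (top ∸ i) ≡ top
          end = m+[n∸m]≡n i≤top
          e< : i + (top ∸ i) < 6 * a
          e< = subst (_< 6 * a) (sym end) top<

    -- Arcs of the Hamilton cycle are connected along rails, and the arc through 0 by the wrap edge
    -- if it extends to both sides of 0. Different `p` will provide balanced partitions of both
    -- kinds.
    arc-balanced : balancedᵇ G (2 * a) f ≡ true
    arc-balanced = parts⇒valid G f (2 * a) (2 * a) (2 * a) 1≤2a 1≤2a 1≤2a (count₀ , conn₀) (count₁ , conn₁) (count₂ , conn₂)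
      where
      1≤2a = ≤-trans 1≤a (m≤m+n a _)

-- Spanning trees of a lobe

module Trees (n k a : ℕ) (k≡ : k ≡ suc n) (a≡ : a ≡ 5 * k + 1) (m : ℕ) (m≡ : m ≡ 6 * a) where

  open Edges k a a≡
  open Balance k a a≡ m m≡
  open Upper k a a≡ m m≡
  open Paths k a a≡ m m≡

  module _ {R : ℕ → ℕ → Set} where

    descend : ∀ {s x} → s ≤ x → (∀ {i} → s ≤ i → i < x → R (suc i) i) → Star R x s
    descend {s} {x} s≤x step = chain-down s (x ∸ s)
      (λ i l h → step l (subst (i <_) (m+[n∸m]≡n s≤x) h)) s≤x (≤-reflexive (sym (m+[n∸m]≡n s≤x)))

    ascend : ∀ {s x} → s ≤ x → (∀ {i} → s ≤ i → i < x → R i (suc i)) → Star R s x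
    ascend {s} {x} s≤x step = subst (Star R s) (m+[n∸m]≡n s≤x) (chain-up s (x ∸ s)
      (λ i l h → step l (subst (i <_) (m+[n∸m]≡n s≤x) h)) ≤-refl (m≤m+n s _))

  module _ {m : ℕ} where

    edgeRel-flip : ∀ (F : List (Edge m)) u v → edgeRel F u v ≡ true → edgeRel F v u ≡ true
    edgeRel-flip ((a , b) ∷ F) u v e
      with ⌊ a Fin.≟ u ⌋ ∧ ⌊ b Fin.≟ v ⌋ | ⌊ a Fin.≟ v ⌋ ∧ ⌊ b Fin.≟ u ⌋ | e
    ... | _     | true  | _  = refl
    ... | true  | false | _  = refl
    ... | false | false | e′ = edgeRel-flip F u v e′

    edgeRel-∈ : ∀ {F : List (Edge m)} {u v} → (u , v) ∈ F → edgeRel F u v ≡ true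
    edgeRel-∈ {F = (a , b) ∷ F} {u} {v} (here refl)
      rewrite ⌊⌋-true (a Fin.≟ a) refl | ⌊⌋-true (b Fin.≟ b) refl = refl
    edgeRel-∈ {F = (a , b) ∷ F} {u} {v} (there i) = ∨-trueʳ (edgeRel-∈ i)

  allVecs : ∀ t n → List (Vec (Fin t) n)
  allVecs t zero    = [] ∷ []
  allVecs t (suc n) = cartesianProductWith _∷_ (allFin t) (allVecs t n)

  length-cartesianProductWith : ∀ {A B C : Set} (f : A → B → C) (xs : List A) (ys : List B) →
                                length (cartesianProductWith f xs ys) ≡ length xs * length ys
  length-cartesianProductWith f []       ys = refl
  length-cartesianProductWith f (x ∷ xs) ys = trans (length-++ (map (f x) ys))
    (cong₂ _+_ (length-map (f x) ys) (length-cartesianProductWith f xs ys))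

  length-allVecs : ∀ t n → length (allVecs t n) ≡ t ^ n
  length-allVecs t zero    = refl
  length-allVecs t (suc n) = trans (length-cartesianProductWith _∷_ (allFin t) (allVecs t n))
    (cong₂ _*_ {length (allFin t)} {t} (length-tabulate id) (length-allVecs t n))

  allVecs-unique : ∀ t n → Unique (allVecs t n)
  allVecs-unique t zero    = [] ∷ []
  allVecs-unique t (suc n) = Unique.cartesianProductWith⁺ _∷_ ∷-injective (Unique.allFin⁺ t) (allVecs-unique t n)

  chord-edge : ∀ {β q u v} → β ≡ 0 ⊎ β ≡ 3 * a → q ≤ k → u ≡ β + 5 * q → u + v ≡ β + (β + 2 * a) → Edge< u v
  chord-edge {q = q} (inj₁ refl) q≤k e s = chordL q q≤k e s
  chord-edge {q = q} {u} {v} (inj₂ refl) q≤k e s = chordR q q≤k e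
    (linear 3 (λ a u v → u :+ v :≡ 3 :* a :+ (3 :* a :+ 2 :* a) ⇒ ⊢ u :+ v :≡ 8 :* a) (a ∷ u ∷ v ∷ []) s)

  -- A lobe with chords at distances 5q from its ends. The q-th cell, between chords q and q + 1, has ten rail edges,
  -- numbered c < 10; deleting one of them for each q = 1 .. n and the chords 0 and k leaves a spanning tree.
  module Lobe (β : ℕ) (base : β ≡ 0 ⊎ β ≡ 3 * a) (lo : ℕ) (lo≤1 : lo ≤ 1)
              (U : VSet m) (U-in : ∀ v → U v ≡ true → β + lo ≤ toℕ v × toℕ v + lo ≤ β + 2 * a)
              (U-out : ∀ v → β + lo ≤ toℕ v → toℕ v + lo ≤ β + 2 * a → U v ≡ true)
              (U-count : count U + 2 * lo ≡ 2 * a + 1) where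

    end : ℕ
    end = β + 2 * a

    β≤3a : β ≤ 3 * a
    β≤3a = [ (λ { refl → z≤n }) , ≤-reflexive ]′ base

    end<6a : end < 6 * a
    end<6a = linear 2 (λ a β → con 1 :≤ a ⇒ β :≤ 3 :* a ⇒ ⊢ β :+ 2 :* a :< 6 :* a) (a ∷ β ∷ []) 1≤a β≤3a

    -- `lo` is 1 for the open lobe, which lacks its two end vertices, and 0 for the closed lobe.
    InU : ℕ → Set
    InU x = β + lo ≤ x × x + lo ≤ end

    InU⇒< : ∀ {x} → InU x → x < 6 * a
    InU⇒< {x} (_ , h) = ≤-<-trans (≤-trans (m≤m+n x lo) h) end<6a

    -- The rail edge from `x` to `suc x` as edge `c` of cell `q`. Edges 5 to 9 run down the other
    -- rail from the upper end of chord `q`; edge 5 ends at that vertex, `end ∸ 5 * q`, whence the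
    -- 4.
    data At (q c x : ℕ) : Set where
      lower : c < 5 → x ≡ β + 5 * q + c → At q c x
      upper : 5 ≤ c → x + (5 * q + c) ≡ end + 4 → At q c x

    at : ∀ q c → q ≤ n → c < 10 → ∃ (At q c)
    at q c q≤n c<10 with ≤-<-connex 5 c
    ... | inj₂ c<5 = β + 5 * q + c , lower c<5 refl
    ... | inj₁ 5≤c = end + 4 ∸ (5 * q + c) , upper 5≤c (m∸n+n≡m
      (linear 6 (λ a k n β q c → a :≡ 5 :* k :+ con 1 ⇒ k :≡ con 1 :+ n ⇒ q :≤ n ⇒ c :< con 10 ⇒ ⊢ 5 :* q :+ c :≤ β :+ 2 :* a :+ con 4)
        (a ∷ k ∷ n ∷ β ∷ q ∷ c ∷ []) a≡ k≡ q≤n c<10))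

    -- Cells have disjoint sets of rail edges: on one rail the blocks of five do not overlap, and
    -- cell numbers up to `n` keep the two rails apart.
    at-determined : ∀ {q c q′ c′ x} → q ≤ n → q′ ≤ n → c < 10 → c′ < 10 → At q c x → At q′ c′ x → q ≡ q′ × c ≡ c′
    at-determined {q} {c} {q′} {c′} {x} q≤ q′≤ c< c′< (lower l e) (lower l′ e′) =
      linear 6 (λ β q c q′ c′ x → c :< con 5 ⇒ c′ :< con 5 ⇒ x :≡ β :+ 5 :* q :+ c ⇒ x :≡ β :+ 5 :* q′ :+ c′ ⇒ ⊢ q :≡ q′)
        (β ∷ q ∷ c ∷ q′ ∷ c′ ∷ x ∷ []) l l′ e e′ ,
      linear 6 (λ β q c q′ c′ x → c :< con 5 ⇒ c′ :< con 5 ⇒ x :≡ β :+ 5 :* q :+ c ⇒ x :≡ β :+ 5 :* q′ :+ c′ ⇒ q :≡ q′ ⇒ ⊢ c :≡ c′)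
        (β ∷ q ∷ c ∷ q′ ∷ c′ ∷ x ∷ []) l l′ e e′
        (linear 6 (λ β q c q′ c′ x → c :< con 5 ⇒ c′ :< con 5 ⇒ x :≡ β :+ 5 :* q :+ c ⇒ x :≡ β :+ 5 :* q′ :+ c′ ⇒ ⊢ q :≡ q′)
          (β ∷ q ∷ c ∷ q′ ∷ c′ ∷ x ∷ []) l l′ e e′)
    at-determined {q} {c} {q′} {c′} {x} q≤ q′≤ c< c′< (upper l e) (upper l′ e′) = q≡ , c≡
      where
      s : 5 * q + c ≡ 5 * q′ + c′
      s = +-cancelˡ-≡ x _ _ (trans e (sym e′))
      q≡ : q ≡ q′
      q≡ = linear 4 (λ q c q′ c′ → con 5 :≤ c ⇒ con 5 :≤ c′ ⇒ c :< con 10 ⇒ c′ :< con 10 ⇒ 5 :* q :+ c :≡ 5 :* q′ :+ c′ ⇒ ⊢ q :≡ q′)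
        (q ∷ c ∷ q′ ∷ c′ ∷ []) l l′ c< c′< s
      c≡ : c ≡ c′
      c≡ = linear 4 (λ q c q′ c′ → 5 :* q :+ c :≡ 5 :* q′ :+ c′ ⇒ q :≡ q′ ⇒ ⊢ c :≡ c′) (q ∷ c ∷ q′ ∷ c′ ∷ []) s q≡
    at-determined {q} {c} {q′} {c′} {x} q≤ q′≤ c< c′< (lower l e) (upper l′ e′) = ⊥-elim (apart q≤ q′≤ c′< l e e′)
      where
      apart : ∀ {q c q′ c′ x} → q ≤ n → q′ ≤ n → c′ < 10 → c < 5 → x ≡ β + 5 * q + c → x + (5 * q′ + c′) ≡ end + 4 → ⊥
      apart {q} {c} {q′} {c′} {x} q≤ q′≤ c′< l refl e′ = linear 8 (λ a k n β q c q′ c′ → a :≡ 5 :* k :+ con 1 ⇒ k :≡ con 1 :+ n ⇒ q :≤ n ⇒ q′ :≤ n ⇒ c′ :< con 10 ⇒ c :< con 5 ⇒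
          β :+ 5 :* q :+ c :+ (5 :* q′ :+ c′) :≡ β :+ 2 :* a :+ con 4 ⇒ ⊢ :⊥)
        (a ∷ k ∷ n ∷ β ∷ q ∷ c ∷ q′ ∷ c′ ∷ []) a≡ k≡ q≤ q′≤ c′< l e′
    at-determined {q} {c} {q′} {c′} {x} q≤ q′≤ c< c′< (upper l e) (lower l′ e′) =
      let (p , r) = at-determined q′≤ q≤ c′< c< (lower l′ e′) (upper l e) in sym p , sym r

    -- The rail stays intact on the stretches outside chord 1, by the outer bounds, and at the two
    -- rail edges meeting in the middle vertex `β + a`, by the last clause.
    at-range : ∀ {q c x} → 1 ≤ q → q ≤ n → c < 10 → At q c x → β + 5 ≤ x × x + 6 ≤ end × (x + 2 ≤ β + a ⊎ β + a < x)
    at-range {q} {c} {x} 1≤q q≤ c< (lower l refl) =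
      linear 3 (λ β q c → con 1 :≤ q ⇒ ⊢ β :+ con 5 :≤ β :+ 5 :* q :+ c) (β ∷ q ∷ c ∷ []) 1≤q ,
      linear 6 (λ a k n β q c → a :≡ 5 :* k :+ con 1 ⇒ k :≡ con 1 :+ n ⇒ con 1 :≤ q ⇒ q :≤ n ⇒ c :< con 5 ⇒ ⊢ β :+ 5 :* q :+ c :+ con 6 :≤ β :+ 2 :* a)
              (a ∷ k ∷ n ∷ β ∷ q ∷ c ∷ []) a≡ k≡ 1≤q q≤ l ,
      inj₁ (linear 6 (λ a k n β q c → a :≡ 5 :* k :+ con 1 ⇒ k :≡ con 1 :+ n ⇒ q :≤ n ⇒ c :< con 5 ⇒ ⊢ β :+ 5 :* q :+ c :+ con 2 :≤ β :+ a)
              (a ∷ k ∷ n ∷ β ∷ q ∷ c ∷ []) a≡ k≡ q≤ l)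
    at-range {q} {c} {x} 1≤q q≤ c< (upper l e) =
      linear 7 (λ a k n β q c x → a :≡ 5 :* k :+ con 1 ⇒ k :≡ con 1 :+ n ⇒ q :≤ n ⇒ c :< con 10 ⇒ x :+ (5 :* q :+ c) :≡ β :+ 2 :* a :+ con 4 ⇒ ⊢ β :+ con 5 :≤ x)
              (a ∷ k ∷ n ∷ β ∷ q ∷ c ∷ x ∷ []) a≡ k≡ q≤ c< e ,
      linear 5 (λ a β q c x → con 1 :≤ q ⇒ con 5 :≤ c ⇒ x :+ (5 :* q :+ c) :≡ β :+ 2 :* a :+ con 4 ⇒ ⊢ x :+ con 6 :≤ β :+ 2 :* a)
              (a ∷ β ∷ q ∷ c ∷ x ∷ []) 1≤q l e ,
      inj₂ (linear 7 (λ a k n β q c x → a :≡ 5 :* k :+ con 1 ⇒ k :≡ con 1 :+ n ⇒ q :≤ n ⇒ c :< con 10 ⇒ x :+ (5 :* q :+ c) :≡ β :+ 2 :* a :+ con 4 ⇒ ⊢ β :+ a :< x)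
              (a ∷ k ∷ n ∷ β ∷ q ∷ c ∷ x ∷ []) a≡ k≡ q≤ c< e)

    module Tree (choice : Vec (Fin 10) n) where

      cell : Fin n → ℕ
      cell j = suc (toℕ j)

      cell≤n : ∀ j → cell j ≤ n
      cell≤n = Fin.toℕ<n

      pick : Fin n → ℕ
      pick j = toℕ (lookup choice j)

      pick< : ∀ j → pick j < 10
      pick< j = Fin.toℕ<n (lookup choice j)

      private
        hole-at : ∀ j → ∃ (At (cell j) (pick j))
        hole-at j = at (cell j) (pick j) (cell≤n j) (pick< j)

      hole : Fin n → ℕ
      hole j = proj₁ (hole-at j)

      hole-spec : ∀ j → At (cell j) (pick j) (hole j)
      hole-spec j = proj₂ (hole-at j)

      Hole : ℕ → Set
      Hole x = ∃ λ j → x ≡ hole j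

      hole? : ∀ x → Dec (Hole x)
      hole? x = Fin.any? λ j → x ≟ hole j

      hole-range : ∀ {x} → Hole x → β + 5 ≤ x × x + 6 ≤ end × (x + 2 ≤ β + a ⊎ β + a < x)
      hole-range (j , refl) = at-range (s≤s z≤n) (cell≤n j) (pick< j) (hole-spec j)

      hole-unique : ∀ {q c x} → q ≤ n → c < 10 → At q c x → ((j , _) : Hole x) → q ≡ cell j × c ≡ pick j
      hole-unique q≤ c< p (j , refl) = at-determined q≤ (cell≤n j) c< (pick< j) p (hole-spec j)

      hole-injective : ∀ {i j} → hole i ≡ hole j → i ≡ j
      hole-injective {i} {j} e = Fin.toℕ-injective (suc-injective (proj₁
        (hole-unique (cell≤n i) (pick< i) (hole-spec i) (j , e))))

      Keep : ℕ → ℕ → Set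
      Keep u v = (v ≡ suc u × ¬ Hole u) ⊎ (∃ λ j → u ≡ β + 5 * cell j × u + v ≡ β + end)

      keep? : ∀ u v → Dec (Keep u v)
      keep? u v = (v ≟ suc u ×-dec ¬? (hole? u)) ⊎-dec Fin.any? λ j → u ≟ β + 5 * cell j ×-dec u + v ≟ β + end

      keepᵇ : Edge m → Bool
      keepᵇ (u , v) = ⌊ keep? (toℕ u) (toℕ v) ⌋

      tree : List (Edge m)
      tree = filterᵇ keepᵇ (inducedEdges G U)

      keep⇒edge : ∀ {u v} → Keep u v → Edge< u v
      keep⇒edge (inj₁ (e , _)) = rail e
      keep⇒edge (inj₂ (j , e , s)) = chord-edge base (<⇒≤ (subst (cell j <_) (sym k≡) (s≤s (cell≤n j)))) e s

      ∈-tree⁺ : ∀ {u v} → InU (toℕ u) → InU (toℕ v) → Keep (toℕ u) (toℕ v) → (u , v) ∈ tree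
      ∈-tree⁺ {u} {v} (p , q) (r , s) κ = ∈-filter⁺ _
        (∈-inducedEdges⁺ U (U-out u p q) (U-out v r s) (keep⇒edge κ)) (≡true⇒T (⌊⌋-true (keep? (toℕ u) (toℕ v)) κ))

      ∈-tree⁻ : ∀ {u v} → (u , v) ∈ tree → InU (toℕ u) × InU (toℕ v) × Keep (toℕ u) (toℕ v)
      ∈-tree⁻ {u} {v} i with ∈-filter⁻ _ {xs = inducedEdges G U} i
      ... | j , t = let (p , q , _) = ∈-inducedEdges⁻ U j in
        U-in u p , U-in v q , ⌊⌋-sound (keep? (toℕ u) (toℕ v)) (T⇒≡true t)

      tree-unique : Unique tree
      tree-unique = Unique.filter⁺ _ (inducedEdges-unique U)

      -- The tree has as many edges as the rail: chord q takes the place of the hole in cell q.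
      data TreeCode (u v : ℕ) : ℕ → Set where
        kept  : v ≡ suc u → ¬ Hole u → TreeCode u v u
        chord : ∀ j → u ≡ β + 5 * cell j → u + v ≡ β + end → TreeCode u v (hole j)

      code-injective : ∀ {u v u′ v′ c} → TreeCode u v c → TreeCode u′ v′ c → u ≡ u′ × v ≡ v′
      code-injective p q = go p q refl
        where
        go : ∀ {u v u′ v′ c c′} → TreeCode u v c → TreeCode u′ v′ c′ → c ≡ c′ → u ≡ u′ × v ≡ v′
        go (kept e _) (kept e′ _) refl = refl , trans e (sym e′)
        go (kept _ ¬h) (chord j _ _) eq = ⊥-elim (¬h (j , eq))
        go (chord j _ _) (kept _ ¬h) eq = ⊥-elim (¬h (j , sym eq))
        go {u} (chord i e s) (chord j e′ s′) eq with hole-injective eq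
        ... | refl with trans e (sym e′)
        ...   | refl = refl , +-cancelˡ-≡ u _ _ (trans s (sym s′))

      -- The shortest chord kept is chord `n`, which spans `2 * a ∸ 10 * n`, that is 12. This tells
      -- chords from rail edges.
      chord-span : ∀ {u v} j → u ≡ β + 5 * cell j → u + v ≡ β + end → u + 12 ≤ v
      chord-span {u} {v} j e s = linear 7 (λ a k n β q u v → a :≡ 5 :* k :+ con 1 ⇒ k :≡ con 1 :+ n ⇒ q :≤ n ⇒ u :≡ β :+ 5 :* q ⇒ u :+ v :≡ β :+ (β :+ 2 :* a) ⇒ ⊢ u :+ con 12 :≤ v)
        (a ∷ k ∷ n ∷ β ∷ cell j ∷ u ∷ v ∷ []) a≡ k≡ (cell≤n j) e s

      code-functional : ∀ {u v c c′} → TreeCode u v c → TreeCode u v c′ → c ≡ c′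
      code-functional (kept _ _) (kept _ _) = refl
      code-functional {u} (kept refl _) (chord j e s) = ⊥-elim (linear 1 (λ u → u :+ con 12 :≤ con 1 :+ u ⇒ ⊢ :⊥)
              (u ∷ []) (chord-span j e s))
      code-functional {u} (chord j e s) (kept refl _) = ⊥-elim (linear 1 (λ u → u :+ con 12 :≤ con 1 :+ u ⇒ ⊢ :⊥)
              (u ∷ []) (chord-span j e s))
      code-functional (chord i e s) (chord j e′ s′) =
        cong hole (Fin.toℕ-injective (suc-injective (*-cancelˡ-≡ (cell i) (cell j) 5 (+-cancelˡ-≡ β _ _ (trans (sym e) e′)))))

      d : ℕ
      d = 2 * a ∸ 2 * lo

      d+ : d + 2 * lo ≡ 2 * a
      d+ = m∸n+n≡m (*-monoʳ-≤ 2 (≤-trans lo≤1 1≤a))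

      rails : List ℕ
      rails = interval (β + lo) d

      in-rails : ∀ {x} → β + lo ≤ x → x + lo < end → x ∈ rails
      in-rails {x} l h = ∈-interval⁺ (β + lo) d l
        (linear 5 (λ a β lo d x → d :+ 2 :* lo :≡ 2 :* a ⇒ x :+ lo :< β :+ 2 :* a ⇒ ⊢ x :< β :+ lo :+ d)
                (a ∷ β ∷ lo ∷ d ∷ x ∷ []) d+ h)

      in-rails⁻ : ∀ {x} → x ∈ rails → InU x × InU (suc x)
      in-rails⁻ {x} i with ∈-interval⁻ (β + lo) d i
      ... | l , h = (l , <⇒≤ x<) , ≤-trans l (n≤1+n x) , x<
        where
        x< : x + lo < end
        x< = linear 5 (λ a β lo d x → d :+ 2 :* lo :≡ 2 :* a ⇒ x :< β :+ lo :+ d ⇒ ⊢ x :+ lo :< β :+ 2 :* a)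
                (a ∷ β ∷ lo ∷ d ∷ x ∷ []) d+ h

      hole-in-rails : ∀ j → hole j ∈ rails
      hole-in-rails j = let (l , h , _) = hole-range (j , refl) in in-rails
        (linear 3 (λ β lo x → lo :≤ con 1 ⇒ β :+ con 5 :≤ x ⇒ ⊢ β :+ lo :≤ x) (β ∷ lo ∷ hole j ∷ []) lo≤1 l)
        (linear 4 (λ a β lo x → lo :≤ con 1 ⇒ x :+ con 6 :≤ β :+ 2 :* a ⇒ ⊢ x :+ lo :< β :+ 2 :* a)
                (a ∷ β ∷ lo ∷ hole j ∷ []) lo≤1 h)

      keep⇒code : ∀ {u v} → InU u → InU v → Keep u v → ∃ λ c → c ∈ rails × TreeCode u v c
      keep⇒code {u} {v} (l , _) (_ , h) (inj₁ (e , ¬h)) = u , in-rails l (subst (λ w → w + lo ≤ end) e h) , kept e ¬h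
      keep⇒code _ _ (inj₂ (j , e , s)) = hole j , hole-in-rails j , chord j e s

      encode : ∀ {u v} → (u , v) ∈ tree → ∃ λ c → c ∈ rails × TreeCode (toℕ u) (toℕ v) c
      encode i = let (p , q , κ) = ∈-tree⁻ i in keep⇒code p q κ

      edge-between : ∀ {x y} → InU x → InU y → Keep x y → ∃ λ e → e ∈ tree × toℕ (proj₁ e) ≡ x × toℕ (proj₂ e) ≡ y
      edge-between {x} {y} p q κ = (u , v) ,
        ∈-tree⁺ (subst InU (sym u≡) p) (subst InU (sym v≡) q) (subst₂ Keep (sym u≡) (sym v≡) κ) , u≡ , v≡
        where
        u = vertex (InU⇒< p)
        v = vertex (InU⇒< q)
        u≡ = toℕ-vertex (InU⇒< p)
        v≡ = toℕ-vertex (InU⇒< q)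

      chord-top : ℕ → ℕ
      chord-top q = end ∸ 5 * q

      chord-top+ : ∀ {q} → q ≤ k → chord-top q + 5 * q ≡ end
      chord-top+ {q} q≤ = m∸n+n≡m (linear 4 (λ a k q β → a :≡ 5 :* k :+ con 1 ⇒ q :≤ k ⇒ ⊢ 5 :* q :≤ β :+ 2 :* a)
              (a ∷ k ∷ q ∷ β ∷ []) a≡ q≤)

      cell≤k : ∀ j → cell j ≤ k
      cell≤k j = subst (cell j ≤_) (sym k≡) (≤-trans (cell≤n j) (n≤1+n n))

      chord-sum : ∀ j → β + 5 * cell j + chord-top (cell j) ≡ β + end
      chord-sum j = linear 4 (λ β q h e → h :+ 5 :* q :≡ e ⇒ ⊢ β :+ 5 :* q :+ h :≡ β :+ e)
        (β ∷ cell j ∷ chord-top (cell j) ∷ end ∷ []) (chord-top+ (cell≤k j))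

      chord-keep : ∀ j → Keep (β + 5 * cell j) (chord-top (cell j))
      chord-keep j = inj₂ (j , refl , chord-sum j)

      chord-InU : ∀ {q} → 1 ≤ q → q ≤ k → InU (β + 5 * q) × InU (chord-top q)
      chord-InU {q} 1≤q q≤ =
        ( linear 3 (λ β lo q → lo :≤ con 1 ⇒ con 1 :≤ q ⇒ ⊢ β :+ lo :≤ β :+ 5 :* q) (β ∷ lo ∷ q ∷ []) lo≤1 1≤q
        , linear 5 (λ a k β lo q → a :≡ 5 :* k :+ con 1 ⇒ lo :≤ con 1 ⇒ q :≤ k ⇒ ⊢ β :+ 5 :* q :+ lo :≤ β :+ 2 :* a)
                (a ∷ k ∷ β ∷ lo ∷ q ∷ []) a≡ lo≤1 q≤) ,
        ( linear 6 (λ a k β lo q h → a :≡ 5 :* k :+ con 1 ⇒ lo :≤ con 1 ⇒ q :≤ k ⇒ h :+ 5 :* q :≡ β :+ 2 :* a ⇒ ⊢ β :+ lo :≤ h)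
                (a ∷ k ∷ β ∷ lo ∷ q ∷ chord-top q ∷ []) a≡ lo≤1 q≤ (chord-top+ q≤)
        , linear 5 (λ a β lo q h → lo :≤ con 1 ⇒ con 1 :≤ q ⇒ h :+ 5 :* q :≡ β :+ 2 :* a ⇒ ⊢ h :+ lo :≤ β :+ 2 :* a)
                (a ∷ β ∷ lo ∷ q ∷ chord-top q ∷ []) lo≤1 1≤q (chord-top+ q≤))

      decode : ∀ {c} → c ∈ rails → Dec (Hole c) → ∃ λ e → e ∈ tree × TreeCode (toℕ (proj₁ e)) (toℕ (proj₂ e)) c
      decode {c} i (no ¬h) =
        let (p , q) = in-rails⁻ i ; (e , e∈ , u≡ , v≡) = edge-between p q (inj₁ (refl , ¬h)) in
        e , e∈ , subst₂ (λ x y → TreeCode x y c) (sym u≡) (sym v≡) (kept refl ¬h)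
      decode i (yes (j , refl)) =
        let (p , q) = chord-InU (s≤s z≤n) (cell≤k j) ; (e , e∈ , u≡ , v≡) = edge-between p q (chord-keep j) in
        e , e∈ , chord j u≡ (trans (cong₂ _+_ u≡ v≡) (chord-sum j))

      -- The test for spanning trees compares the number of edges exactly, so the coding is used in
      -- both directions.
      tree-length : length tree ≡ d
      tree-length = trans (≤-antisym
        (injection-length (λ e c → TreeCode (toℕ (proj₁ e)) (toℕ (proj₂ e)) c) _≢_
          (λ { {u , v} {u′ , v′} p q ne → let (r , s) = code-injective p q in
               ne (cong₂ _,_ (Fin.toℕ-injective r) (Fin.toℕ-injective s)) }) tree rails tree-unique encode)
        (injection-length (λ c e → TreeCode (toℕ (proj₁ e)) (toℕ (proj₂ e)) c) _≢_
          (λ p q ne → ne (code-functional p q)) rails tree (interval-unique (β + lo) d) λ {c} i → decode i (hole? c)))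
        (length-interval (β + lo) d)

      K : ℕ → ℕ → Set
      K x y = InU x × InU y × (Keep x y ⊎ Keep y x)

      K-flip : ∀ {x y} → K x y → K y x
      K-flip (p , q , e) = q , p , swap e

      InU-convex : ∀ {s t x} → InU s → InU t → s ≤ x → x ≤ t → InU x
      InU-convex (l , _) (_ , h) s≤x x≤t = ≤-trans l s≤x , ≤-trans (+-monoˡ-≤ lo x≤t) h

      module _ {s t : ℕ} (s∈ : InU s) (t∈ : InU t) (s≤t : s ≤ t) (free : ∀ {i} → s ≤ i → i < t → ¬ Hole i) where

        private
          link : ∀ {i} → s ≤ i → i < t → K i (suc i)
          link l h = InU-convex s∈ t∈ l (<⇒≤ h) , InU-convex s∈ t∈ (≤-trans l (n≤1+n _)) h , inj₁ (inj₁ (refl , free l h))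

        run-up : Star K s t
        run-up = ascend s≤t link

        run-down : Star K t s
        run-down = descend s≤t λ l h → K-flip (link l h)

      low high : ℕ → ℕ
      low q  = β + 5 * q
      high q = chord-top q

      Covered : ℕ → Set
      Covered q = ∀ {x} → low q ≤ x → x ≤ high q → Star K x (β + a)

      low≤a : ∀ {q} → q ≤ k → low q < β + a
      low≤a {q} q≤ = linear 4 (λ a k β q → a :≡ 5 :* k :+ con 1 ⇒ q :≤ k ⇒ ⊢ β :+ 5 :* q :< β :+ a) (a ∷ k ∷ β ∷ q ∷ []) a≡ q≤

      a≤high : ∀ {q} → q ≤ k → β + a < high q
      a≤high {q} q≤ = linear 5 (λ a k β q h → a :≡ 5 :* k :+ con 1 ⇒ q :≤ k ⇒ h :+ 5 :* q :≡ β :+ 2 :* a ⇒ ⊢ β :+ a :< h)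
        (a ∷ k ∷ β ∷ q ∷ high q ∷ []) a≡ q≤ (chord-top+ q≤)

      module _ {q : ℕ} (1≤q : 1 ≤ q) (q≤k : q ≤ k) where

        low∈ : InU (low q)
        low∈ = proj₁ (chord-InU 1≤q q≤k)

        high∈ : InU (high q)
        high∈ = proj₂ (chord-InU 1≤q q≤k)

        middle∈ : InU (β + a)
        middle∈ = InU-convex low∈ high∈ (<⇒≤ (low≤a q≤k)) (<⇒≤ (a≤high q≤k))

      k≥1 : 1 ≤ k
      k≥1 = subst (1 ≤_) (sym k≡) (s≤s z≤n)

      no-hole-at-cap : ∀ {i} → β + a ≤ suc i → i ≤ β + a → ¬ Hole i
      no-hole-at-cap {i} l h ho with hole-range ho
      ... | _ , _ , inj₁ e = linear 2 (λ b i → b :≤ con 1 :+ i ⇒ i :+ con 2 :≤ b ⇒ ⊢ :⊥) (β + a ∷ i ∷ []) l e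
      ... | _ , _ , inj₂ e = <⇒≱ e h

      -- Only `β + a` and its two rail neighbours lie between the ends of chord `k`, and the rail
      -- has no hole there.
      covered-cap : Covered k
      covered-cap {x} l h = [ left , right ]′ (≤-total x (β + a))
        where
        x∈ = InU-convex (low∈ k≥1 ≤-refl) (high∈ k≥1 ≤-refl) l h
        a≤ : β + a ≤ suc x
        a≤ = linear 4 (λ a k β x → a :≡ 5 :* k :+ con 1 ⇒ β :+ 5 :* k :≤ x ⇒ ⊢ β :+ a :≤ con 1 :+ x) (a ∷ k ∷ β ∷ x ∷ []) a≡ l
        x≤ : x ≤ suc (β + a)
        x≤ = linear 5 (λ a k β x h → a :≡ 5 :* k :+ con 1 ⇒ x :≤ h ⇒ h :+ 5 :* k :≡ β :+ 2 :* a ⇒ ⊢ x :≤ con 1 :+ (β :+ a))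
                (a ∷ k ∷ β ∷ x ∷ high k ∷ []) a≡ h (chord-top+ ≤-refl)
        left : x ≤ β + a → Star K x (β + a)
        left x≤a = run-up x∈ (middle∈ k≥1 ≤-refl) x≤a λ l′ h′ → no-hole-at-cap (≤-trans a≤ (s≤s l′)) (<⇒≤ h′)
        right : β + a ≤ x → Star K x (β + a)
        right a≤x = run-down (middle∈ k≥1 ≤-refl) x∈ a≤x λ l′ h′ → no-hole-at-cap (≤-trans l′ (n≤1+n _)) (≤-pred (≤-trans h′ x≤))

      module _ (j : Fin n) (IH : Covered (suc (cell j))) where

        private
          q = cell j
          q<k : suc q ≤ k
          q<k = subst (suc q ≤_) (sym k≡) (s≤s (cell≤n j))
          1≤q : 1 ≤ q
          1≤q = s≤s z≤n
          L∈ = low∈ 1≤q (<⇒≤ q<k)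
          H∈ = high∈ 1≤q (<⇒≤ q<k)
          L′∈ = low∈ (≤-trans 1≤q (n≤1+n q)) q<k
          H′∈ = high∈ (≤-trans 1≤q (n≤1+n q)) q<k
          L = low q
          H = high q
          L′ = low (suc q)
          H′ = high (suc q)

          L+5 : L + 5 ≡ L′
          L+5 = linear 2 (λ β q → ⊢ β :+ 5 :* q :+ con 5 :≡ β :+ 5 :* (con 1 :+ q)) (β ∷ q ∷ [])
          H′+5 : H′ + 5 ≡ H
          H′+5 = linear 4 (λ q h h′ e → h :+ 5 :* q :≡ e ⇒ h′ :+ 5 :* (con 1 :+ q) :≡ e ⇒ ⊢ h′ :+ con 5 :≡ h)
            (q ∷ H ∷ H′ ∷ end ∷ []) (chord-top+ (<⇒≤ q<k)) (chord-top+ q<k)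
          L′<H′ : L′ < H′
          L′<H′ = <-trans (low≤a q<k) (a≤high q<k)

          only-hole : ∀ {i c} → c < 10 → At q c i → i ≢ hole j → ¬ Hole i
          only-hole c< p ne ho@(j′ , e) with Fin.toℕ-injective (suc-injective (proj₁ (hole-unique (cell≤n j) c< p ho)))
          ... | refl = ne e

          low-free : ∀ {i} → L ≤ i → i < L′ → i ≢ hole j → ¬ Hole i
          low-free {i} l h = only-hole (<-trans c<5 (s≤s (s≤s (s≤s (s≤s (s≤s (s≤s z≤n))))))) (lower c<5 (sym (m+[n∸m]≡n l)))
            where
            c<5 : i ∸ L < 5
            c<5 = +-cancelˡ-< L _ _ (subst₂ _<_ (sym (m+[n∸m]≡n l)) (sym L+5) h)

          high-free : ∀ {i} → H′ ≤ i → i < H → i ≢ hole j → ¬ Hole i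
          high-free {i} l h = only-hole
            (linear 4 (λ i h′ h c → c :+ i :≡ h :+ con 4 ⇒ h′ :≤ i ⇒ h′ :+ con 5 :≡ h ⇒ ⊢ c :< con 10)
                    (i ∷ H′ ∷ H ∷ H + 4 ∸ i ∷ []) c+ l H′+5)
            (upper (linear 3 (λ i h c → c :+ i :≡ h :+ con 4 ⇒ i :< h ⇒ ⊢ con 5 :≤ c) (i ∷ H ∷ H + 4 ∸ i ∷ []) c+ h)
              (linear 5 (λ i h c q e → c :+ i :≡ h :+ con 4 ⇒ h :+ 5 :* q :≡ e ⇒ ⊢ i :+ (5 :* q :+ c) :≡ e :+ con 4)
                      (i ∷ H ∷ H + 4 ∸ i ∷ q ∷ end ∷ []) c+ (chord-top+ (<⇒≤ q<k))))
            where
            c+ : (H + 4 ∸ i) + i ≡ H + 4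
            c+ = m∸n+n≡m (≤-trans (<⇒≤ h) (m≤m+n H 4))

          across : K L H
          across = L∈ , H∈ , inj₁ (chord-keep j)

          L≤L′ : L ≤ L′
          L≤L′ = subst (L ≤_) L+5 (m≤m+n L 5)
          H′≤H : H′ ≤ H
          H′≤H = subst (H′ ≤_) H′+5 (m≤m+n H′ 5)

          from-low : ∀ {x} → (∀ {i} → x ≤ i → i < L′ → i ≢ hole j) → L ≤ x → x ≤ L′ → Star K x (β + a)
          from-low ne l h = run-up (InU-convex L∈ L′∈ l h) L′∈ h (λ l′ h′ → low-free (≤-trans l l′) h′ (ne l′ h′)) ◅◅ IH ≤-refl (<⇒≤ L′<H′)

          from-high : ∀ {x} → (∀ {i} → H′ ≤ i → i < x → i ≢ hole j) → H′ ≤ x → x ≤ H → Star K x (β + a)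
          from-high ne l h = run-down H′∈ (InU-convex H′∈ H∈ l h) l (λ l′ h′ → high-free l′ (<-≤-trans h′ h) (ne l′ h′)) ◅◅ IH (<⇒≤ L′<H′) ≤-refl

          -- The hole divides one side of the cell. The inner piece runs on to the inner chord; the
          -- outer piece returns to `L`, crosses chord `q` and follows the opposite side, which is
          -- intact. `hole-high` is the mirror image.
          hole-low : hole j < L′ → L ≤ hole j → Covered q
          hole-low o<L′ L≤o {x} l h = [ lows , (λ g → [ IH g , (λ g′ → highs g′ h) ]′ (≤-total x H′)) ]′ (≤-total x L′)
            where
            highs : ∀ {x} → H′ ≤ x → x ≤ H → Star K x (β + a)
            highs = from-high λ H′≤i _ e → <⇒≱ (<-trans o<L′ L′<H′) (subst (H′ ≤_) e H′≤i)
            lows : x ≤ L′ → Star K x (β + a)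
            lows x≤L′ with ≤-<-connex x (hole j)
            ... | inj₂ o<x = from-low (λ x≤i _ e → <⇒≱ o<x (subst (x ≤_) e x≤i)) l x≤L′
            ... | inj₁ x≤o = run-down L∈ (InU-convex L∈ L′∈ l x≤L′) l (λ l′ h′ → low-free l′ (<-≤-trans h′ x≤L′) (<⇒≢ (<-≤-trans h′ x≤o)))
                             ◅◅ across ◅ highs H′≤H ≤-refl

          hole-high : H′ ≤ hole j → hole j < H → Covered q
          hole-high H′≤o o<H {x} l h = [ (λ g → lows l g) , (λ g → [ IH g , highs ]′ (≤-total x H′)) ]′ (≤-total x L′)
            where
            lows : ∀ {x} → L ≤ x → x ≤ L′ → Star K x (β + a)
            lows = from-low λ _ i<L′ e → <⇒≱ (<-≤-trans L′<H′ H′≤o) (<⇒≤ (subst (_< L′) e i<L′))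
            highs : H′ ≤ x → Star K x (β + a)
            highs g with ≤-<-connex x (hole j)
            ... | inj₁ x≤o = from-high (λ _ i<x → <⇒≢ (<-≤-trans i<x x≤o)) g h
            ... | inj₂ o<x = run-up (InU-convex H′∈ H∈ g h) H∈ h (λ l′ h′ → high-free (≤-trans g l′) h′ (λ e → <⇒≱ o<x (subst (x ≤_) e l′)))
                             ◅◅ K-flip across ◅ lows ≤-refl L≤L′

          place : At q (pick j) (hole j) → Covered q
          place (lower c<5 e) = hole-low (subst₂ _<_ (sym e) L+5 (+-monoʳ-< L c<5)) (subst (L ≤_) (sym e) (m≤m+n L _))
          place (upper 5≤c e) = hole-high
            (linear 6 (λ o q c h′ h e → o :+ (5 :* q :+ c) :≡ e :+ con 4 ⇒ c :< con 10 ⇒ h′ :+ con 5 :≡ h ⇒ h :+ 5 :* q :≡ e ⇒ ⊢ h′ :≤ o)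
              (hole j ∷ q ∷ pick j ∷ H′ ∷ H ∷ end ∷ []) e (pick< j) H′+5 (chord-top+ (<⇒≤ q<k)))
            (linear 5 (λ o q c h e → o :+ (5 :* q :+ c) :≡ e :+ con 4 ⇒ con 5 :≤ c ⇒ h :+ 5 :* q :≡ e ⇒ ⊢ o :< h)
              (hole j ∷ q ∷ pick j ∷ H ∷ end ∷ []) e 5≤c (chord-top+ (<⇒≤ q<k)))

        covered-step : Covered q
        covered-step = place (hole-spec j)

      -- The induction starts at the cap and proceeds outward; `e` counts the cells between chord
      -- `suc q` and chord `k`.
      covered : ∀ e q → suc q + e ≡ k → Covered (suc q)
      covered zero    q s = subst Covered (sym (trans (sym (+-identityʳ _)) s)) covered-cap
      covered (suc e) q s = subst (Covered ∘ suc) (Fin.toℕ-fromℕ< q<n)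
        (covered-step (fromℕ< q<n) (subst (Covered ∘ suc ∘ suc) (sym (Fin.toℕ-fromℕ< q<n)) (covered e (suc q) (trans (sym (+-suc (suc q) e)) s))))
        where
        q<n : q < n
        q<n = linear 4 (λ n k q e → k :≡ con 1 :+ n ⇒ con 1 :+ q :+ (con 1 :+ e) :≡ k ⇒ ⊢ q :< n) (n ∷ k ∷ q ∷ e ∷ []) k≡ s

      covered₁ : Covered 1
      covered₁ = covered n 0 (sym k≡)

      to-middle : ∀ {x} → InU x → Star K x (β + a)
      to-middle {x} x∈ = [ below , (λ g → [ covered₁ g , above ]′ (≤-total x (high 1))) ]′ (≤-total x (low 1))
        where
        below : x ≤ low 1 → Star K x (β + a)
        below h = run-up x∈ (low∈ ≤-refl k≥1) h (λ _ i< ho → <⇒≱ i< (proj₁ (hole-range ho)))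
          ◅◅ covered₁ ≤-refl (<⇒≤ (<-trans (low≤a k≥1) (a≤high k≥1)))
        above : high 1 ≤ x → Star K x (β + a)
        above g = run-down (high∈ ≤-refl k≥1) x∈ g
          (λ {i} l _ ho → linear 3 (λ i h e → h :+ con 5 :≡ e ⇒ h :≤ i ⇒ i :+ con 6 :≤ e ⇒ ⊢ :⊥)
                  (i ∷ high 1 ∷ end ∷ []) (chord-top+ k≥1) l (proj₁ (proj₂ (hole-range ho))))
          ◅◅ covered₁ (<⇒≤ (<-trans (low≤a k≥1) (a≤high k≥1))) ≤-refl

      tree-spans : isSpanningTreeᵇ U tree ≡ true
      tree-spans = ∧-true (subst₂ (λ x y → (x + 1 ≡ᵇ y) ≡ true) (sym tree-length) size (≡ᵇ-refl (d + 1)))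
        (star⇒connected (edgeRel tree) U K (λ (_ , q , _) → InU⇒< q) sound (edgeRel-flip tree) (InU⇒< (middle∈ ≤-refl k≥1))
          λ v Uv → to-middle (U-in v Uv))
        where
        size : d + 1 ≡ count U
        size = linear 4 (λ d lo a c → d :+ 2 :* lo :≡ 2 :* a ⇒ c :+ 2 :* lo :≡ 2 :* a :+ con 1 ⇒ ⊢ d :+ con 1 :≡ c)
                (d ∷ lo ∷ a ∷ count U ∷ []) d+ U-count
        sound : ∀ u v → K (toℕ u) (toℕ v) → Link (edgeRel tree) U u v
        sound u v ((p , p′) , (q , q′) , e) = U-out u p p′ , U-out v q q′ ,
          [ (λ κ → edgeRel-∈ (∈-tree⁺ (p , p′) (q , q′) κ))
          , (λ κ → edgeRel-flip tree v u (edgeRel-∈ (∈-tree⁺ (q , q′) (p , p′) κ))) ]′ e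

    -- A hole of `v` is a rail edge absent from its tree, hence absent from the equal tree of `w`,
    -- where it must be a hole too. The place of a hole determines its cell and the choice made
    -- there.
    hole-subset : ∀ v w → Tree.tree v ≡ Tree.tree w → ∀ j → lookup v j ≡ lookup w j
    hole-subset v w e j = finish (decidable-stable (Tree.hole? w x) stays)
      where
      x = Tree.hole v j
      x∈ = Tree.in-rails⁻ v (Tree.hole-in-rails v j)
      stays : ¬ ¬ Tree.Hole w x
      stays ¬h = let (edge , e∈ , u≡ , v≡) = Tree.edge-between w (proj₁ x∈) (proj₂ x∈) (inj₁ (refl , ¬h)) in
        not-kept u≡ v≡ (proj₂ (proj₂ (Tree.∈-tree⁻ v (subst (edge ∈_) (sym e) e∈))))
        where
        not-kept : ∀ {a b} → a ≡ x → b ≡ suc x → Tree.Keep v a b → ⊥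
        not-kept refl refl (inj₁ (_ , ¬h)) = ¬h (j , refl)
        not-kept refl refl (inj₂ (i , e , s)) = linear 1 (λ u → u :+ con 12 :≤ con 1 :+ u ⇒ ⊢ :⊥)
                (x ∷ []) (Tree.chord-span v i e s)
      finish : Tree.Hole w x → lookup v j ≡ lookup w j
      finish (i , x≡) = same (Tree.hole-unique w (Tree.cell≤n v j) (Tree.pick< v j) (Tree.hole-spec v j) (i , x≡))
        where
        same : suc (toℕ j) ≡ suc (toℕ i) × toℕ (lookup v j) ≡ toℕ (lookup w i) → lookup v j ≡ lookup w j
        same (p , q) = trans (Fin.toℕ-injective q) (cong (lookup w) (sym (Fin.toℕ-injective (suc-injective p))))

    tree-injective : ∀ {v w} → Tree.tree v ≡ Tree.tree w → v ≡ w
    tree-injective {v} {w} e = trans (sym (tabulate∘lookup v)) (trans (tabulate-cong (hole-subset v w e)) (tabulate∘lookup w))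

    τ-lobe : 10 ^ n ≤ τ G U
    τ-lobe = subst (_≤ τ G U) (length-allVecs 10 n)
      (injection-length (λ v S → S ≡ Tree.tree v) _≢_ (λ p q ne → ne (tree-injective (trans (sym p) q)))
        (allVecs 10 n) _ (allVecs-unique 10 n)
        λ {v} _ → Tree.tree v , ∈-filter⁺ _ (filter∈sublists (Tree.keepᵇ v) (inducedEdges G U)) (≡true⇒T (Tree.tree-spans v)) , refl)

-- The near-balanced partition of large weight

module Heavy (n k a : ℕ) (k≡ : k ≡ suc n) (a≡ : a ≡ 5 * k + 1) (m : ℕ) (m≡ : m ≡ 6 * a) where

  open Edges k a a≡
  open Balance k a a≡ m m≡
  open Upper k a a≡ m m≡
  open Paths k a a≡ m m≡
  open Trees n k a k≡ a≡ m m≡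

  -- One lobe without its outermost chord (2a - 1 vertices), the other lobe (2a + 1 vertices), and the rest.
  nearColour : ℕ → Fin 3
  nearColour i = if ⌊ i ≟ 0 ⌋ then i1 else if ⌊ i <? 2 * a ⌋ then i0 else if ⌊ i <? 3 * a ⌋ then i1
    else if ⌊ i <? 5 * a + 1 ⌋ then i2 else i1

  module _ {i : ℕ} where

    near-left : 1 ≤ i → i < 2 * a → nearColour i ≡ i0
    near-left l h with i ≟ 0 | i <? 2 * a
    ... | yes z | _     = ⊥-elim (<⇒≢ l (sym z))
    ... | no _  | yes _ = refl
    ... | no _  | no g  = ⊥-elim (g h)

    near-low : 2 * a ≤ i → i < 3 * a → nearColour i ≡ i1
    near-low l h with i ≟ 0 | i <? 2 * a | i <? 3 * a
    ... | yes z | _     | _     = refl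
    ... | no _  | yes g | _     = ⊥-elim (<⇒≱ g l)
    ... | no _  | no _  | yes _ = refl
    ... | no _  | no _  | no g  = ⊥-elim (g h)

    near-right : 3 * a ≤ i → i < 5 * a + 1 → nearColour i ≡ i2
    near-right l h with i ≟ 0 | i <? 2 * a | i <? 3 * a | i <? 5 * a + 1
    ... | yes z | _     | _     | _     = ⊥-elim (<⇒≱ (≤-trans 1≤a (m≤m+n a _)) (subst (3 * a ≤_) z l))
    ... | no _  | yes g | _     | _     = ⊥-elim (<⇒≱ (<-trans g 2a<3a) l)
    ... | no _  | no _  | yes g | _     = ⊥-elim (<⇒≱ g l)
    ... | no _  | no _  | no _  | yes _ = refl
    ... | no _  | no _  | no _  | no g  = ⊥-elim (g h)

    near-high : 5 * a + 1 ≤ i → nearColour i ≡ i1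
    near-high l with i ≟ 0 | i <? 2 * a | i <? 3 * a | i <? 5 * a + 1
    ... | yes z | _     | _     | _     = refl
    ... | no _  | yes g | _     | _     = ⊥-elim (<⇒≱ (<-trans (<-trans g (<-trans 2a<3a 3a<5a)) (m<m+n (5 * a) (s≤s z≤n))) l)
    ... | no _  | no _  | yes g | _     = refl
    ... | no _  | no _  | no _  | yes g = ⊥-elim (<⇒≱ g l)
    ... | no _  | no _  | no _  | no _  = refl

  data Zone (i : ℕ) : Fin 3 → Set where
    base-left  : i ≡ 0 → Zone i i1
    lobe-left  : 1 ≤ i → i < 2 * a → Zone i i0
    path-low   : 2 * a ≤ i → i < 3 * a → Zone i i1
    lobe-right : 3 * a ≤ i → i < 5 * a + 1 → Zone i i2
    path-high  : 5 * a + 1 ≤ i → Zone i i1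

  zone : ∀ i → Zone i (nearColour i)
  zone i = [ from-2a , below-2a (i ≟ 0) ]′ (≤-<-connex (2 * a) i)
    where
    below-2a : Dec (i ≡ 0) → i < 2 * a → Zone i (nearColour i)
    below-2a (yes z) _ = subst (λ j → Zone j (nearColour j)) (sym z) (base-left refl)
    below-2a (no z)  l = subst (Zone i) (sym (near-left (n≢0⇒n>0 z) l)) (lobe-left (n≢0⇒n>0 z) l)
    from-3a : 3 * a ≤ i → Zone i (nearColour i)
    from-3a g = [ (λ g′ → subst (Zone i) (sym (near-high g′)) (path-high g′))
                , (λ l → subst (Zone i) (sym (near-right g l)) (lobe-right g l)) ]′ (≤-<-connex (5 * a + 1) i)
    from-2a : 2 * a ≤ i → Zone i (nearColour i)
    from-2a g = [ from-3a , (λ l → subst (Zone i) (sym (near-low g l)) (path-low g l)) ]′ (≤-<-connex (3 * a) i)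

  zone-of : ∀ {i x} → nearColour i ≡ x → Zone i x
  zone-of {i} e = subst (Zone i) e (zone i)

  near-left⁻ : ∀ {i} → nearColour i ≡ i0 → 1 ≤ i × i < 2 * a
  near-left⁻ e with zone-of e
  ... | lobe-left l h = l , h

  near-right⁻ : ∀ {i} → nearColour i ≡ i2 → 3 * a ≤ i × i < 5 * a + 1
  near-right⁻ e with zone-of e
  ... | lobe-right l h = l , h

  data Rest (i : ℕ) : Set where
    root : i ≡ 0 → Rest i
    low  : 2 * a ≤ i → i < 3 * a → Rest i
    high : 5 * a + 1 ≤ i → Rest i

  rest⁻ : ∀ {i} → nearColour i ≡ i1 → Rest i
  rest⁻ e with zone-of e
  ... | base-left z  = root z
  ... | path-low l h = low l h
  ... | path-high l  = high l

  2≤a : 2 ≤ a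
  2≤a = linear 3 (λ a k n → a :≡ 5 :* k :+ con 1 ⇒ k :≡ con 1 :+ n ⇒ ⊢ con 2 :≤ a) (a ∷ k ∷ n ∷ []) a≡ k≡

  5a+1<6a : 5 * a + 1 < 6 * a
  5a+1<6a = linear 1 (λ a → con 2 :≤ a ⇒ ⊢ 5 :* a :+ con 1 :< 6 :* a) (a ∷ []) 2≤a

  5a+1≤top : 5 * a + 1 ≤ top
  5a+1≤top = ≤-pred (subst (5 * a + 1 <_) (sym suc-top) 5a+1<6a)

  full∈sublists : ∀ {A : Set} (xs : List A) → xs ∈ sublists xs
  full∈sublists []       = here refl
  full∈sublists (x ∷ xs) = ∈-++⁺ʳ (sublists xs) (∈-map⁺ (x ∷_) (full∈sublists xs))

  module _ (f : Labeling m) (f≗ : ∀ v → f v ≡ nearColour (toℕ v)) where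

    count-left : count (part f i0) ≡ 2 * a ∸ 1
    count-left = interval-count f nearColour f≗ i0 1 (2 * a ∸ 1) (≤-trans (≤-reflexive 1+) 2a≤6a)
      (λ {i} l h → near-left l (subst (i <_) 1+ h)) λ {i} _ e → let (l , h) = near-left⁻ e in l , subst (i <_) (sym 1+) h
      where
      1+ : 1 + (2 * a ∸ 1) ≡ 2 * a
      1+ = m+[n∸m]≡n {1} (≤-trans 1≤a (m≤m+n a _))

    5a+1 : 3 * a + (2 * a + 1) ≡ 5 * a + 1
    5a+1 = linear 1 (λ a → ⊢ 3 :* a :+ (2 :* a :+ con 1) :≡ 5 :* a :+ con 1) (a ∷ [])

    count-right : count (part f i2) ≡ 2 * a + 1
    count-right = interval-count f nearColour f≗ i2 (3 * a) (2 * a + 1) (<⇒≤ (subst (_< 6 * a) (sym 5a+1) 5a+1<6a))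
      (λ {i} l h → near-right l (subst (i <_) 5a+1 h)) λ {i} _ e → let (l , h) = near-right⁻ e in l , subst (i <_) (sym 5a+1) h

    count-rest : count (part f i1) ≡ 2 * a
    count-rest = linear 5 (λ a c₀ c₁ c₂ d → c₀ :+ c₁ :+ c₂ :≡ 6 :* a ⇒ c₀ :≡ d ⇒ con 1 :+ d :≡ 2 :* a ⇒ c₂ :≡ 2 :* a :+ con 1 ⇒ ⊢ c₁ :≡ 2 :* a)
      (a ∷ count (part f i0) ∷ count (part f i1) ∷ count (part f i2) ∷ 2 * a ∸ 1 ∷ [])
      (trans (count-parts f) m≡) count-left (m+[n∸m]≡n {1} (≤-trans 1≤a (m≤m+n a _))) count-right

    connected-left : inducedConnectedᵇ G (part f i0) ≡ true
    connected-left = interval-connected f nearColour f≗ i0 1 (2 * a ∸ 2) (subst (_< 6 * a) (sym 2a≡) (≤-<-trans (m∸n≤m (2 * a) 1) 2a<6a))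
      (λ {i} l h → near-left l (≤-<-trans (subst (i ≤_) 2a≡ h) (≤-reflexive 1+)))
      λ {i} _ e → let (l , h) = near-left⁻ e in l , subst (i ≤_) (sym 2a≡) (≤-pred (subst (suc i ≤_) (sym 1+) h))
      where
      1+ : 1 + (2 * a ∸ 1) ≡ 2 * a
      1+ = m+[n∸m]≡n {1} (≤-trans 1≤a (m≤m+n a _))
      2a≡ : 1 + (2 * a ∸ 2) ≡ 2 * a ∸ 1
      2a≡ = suc-injective (trans (m+[n∸m]≡n {2} (≤-trans 2≤a (m≤m+n a _))) (sym 1+))

    connected-right : inducedConnectedᵇ G (part f i2) ≡ true
    connected-right = interval-connected f nearColour f≗ i2 (3 * a) (2 * a) (subst (_< 6 * a) 5a≡ 5a<6a)
      (λ {i} l h → near-right l (subst (i <_) (+-comm 1 (5 * a)) (s≤s (subst (i ≤_) (sym 5a≡) h))))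
      λ {i} _ e → let (l , h) = near-right⁻ e in l , subst (i ≤_) 5a≡ (≤-pred (subst (i <_) (+-comm (5 * a) 1) h))

    private
      Walk = Inside f nearColour f≗ i1

    -- The rest falls into the interval from `2 * a` below `3 * a` and the vertices from `5 * a + 1`
    -- around to 0. Chord 0, whose ends the open lobe gives up, joins the two.
    chord-edge₀ : Edge< 0 (2 * a)
    chord-edge₀ = chordL 0 z≤n refl refl

    to-root : ∀ {i} → i < 6 * a → nearColour i ≡ i1 → Star Walk i 0
    to-root {i} i< e = by-zone (rest⁻ e)
      where
      by-zone : Rest i → Star Walk i 0
      by-zone (root refl) = ε
      by-zone (low l h) =
        descend l (λ {j} l′ h′ → inside (≤-<-trans h′ i<) (<-trans h′ i<) (near-low (≤-trans l′ (n≤1+n j)) (≤-<-trans h′ h))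
          (near-low l′ (<-trans h′ h)) (inj₂ (rail refl)))
        ◅◅ inside 2a<6a 0<6a (near-low ≤-refl 2a<3a) refl (inj₂ chord-edge₀) ◅ ε
      by-zone (high l) =
        ascend (≤-pred (subst (suc i ≤_) (sym suc-top) i<)) (λ {j} l′ h′ → inside (<-trans h′ top<) (≤-<-trans h′ top<)
          (near-high (≤-trans l l′)) (near-high (≤-trans l (≤-trans l′ (n≤1+n j)))) (inj₁ (rail refl)))
        ◅◅ inside top< 0<6a (near-high 5a+1≤top) refl (inj₂ (wrap refl suc-top)) ◅ ε

    connected-rest : inducedConnectedᵇ G (part f i1) ≡ true
    connected-rest = part-connected f nearColour f≗ i1 0<6a to-root

    near-valid : validᵇ G (2 * a ∸ 1) (2 * a) (2 * a + 1) f ≡ true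
    near-valid = parts⇒valid G f _ _ _ (∸-monoˡ-≤ 1 (≤-trans 2≤a (m≤m+n a _))) (≤-trans 1≤a (m≤m+n a _)) (m≤n+m 1 (2 * a))
      (count-left , connected-left) (count-rest , connected-rest) (count-right , connected-right)

    private
      E = inducedEdges G (part f i1)

    -- The rest is a path; its edges correspond to its vertices other than 0.
    data PathCode (u v : ℕ) : ℕ → Set where
      p-low   : v ≡ suc u → 2 * a ≤ u → v < 3 * a → PathCode u v v
      p-high  : v ≡ suc u → 5 * a + 1 ≤ u → v < 6 * a → PathCode u v u
      p-wrap  : u ≡ 0 → suc v ≡ 6 * a → PathCode u v v
      p-chord : u ≡ 0 → v ≡ 2 * a → PathCode u v v

    pathCodes : List ℕ
    pathCodes = interval (2 * a) a ++ interval (5 * a + 1) (a ∸ 1)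

    a-1+ : 1 + (a ∸ 1) ≡ a
    a-1+ = m+[n∸m]≡n {1} 1≤a

    pathCodes-length : length pathCodes + 1 ≡ 2 * a
    pathCodes-length rewrite length-++ (interval (2 * a) a) {interval (5 * a + 1) (a ∸ 1)} | length-interval (2 * a) a | length-interval (5 * a + 1) (a ∸ 1) =
      linear 2 (λ a b → con 1 :+ b :≡ a ⇒ ⊢ a :+ b :+ con 1 :≡ 2 :* a) (a ∷ a ∸ 1 ∷ []) a-1+

    ∈-low : ∀ {c} → 2 * a ≤ c → c < 3 * a → c ∈ pathCodes
    ∈-low {c} l h = ∈-++⁺ˡ (∈-interval⁺ (2 * a) a l (subst (c <_) (+-comm a (2 * a)) h))

    ∈-high : ∀ {c} → 5 * a + 1 ≤ c → c < 6 * a → c ∈ pathCodes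
    ∈-high {c} l h = ∈-++⁺ʳ (interval (2 * a) a) (∈-interval⁺ (5 * a + 1) (a ∸ 1) l
      (linear 3 (λ a b c → con 1 :+ b :≡ a ⇒ c :< 6 :* a ⇒ ⊢ c :< 5 :* a :+ con 1 :+ b) (a ∷ a ∸ 1 ∷ c ∷ []) a-1+ h))

    pathCodes⁻ : ∀ {c} → c ∈ pathCodes → (2 * a ≤ c × c < 3 * a) ⊎ (5 * a + 1 ≤ c × c < 6 * a)
    pathCodes⁻ {c} i with ∈-++⁻ (interval (2 * a) a) i
    ... | inj₁ j = let (l , h) = ∈-interval⁻ (2 * a) a j in inj₁ (l , subst (c <_) (+-comm (2 * a) a) h)
    ... | inj₂ j = let (l , h) = ∈-interval⁻ (5 * a + 1) (a ∸ 1) j in inj₂ (l ,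
      linear 3 (λ a b c → con 1 :+ b :≡ a ⇒ c :< 5 :* a :+ con 1 :+ b ⇒ ⊢ c :< 6 :* a) (a ∷ a ∸ 1 ∷ c ∷ []) a-1+ h)

    pathCodes-unique : Unique pathCodes
    pathCodes-unique = Unique.++⁺ (interval-unique (2 * a) a) (interval-unique (5 * a + 1) (a ∸ 1)) λ {x} (i , j) →
      linear 2 (λ a c → c :< 2 :* a :+ a ⇒ 5 :* a :+ con 1 :≤ c ⇒ ⊢ :⊥) (a ∷ x ∷ [])
        (proj₂ (∈-interval⁻ (2 * a) a i)) (proj₁ (∈-interval⁻ (5 * a + 1) (a ∸ 1) j))

    pathCode-injective : ∀ {u v u′ v′ c c′} → PathCode u v c → PathCode u′ v′ c′ → c ≡ c′ → u ≡ u′ × v ≡ v′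
    pathCode-injective (p-low refl _ _) (p-low refl _ _) refl = refl , refl
    pathCode-injective {v = v} (p-low _ _ h) (p-high _ l _) refl = ⊥-elim (linear 2 (λ a v → v :< 3 :* a ⇒ 5 :* a :+ con 1 :≤ v ⇒ ⊢ :⊥)
            (a ∷ v ∷ []) h l)
    pathCode-injective {v = v} (p-low _ _ h) (p-wrap _ e) refl = ⊥-elim (linear 2 (λ a v → con 2 :≤ a ⇒ v :< 3 :* a ⇒ con 1 :+ v :≡ 6 :* a ⇒ ⊢ :⊥)
            (a ∷ v ∷ []) 2≤a h e)
    pathCode-injective (p-low refl l _) (p-chord _ e) refl = ⊥-elim (<⇒≱ (s≤s l) (≤-reflexive e))
    pathCode-injective {v′ = v} (p-high _ l _) (p-low _ _ h) refl = ⊥-elim (linear 2 (λ a v → v :< 3 :* a ⇒ 5 :* a :+ con 1 :≤ v ⇒ ⊢ :⊥)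
            (a ∷ v ∷ []) h l)
    pathCode-injective (p-high refl _ _) (p-high refl _ _) refl = refl , refl
    pathCode-injective (p-high refl _ h) (p-wrap _ e) refl = ⊥-elim (<-irrefl e h)
    pathCode-injective {u} (p-high _ l _) (p-chord _ e) refl = ⊥-elim (linear 2 (λ a v → v :≡ 2 :* a ⇒ 5 :* a :+ con 1 :≤ v ⇒ ⊢ :⊥)
            (a ∷ u ∷ []) e l)
    pathCode-injective {v = v} (p-wrap _ e) (p-low _ _ h) refl = ⊥-elim (linear 2 (λ a v → con 2 :≤ a ⇒ v :< 3 :* a ⇒ con 1 :+ v :≡ 6 :* a ⇒ ⊢ :⊥)
            (a ∷ v ∷ []) 2≤a h e)
    pathCode-injective (p-wrap _ e) (p-high refl _ h) refl = ⊥-elim (<-irrefl e h)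
    pathCode-injective (p-wrap refl _) (p-wrap refl _) refl = refl , refl
    pathCode-injective (p-wrap refl _) (p-chord refl _) refl = refl , refl
    pathCode-injective (p-chord _ e) (p-low refl l _) refl = ⊥-elim (<⇒≱ (s≤s l) (≤-reflexive e))
    pathCode-injective {v = u} (p-chord _ e) (p-high _ l _) refl = ⊥-elim (linear 2 (λ a v → v :≡ 2 :* a ⇒ 5 :* a :+ con 1 :≤ v ⇒ ⊢ :⊥)
            (a ∷ u ∷ []) e l)
    pathCode-injective (p-chord refl _) (p-wrap refl _) refl = refl , refl
    pathCode-injective (p-chord refl _) (p-chord refl _) refl = refl , refl

    pathCode-functional : ∀ {u v c c′} → PathCode u v c → PathCode u v c′ → c ≡ c′
    pathCode-functional (p-high _ _ _) (p-high _ _ _) = refl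
    pathCode-functional {u} {v} (p-high e l _) (p-low _ _ h) = ⊥-elim (linear 3 (λ a u v → v :≡ con 1 :+ u ⇒ v :< 3 :* a ⇒ 5 :* a :+ con 1 :≤ u ⇒ ⊢ :⊥)
            (a ∷ u ∷ v ∷ []) e h l)
    pathCode-functional {u} {v} (p-low _ _ h) (p-high e l _) = ⊥-elim (linear 3 (λ a u v → v :≡ con 1 :+ u ⇒ v :< 3 :* a ⇒ 5 :* a :+ con 1 :≤ u ⇒ ⊢ :⊥)
            (a ∷ u ∷ v ∷ []) e h l)
    pathCode-functional (p-high _ l _) (p-wrap refl _) = ⊥-elim (n≮0 (subst (_≤ 0) (+-comm (5 * a) 1) l))
    pathCode-functional (p-high _ l _) (p-chord refl _) = ⊥-elim (n≮0 (subst (_≤ 0) (+-comm (5 * a) 1) l))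
    pathCode-functional (p-wrap refl _) (p-high _ l _) = ⊥-elim (n≮0 (subst (_≤ 0) (+-comm (5 * a) 1) l))
    pathCode-functional (p-chord refl _) (p-high _ l _) = ⊥-elim (n≮0 (subst (_≤ 0) (+-comm (5 * a) 1) l))
    pathCode-functional (p-low _ _ _) (p-low _ _ _) = refl
    pathCode-functional (p-low _ _ _) (p-wrap _ _) = refl
    pathCode-functional (p-low _ _ _) (p-chord _ _) = refl
    pathCode-functional (p-wrap _ _) (p-low _ _ _) = refl
    pathCode-functional (p-wrap _ _) (p-wrap _ _) = refl
    pathCode-functional (p-wrap _ _) (p-chord _ _) = refl
    pathCode-functional (p-chord _ _) (p-low _ _ _) = refl
    pathCode-functional (p-chord _ _) (p-wrap _ _) = refl
    pathCode-functional (p-chord _ _) (p-chord _ _) = refl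

    edge⇒pathCode : ∀ {u v} → v < 6 * a → nearColour u ≡ i1 → nearColour v ≡ i1 → Edge< u v → ∃ λ c → c ∈ pathCodes × PathCode u v c
    edge⇒pathCode {u} {v} v< Fu Fv (rail refl) = go (rest⁻ Fu) (rest⁻ Fv)
      where
      go : Rest u → Rest v → _
      go (low l h) (low l′ h′) = v , ∈-low l′ h′ , p-low refl l h′
      go (low l h) (high l′) = ⊥-elim (linear 2 (λ a u → con 1 :≤ a ⇒ u :< 3 :* a ⇒ 5 :* a :+ con 1 :≤ con 1 :+ u ⇒ ⊢ :⊥)
              (a ∷ u ∷ []) 1≤a h l′)
      go (high l) _ = u , ∈-high l (<-trans ≤-refl v<) , p-high refl l v<
      go (root refl) (low l h) = ⊥-elim (<⇒≱ (≤-trans 2≤a (m≤m+n a _)) l)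
      go (root refl) (high l) = ⊥-elim (linear 1 (λ a → con 1 :≤ a ⇒ 5 :* a :+ con 1 :≤ con 1 ⇒ ⊢ :⊥) (a ∷ []) 1≤a l)
    edge⇒pathCode {u} {v} v< Fu Fv (wrap e e′) =
      v , ∈-high (subst (5 * a + 1 ≤_) (suc-injective (trans suc-top (sym e′))) 5a+1≤top) v< , p-wrap e e′
    edge⇒pathCode {u} {v} v< Fu Fv (chordL q q≤k e e′) = go (rest⁻ Fu)
      where
      u<a : u < a
      u<a = linear 4 (λ a k q u → a :≡ 5 :* k :+ con 1 ⇒ q :≤ k ⇒ u :≡ 5 :* q ⇒ ⊢ u :< a) (a ∷ k ∷ q ∷ u ∷ []) a≡ q≤k e
      go : Rest u → _
      go (root refl) = v , ∈-low (≤-reflexive (sym e′)) (subst (_< 3 * a) (sym e′) 2a<3a) , p-chord refl e′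
      go (low l h) = ⊥-elim (<⇒≱ u<a (≤-trans (m≤m+n a _) l))
      go (high l) = ⊥-elim (linear 2 (λ a u → u :< a ⇒ 5 :* a :+ con 1 :≤ u ⇒ ⊢ :⊥) (a ∷ u ∷ []) u<a l)
    edge⇒pathCode {u} {v} v< Fu Fv (chordR q q≤k e e′) = go (rest⁻ Fu)
      where
      3a≤u : 3 * a ≤ u
      3a≤u = subst (3 * a ≤_) (sym e) (m≤m+n (3 * a) _)
      go : Rest u → _
      go (root refl) = ⊥-elim (<⇒≱ (≤-trans 1≤a (m≤m+n a _)) 3a≤u)
      go (low l h) = ⊥-elim (<⇒≱ h 3a≤u)
      go (high l) = ⊥-elim (linear 4 (λ a k q u → a :≡ 5 :* k :+ con 1 ⇒ q :≤ k ⇒ u :≡ 3 :* a :+ 5 :* q ⇒ 5 :* a :+ con 1 :≤ u ⇒ ⊢ :⊥)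
              (a ∷ k ∷ q ∷ u ∷ []) a≡ q≤k e l)

    edge-in : ∀ {x y} (x< : x < 6 * a) (y< : y < 6 * a) → nearColour x ≡ i1 → nearColour y ≡ i1 → Edge< x y →
              (vertex x< , vertex y<) ∈ E
    edge-in x< y< Fx Fy e = ∈-inducedEdges⁺ (part f i1)
      (in-part f nearColour f≗ (vertex x<) (trans (cong nearColour (toℕ-vertex x<)) Fx))
      (in-part f nearColour f≗ (vertex y<) (trans (cong nearColour (toℕ-vertex y<)) Fy))
      (subst₂ Edge< (sym (toℕ-vertex x<)) (sym (toℕ-vertex y<)) e)

    pathCode⇒edge : ∀ {c} → c ∈ pathCodes → ∃ λ e → e ∈ E × PathCode (toℕ (proj₁ e)) (toℕ (proj₂ e)) c
    pathCode⇒edge {c} i = [ lows , highs ]′ (pathCodes⁻ i)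
      where
      make : ∀ {x y} (x< : x < 6 * a) (y< : y < 6 * a) → nearColour x ≡ i1 → nearColour y ≡ i1 → Edge< x y → PathCode x y c →
             ∃ λ e → e ∈ E × PathCode (toℕ (proj₁ e)) (toℕ (proj₂ e)) c
      make x< y< Fx Fy e p = _ , edge-in x< y< Fx Fy e , subst₂ (λ x y → PathCode x y c) (sym (toℕ-vertex x<)) (sym (toℕ-vertex y<)) p
      below : ∀ {c′} → c′ ≡ c → 2 * a < c′ → c′ < 3 * a → ∃ λ e → e ∈ E × PathCode (toℕ (proj₁ e)) (toℕ (proj₂ e)) c
      below {suc b} refl (s≤s l) h = make (<-trans (<-trans ≤-refl h) 3a<6a) (<-trans h 3a<6a) (near-low l (<-trans ≤-refl h))
        (near-low (≤-trans l (n≤1+n b)) h) (rail refl) (p-low refl l h)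
      lows : 2 * a ≤ c × c < 3 * a → _
      lows (l , h) with m≤n⇒m<n∨m≡n l
      ... | inj₁ l′ = below refl l′ h
      ... | inj₂ e = make 0<6a (<-trans h 3a<6a) refl (near-low l h) (subst (Edge< 0) e chord-edge₀) (p-chord refl (sym e))
      highs : 5 * a + 1 ≤ c × c < 6 * a → _
      highs (l , h) with m≤n⇒m<n∨m≡n h
      ... | inj₁ h′ = make h h′ (near-high l) (near-high (≤-trans l (n≤1+n c))) (rail refl) (p-high refl l h′)
      ... | inj₂ e = make 0<6a h refl (near-high l) (wrap refl e) (p-wrap refl e)

    E-length : length E ≡ length pathCodes
    E-length = ≤-antisym
      (injection-length (λ e c → PathCode (toℕ (proj₁ e)) (toℕ (proj₂ e)) c) _≢_
        (λ { {u , v} {u′ , v′} p q ne → let (r , s) = pathCode-injective p q refl in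
             ne (cong₂ _,_ (Fin.toℕ-injective r) (Fin.toℕ-injective s)) })
        E pathCodes (inducedEdges-unique (part f i1))
        λ { {u , v} i → let (p , q , e) = ∈-inducedEdges⁻ (part f i1) i in
            edge⇒pathCode (toℕ<6a v) (in-part⁻ f nearColour f≗ u p) (in-part⁻ f nearColour f≗ v q) e })
      (injection-length (λ c e → PathCode (toℕ (proj₁ e)) (toℕ (proj₂ e)) c) _≢_
        (λ p q ne → ne (pathCode-functional p q)) pathCodes E pathCodes-unique pathCode⇒edge)

    -- The rest induces a tree, so the full list of its induced edges is the witness.
    rest-spans : isSpanningTreeᵇ (part f i1) E ≡ true
    rest-spans = ∧-true
      (subst₂ (λ x y → (x + 1 ≡ᵇ y) ≡ true) (sym E-length) (trans pathCodes-length (sym count-rest)) (≡ᵇ-refl (length pathCodes + 1)))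
      (star⇒connected (edgeRel E) (part f i1) Walk Inside.j< sound (edgeRel-flip E) 0<6a
        λ v e → to-root (toℕ<6a v) (in-part⁻ f nearColour f≗ v e))
      where
      sound : ∀ u v → Walk (toℕ u) (toℕ v) → Link (edgeRel E) (part f i1) u v
      sound u v (inside _ _ p q e) = u∈ , v∈ ,
        [ (λ κ → edgeRel-∈ (∈-inducedEdges⁺ (part f i1) u∈ v∈ κ))
        , (λ κ → edgeRel-flip E v u (edgeRel-∈ (∈-inducedEdges⁺ (part f i1) v∈ u∈ κ))) ]′ e
        where
        u∈ = in-part f nearColour f≗ u p
        v∈ = in-part f nearColour f≗ v q

    τ-rest : 1 ≤ τ G (part f i1)
    τ-rest = nonempty (∈-filter⁺ _ (full∈sublists E) (≡true⇒T rest-spans))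
      where
      nonempty : ∀ {A : Set} {x : A} {xs} → x ∈ xs → 1 ≤ length xs
      nonempty (here _)  = s≤s z≤n
      nonempty (there _) = s≤s z≤n

    τ-left : 10 ^ n ≤ τ G (part f i0)
    τ-left = Lobe.τ-lobe 0 (inj₁ refl) 1 ≤-refl (part f i0)
      (λ v e → let (l , h) = near-left⁻ (in-part⁻ f nearColour f≗ v e) in l , subst (_≤ 2 * a) (+-comm 1 (toℕ v)) h)
      (λ v l h → in-part f nearColour f≗ v (near-left l (subst (_≤ 2 * a) (+-comm (toℕ v) 1) h)))
      (linear 3 (λ a c d → c :≡ d ⇒ con 1 :+ d :≡ 2 :* a ⇒ ⊢ c :+ 2 :* con 1 :≡ 2 :* a :+ con 1)
              (a ∷ count (part f i0) ∷ 2 * a ∸ 1 ∷ [])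
        count-left (m+[n∸m]≡n {1} (≤-trans 1≤a (m≤m+n a _))))

    τ-right : 10 ^ n ≤ τ G (part f i2)
    τ-right = Lobe.τ-lobe (3 * a) (inj₂ refl) 0 z≤n (part f i2)
      (λ v e → let (l , h) = near-right⁻ (in-part⁻ f nearColour f≗ v e) in
        linear 2 (λ a v → 3 :* a :≤ v ⇒ ⊢ 3 :* a :+ con 0 :≤ v) (a ∷ toℕ v ∷ []) l ,
        linear 2 (λ a v → v :< 5 :* a :+ con 1 ⇒ ⊢ v :+ con 0 :≤ 3 :* a :+ 2 :* a) (a ∷ toℕ v ∷ []) h)
      (λ v l h → in-part f nearColour f≗ v (near-right
        (linear 2 (λ a v → 3 :* a :+ con 0 :≤ v ⇒ ⊢ 3 :* a :≤ v) (a ∷ toℕ v ∷ []) l)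
        (linear 2 (λ a v → v :+ con 0 :≤ 3 :* a :+ 2 :* a ⇒ ⊢ v :< 5 :* a :+ con 1) (a ∷ toℕ v ∷ []) h)))
      (linear 2 (λ a c → c :≡ 2 :* a :+ con 1 ⇒ ⊢ c :+ 2 :* con 0 :≡ 2 :* a :+ con 1) (a ∷ count (part f i2) ∷ []) count-right)

    τP-near : 10 ^ n * 1 * 10 ^ n ≤ τP G f
    τP-near = *-mono-≤ (*-mono-≤ τ-left τ-rest) τ-right

  near-weight : 10 ^ n * 1 * 10 ^ n ≤ Wlab G (2 * a ∸ 1) (2 * a) (2 * a + 1)
  near-weight = let (f , f∈ , f≗) = allLabelings-complete m (nearColour ∘ toℕ) in
    ≤-trans (τP-near f f≗) (Wlab-≥ G (2 * a ∸ 1) (2 * a) (2 * a + 1) f f∈ (near-valid f f≗))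

-- The embedding into the triangular lattice

module Geometry (κ k a : ℕ) (k≡ : k ≡ 4 * κ) (1≤k : 1 ≤ k) (a≡ : a ≡ 5 * k + 1) where

  open Edges k a a≡

  -- Rail number j starts at the cap (0 , 2); the other rail is its image under the point reflection
  -- (x , y) ↦ (13k + 2 - x , 3 - y). Down, Flat and Up are the steps (1 , -1), (1 , 0), (0 , 1).
  data Step : Set where
    D F U : Step

  data Move (x y x′ y′ : ℕ) : Step → Set where
    down : x′ ≡ 1 + x → y ≡ 1 + y′ → Move x y x′ y′ D
    flat : x′ ≡ 1 + x → y′ ≡ y → Move x y x′ y′ F
    up   : x′ ≡ x → y′ ≡ 1 + y → Move x y x′ y′ U

  -- Index and abscissa of the first rung of each lobe on a rail. A lobe takes `5 * k` steps for
  -- `4 * k` units of `x`; the stretch between the lobes takes `5 * k + 1` steps for `5 * k` units,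
  -- one of them going up.
  data Block (J X : ℕ) : Set where
    left  : J ≡ 1 → X ≡ 1 → Block J X
    right : J ≡ 10 * k + 2 → X ≡ 9 * k + 1 → Block J X

  -- A cell follows the pattern `D F F U F`: between rungs the rail dips to height 0, out of reach
  -- of the other rail, at the price of five steps for four units of `x`. The stretch between the
  -- lobes is one long dip.
  data Pos (j x y : ℕ) : Step → Set where
    cap       : j ≡ 0 → x ≡ 0 → y ≡ 2 → Pos j x y D
    rung      : ∀ {J X} q → Block J X → q < k → j ≡ J + 5 * q → x ≡ X + 4 * q → y ≡ 1 → Pos j x y D
    rail₁     : ∀ {J X} q → Block J X → q < k → j ≡ J + 5 * q + 1 → x ≡ X + 4 * q + 1 → y ≡ 0 → Pos j x y F
    rail₂     : ∀ {J X} q → Block J X → q < k → j ≡ J + 5 * q + 2 → x ≡ X + 4 * q + 2 → y ≡ 0 → Pos j x y F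
    rail₃     : ∀ {J X} q → Block J X → q < k → j ≡ J + 5 * q + 3 → x ≡ X + 4 * q + 3 → y ≡ 0 → Pos j x y U
    rail₄     : ∀ {J X} q → Block J X → q < k → j ≡ J + 5 * q + 4 → x ≡ X + 4 * q + 3 → y ≡ 1 → Pos j x y F
    rung-mid  : j ≡ 1 + 5 * k → x ≡ 1 + 4 * k → y ≡ 1 → Pos j x y D
    mid       : ∀ t → 1 ≤ t → t + 1 < 5 * k → j ≡ 1 + 5 * k + t → x ≡ 1 + 4 * k + t → y ≡ 0 → Pos j x y F
    mid-last  : ∀ t → 1 ≤ t → t + 1 ≡ 5 * k → j ≡ 1 + 5 * k + t → x ≡ 1 + 4 * k + t → y ≡ 0 → Pos j x y U
    mid-end   : j ≡ 1 + 10 * k → x ≡ 9 * k → y ≡ 1 → Pos j x y F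
    rung-last : j ≡ 15 * k + 2 → x ≡ 13 * k + 1 → y ≡ 1 → Pos j x y F
    beyond    : 15 * k + 2 < j → Pos j x y F

  rise : Step → ℕ
  rise D = 2
  rise F = 3
  rise U = 1

  rise-range : ∀ s → 1 ≤ rise s × rise s ≤ 3
  rise-range D = s≤s z≤n , m≤m+n 2 1
  rise-range F = s≤s z≤n , ≤-refl
  rise-range U = s≤s z≤n , m≤m+n 1 2

  record Spot (j : ℕ) : Set where
    constructor spot-at
    field
      x y : ℕ
      out : Step
      pos : Pos j x y out

  -- No two consecutive steps raise 3x + y by less than 4, while lattice neighbours differ by at most 3.
  Next : ∀ (j x y : ℕ) → Step → Set
  Next j x y s = Σ[ S ∈ Spot (suc j) ] (Move x y (Spot.x S) (Spot.y S) s × 4 ≤ rise s + rise (Spot.out S))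

  next : ∀ {j x y s} → Pos j x y s → Next j x y s
  next (cap refl refl refl) =
    spot-at 1 1 D (rung 0 (left refl refl) 1≤k refl refl refl) , down refl refl , ≤-refl
  next {j} {x} (rung {J} {X} q b q<k e e′ refl) =
    spot-at (suc x) 0 F (rail₁ q b q<k (trans (cong suc e) (sym (+-comm _ 1))) (trans (cong suc e′) (sym (+-comm _ 1))) refl) ,
    down refl refl , m≤n+m 4 1
  next {j} {x} (rail₁ {J} {X} q b q<k e e′ refl) =
    spot-at (suc x) 0 F (rail₂ q b q<k (trans (cong suc e) (sym (+-suc _ 1))) (trans (cong suc e′) (sym (+-suc _ 1))) refl) ,
    flat refl refl , m≤n+m 4 2
  next {j} {x} (rail₂ {J} {X} q b q<k e e′ refl) =
    spot-at (suc x) 0 U (rail₃ q b q<k (trans (cong suc e) (sym (+-suc _ 2))) (trans (cong suc e′) (sym (+-suc _ 2))) refl) ,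
    flat refl refl , ≤-refl
  next {j} {x} (rail₃ {J} {X} q b q<k e e′ refl) =
    spot-at x 1 F (rail₄ q b q<k (trans (cong suc e) (sym (+-suc _ 3))) e′ refl) , up refl refl , ≤-refl
  next {j} {x} (rail₄ {J} {X} q b q<k e e′ refl) with suc q <? k
  ... | yes l =
    spot-at (suc x) 1 D (rung (suc q) b l
      (linear 3 (λ j J q → j :≡ J :+ 5 :* q :+ con 4 ⇒ ⊢ con 1 :+ j :≡ J :+ 5 :* (con 1 :+ q)) (j ∷ J ∷ q ∷ []) e)
      (linear 3 (λ x X q → x :≡ X :+ 4 :* q :+ con 3 ⇒ ⊢ con 1 :+ x :≡ X :+ 4 :* (con 1 :+ q)) (x ∷ X ∷ q ∷ []) e′) refl) ,
    flat refl refl , m≤n+m 4 1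
  -- The last cell of the left block leads to the last rung of its lobe, that of the right block to
  -- the end of the rail.
  ... | no g = finish b (≤-antisym q<k (≮⇒≥ g))
    where
    finish : Block J X → suc q ≡ k → Next j x 1 F
    finish (left refl refl) s =
      spot-at (suc x) 1 D (rung-mid
        (linear 3 (λ j q k → j :≡ con 1 :+ 5 :* q :+ con 4 ⇒ con 1 :+ q :≡ k ⇒ ⊢ con 1 :+ j :≡ con 1 :+ 5 :* k)
                (j ∷ q ∷ k ∷ []) e s)
        (linear 3 (λ x q k → x :≡ con 1 :+ 4 :* q :+ con 3 ⇒ con 1 :+ q :≡ k ⇒ ⊢ con 1 :+ x :≡ con 1 :+ 4 :* k)
                (x ∷ q ∷ k ∷ []) e′ s) refl) ,
      flat refl refl , m≤n+m 4 1
    finish (right refl refl) s =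
      spot-at (suc x) 1 F (rung-last
        (linear 3 (λ j q k → j :≡ 10 :* k :+ con 2 :+ 5 :* q :+ con 4 ⇒ con 1 :+ q :≡ k ⇒ ⊢ con 1 :+ j :≡ 15 :* k :+ con 2)
                (j ∷ q ∷ k ∷ []) e s)
        (linear 3 (λ x q k → x :≡ 9 :* k :+ con 1 :+ 4 :* q :+ con 3 ⇒ con 1 :+ q :≡ k ⇒ ⊢ con 1 :+ x :≡ 13 :* k :+ con 1)
                (x ∷ q ∷ k ∷ []) e′ s) refl) ,
      flat refl refl , m≤n+m 4 2
  next {j} {x} (rung-mid e e′ refl) =
    spot-at (suc x) 0 F (mid 1 ≤-refl (linear 1 (λ k → con 1 :≤ k ⇒ ⊢ con 1 :+ con 1 :< 5 :* k) (k ∷ []) 1≤k)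
      (trans (cong suc e) (sym (+-comm _ 1))) (trans (cong suc e′) (sym (+-comm _ 1))) refl) ,
    down refl refl , m≤n+m 4 1
  next {j} {x} (mid t 1≤t t< e e′ refl) with suc t + 1 <? 5 * k
  ... | yes l = spot-at (suc x) 0 F (mid (suc t) (s≤s z≤n) l (trans (cong suc e) (sym (+-suc _ t))) (trans (cong suc e′) (sym (+-suc _ t))) refl) ,
    flat refl refl , m≤n+m 4 2
  ... | no g = spot-at (suc x) 0 U (mid-last (suc t) (s≤s z≤n) (≤-antisym t< (≮⇒≥ g)) (trans (cong suc e) (sym (+-suc _ t))) (trans (cong suc e′) (sym (+-suc _ t))) refl) ,
    flat refl refl , ≤-refl
  next {j} {x} (mid-last t _ t≡ e e′ refl) =
    spot-at x 1 F (mid-end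
      (linear 3 (λ j t k → j :≡ con 1 :+ 5 :* k :+ t ⇒ t :+ con 1 :≡ 5 :* k ⇒ ⊢ con 1 :+ j :≡ con 1 :+ 10 :* k)
              (j ∷ t ∷ k ∷ []) e t≡)
      (linear 3 (λ x t k → x :≡ con 1 :+ 4 :* k :+ t ⇒ t :+ con 1 :≡ 5 :* k ⇒ ⊢ x :≡ 9 :* k) (x ∷ t ∷ k ∷ []) e′ t≡) refl) ,
    up refl refl , ≤-refl
  next {j} {x} (mid-end e e′ refl) =
    spot-at (suc x) 1 D (rung 0 (right refl refl) 1≤k
      (linear 2 (λ j k → j :≡ con 1 :+ 10 :* k ⇒ ⊢ con 1 :+ j :≡ 10 :* k :+ con 2 :+ con 0) (j ∷ k ∷ []) e)
      (linear 2 (λ x k → x :≡ 9 :* k ⇒ ⊢ con 1 :+ x :≡ 9 :* k :+ con 1 :+ con 0) (x ∷ k ∷ []) e′) refl) ,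
    flat refl refl , m≤n+m 4 1
  next {j} {x} {y} (rung-last e e′ _) = spot-at (suc x) y F (beyond (≤-reflexive (cong suc (sym e)))) , flat refl refl , m≤n+m 4 2
  next {j} {x} {y} (beyond l) = spot-at (suc x) y F (beyond (<-trans l ≤-refl)) , flat refl refl , m≤n+m 4 2

  spot : ∀ j → Spot j
  spot zero    = spot-at 0 2 D (cap refl refl refl)
  spot (suc j) = proj₁ (next (Spot.pos (spot j)))

  X Y : ℕ → ℕ
  X j = Spot.x (spot j)
  Y j = Spot.y (spot j)

  out : ℕ → Step
  out j = Spot.out (spot j)

  posn : ∀ j → Pos j (X j) (Y j) (out j)
  posn j = Spot.pos (spot j)

  move : ∀ j → Move (X j) (Y j) (X (suc j)) (Y (suc j)) (out j)
  move j = proj₁ (proj₂ (next (posn j)))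

  two-steps : ∀ j → 4 ≤ rise (out j) + rise (out (suc j))
  two-steps j = proj₂ (proj₂ (next (posn j)))

  -- On the six lattice directions this functional takes the values 1, 2, 3 up to sign, and it is
  -- positive on the three steps of a rail; so it orders the vertices of a rail and bounds how far
  -- apart neighbours can be.
  height : ℕ → ℕ
  height j = 3 * X j + Y j

  move-rise : ∀ {x y x′ y′ s} → Move x y x′ y′ s → 3 * x′ + y′ ≡ 3 * x + y + rise s
  move-rise {x} {y} {x′} {y′} (down e e′) = linear 4 (λ x y x′ y′ → x′ :≡ con 1 :+ x ⇒ y :≡ con 1 :+ y′ ⇒ ⊢ 3 :* x′ :+ y′ :≡ 3 :* x :+ y :+ con 2)
          (x ∷ y ∷ x′ ∷ y′ ∷ []) e e′
  move-rise {x} {y} {x′} {y′} (flat e e′) = linear 4 (λ x y x′ y′ → x′ :≡ con 1 :+ x ⇒ y′ :≡ y ⇒ ⊢ 3 :* x′ :+ y′ :≡ 3 :* x :+ y :+ con 3)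
          (x ∷ y ∷ x′ ∷ y′ ∷ []) e e′
  move-rise {x} {y} {x′} {y′} (up e e′) = linear 4 (λ x y x′ y′ → x′ :≡ x ⇒ y′ :≡ con 1 :+ y ⇒ ⊢ 3 :* x′ :+ y′ :≡ 3 :* x :+ y :+ con 1)
          (x ∷ y ∷ x′ ∷ y′ ∷ []) e e′

  height-suc : ∀ j → height (suc j) ≡ height j + rise (out j)
  height-suc j = move-rise (move j)

  height-< : ∀ {i j} → i < j → height i < height j
  height-< {i} {suc j} (s≤s i≤j) = ≤-<-trans (weak i≤j) step
    where
    step : height j < height (suc j)
    step = subst (height j <_) (sym (height-suc j)) (≤-trans (≤-reflexive (+-comm 1 (height j))) (+-monoʳ-≤ (height j) (proj₁ (rise-range (out j)))))
    weak : i ≤ j → height i ≤ height j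
    weak le with m≤n⇒m<n∨m≡n le
    ... | inj₁ lt   = <⇒≤ (height-< lt)
    ... | inj₂ refl = ≤-refl

  height-gap : ∀ {i j} → suc i < j → height i + 4 ≤ height j
  height-gap {i} lt = ≤-trans two (le lt)
    where
    two : height i + 4 ≤ height (suc (suc i))
    two = linear 5 (λ h₀ h₁ h₂ r r′ → h₁ :≡ h₀ :+ r ⇒ h₂ :≡ h₁ :+ r′ ⇒ con 4 :≤ r :+ r′ ⇒ ⊢ h₀ :+ con 4 :≤ h₂)
      (height i ∷ height (suc i) ∷ height (suc (suc i)) ∷ rise (out i) ∷ rise (out (suc i)) ∷ [])
      (height-suc i) (height-suc (suc i)) (two-steps i)
    le : ∀ {j} → suc i < j → height (suc (suc i)) ≤ height j
    le l with m≤n⇒m<n∨m≡n l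
    ... | inj₁ l′   = <⇒≤ (height-< l′)
    ... | inj₂ refl = ≤-refl

  height-injective : ∀ {i j} → height i ≡ height j → i ≡ j
  height-injective {i} {j} e with <-cmp i j
  ... | tri< l _ _ = ⊥-elim (<⇒≢ (height-< l) e)
  ... | tri≈ _ e′ _ = e′
  ... | tri> _ _ l = ⊥-elim (<⇒≢ (height-< l) (sym e))

  data Near (x y x′ y′ : ℕ) : Set where
    east   : x′ ≡ 1 + x → y′ ≡ y → Near x y x′ y′
    west   : x ≡ 1 + x′ → y′ ≡ y → Near x y x′ y′
    north  : x′ ≡ x → y′ ≡ 1 + y → Near x y x′ y′
    south  : x′ ≡ x → y ≡ 1 + y′ → Near x y x′ y′
    south-east : x′ ≡ 1 + x → y ≡ 1 + y′ → Near x y x′ y′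
    north-west : x ≡ 1 + x′ → y′ ≡ 1 + y → Near x y x′ y′

  near-sym : ∀ {x y x′ y′} → Near x y x′ y′ → Near x′ y′ x y
  near-sym (east e e′) = west e (sym e′)
  near-sym (west e e′) = east e (sym e′)
  near-sym (north e e′) = south (sym e) e′
  near-sym (south e e′) = north (sym e) e′
  near-sym (south-east e e′) = north-west e e′
  near-sym (north-west e e′) = south-east e e′

  near-move : ∀ {x y x′ y′} → Near x y x′ y′ → ∃ λ s → Move x y x′ y′ s ⊎ Move x′ y′ x y s
  near-move (east e e′)       = F , inj₁ (flat e e′)
  near-move (west e e′)       = F , inj₂ (flat e (sym e′))
  near-move (north e e′)      = U , inj₁ (up e e′)
  near-move (south e e′)      = U , inj₂ (up (sym e) e′)
  near-move (south-east e e′) = D , inj₁ (down e e′)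
  near-move (north-west e e′) = D , inj₂ (down e e′)

  move-near : ∀ {x y x′ y′ s} → Move x y x′ y′ s → Near x y x′ y′
  move-near (down e e′) = south-east e e′
  move-near (flat e e′) = east e e′
  move-near (up e e′)   = north e e′

  near-height : ∀ {x y x′ y′} → Near x y x′ y′ → 3 * x′ + y′ ≤ 3 * x + y + 3 × 3 * x′ + y′ ≢ 3 * x + y
  near-height {x} {y} {x′} {y′} ν = go (near-move ν)
    where
    ρ : Step → _
    ρ s = 3 * x + y ∷ 3 * x′ + y′ ∷ rise s ∷ []
    go : (∃ λ s → Move x y x′ y′ s ⊎ Move x′ y′ x y s) → 3 * x′ + y′ ≤ 3 * x + y + 3 × 3 * x′ + y′ ≢ 3 * x + y
    go (s , inj₁ μ) =
      linear 3 (λ h h′ r → h′ :≡ h :+ r ⇒ r :≤ con 3 ⇒ ⊢ h′ :≤ h :+ con 3) (ρ s) (move-rise μ) (proj₂ (rise-range s)) ,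
      linear 3 (λ h h′ r → h′ :≡ h :+ r ⇒ con 1 :≤ r ⇒ h′ :≡ h ⇒ ⊢ :⊥) (ρ s) (move-rise μ) (proj₁ (rise-range s))
    go (s , inj₂ μ) =
      linear 3 (λ h h′ r → h :≡ h′ :+ r ⇒ ⊢ h′ :≤ h :+ con 3) (ρ s) (move-rise μ) ,
      linear 3 (λ h h′ r → h :≡ h′ :+ r ⇒ con 1 :≤ r ⇒ h′ :≡ h ⇒ ⊢ :⊥) (ρ s) (move-rise μ) (proj₁ (rise-range s))

  same-rail : ∀ i j → Near (X i) (Y i) (X j) (Y j) → j ≡ suc i ⊎ i ≡ suc j
  same-rail i j ν with <-cmp i j
  ... | tri≈ _ refl _ = ⊥-elim (proj₂ (near-height ν) refl)
  ... | tri< l _ _ = inj₁ (≤-antisym (≮⇒≥ λ g → linear 2 (λ h h′ → h :+ con 4 :≤ h′ ⇒ h′ :≤ h :+ con 3 ⇒ ⊢ :⊥)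
          (height i ∷ height j ∷ []) (height-gap g) (proj₁ (near-height ν))) l)
  ... | tri> _ _ l = inj₂ (≤-antisym (≮⇒≥ λ g → linear 2 (λ h h′ → h :+ con 4 :≤ h′ ⇒ h′ :≤ h :+ con 3 ⇒ ⊢ :⊥)
          (height j ∷ height i ∷ []) (height-gap g) (proj₁ (near-height (near-sym ν)))) l)

  rail-near : ∀ j → Near (X j) (Y j) (X (suc j)) (Y (suc j))
  rail-near j = move-near (move j)

  -- The cap of the other rail is at `(c , 1)`, one step east of the last vertex of this rail at
  -- `(13 * k + 1 , 1)`.
  c : ℕ
  c = 13 * k + 2

  5-clash : ∀ u v r → 1 ≤ r → r < 5 → 5 * u ≢ 5 * v + r
  5-clash u v r 1≤r r<5 e = [ (λ l → linear 3 (λ u v r → u :≤ v ⇒ con 1 :≤ r ⇒ 5 :* u :≡ 5 :* v :+ r ⇒ ⊢ :⊥)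
          (u ∷ v ∷ r ∷ []) l 1≤r e)
                                , (λ l → linear 3 (λ u v r → v :< u ⇒ r :< con 5 ⇒ 5 :* u :≡ 5 :* v :+ r ⇒ ⊢ :⊥)
                                        (u ∷ v ∷ r ∷ []) l r<5 e) ]′ (≤-<-connex u v)

  4-clash : ∀ u v r → 1 ≤ r → r < 4 → 4 * u ≢ 4 * v + r
  4-clash u v r 1≤r r<4 e = [ (λ l → linear 3 (λ u v r → u :≤ v ⇒ con 1 :≤ r ⇒ 4 :* u :≡ 4 :* v :+ r ⇒ ⊢ :⊥)
          (u ∷ v ∷ r ∷ []) l 1≤r e)
                                , (λ l → linear 3 (λ u v r → v :< u ⇒ r :< con 4 ⇒ 4 :* u :≡ 4 :* v :+ r ⇒ ⊢ :⊥)
                                        (u ∷ v ∷ r ∷ []) l r<4 e) ]′ (≤-<-connex u v)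

  block-determined : ∀ {J X J′ X′ q q′} r → r < 5 → Block J X → Block J′ X′ → q ≤ k → q′ < k → J + 5 * q ≡ J′ + 5 * q′ + r →
                     X ≡ X′ × 5 * q ≡ 5 * q′ + r
  block-determined {q = q} {q′} r r<5 (left refl refl) (left refl refl) _ _ e = refl , suc-injective e
  block-determined {q = q} {q′} r r<5 (right refl refl) (right refl refl) _ _ e =
    refl , +-cancelˡ-≡ (10 * k + 2) _ _ (trans e (+-assoc (10 * k + 2) (5 * q′) r))
  block-determined {q = q} {q′} r r<5 (left refl refl) (right refl refl) q≤ q′< e =
    ⊥-elim (linear 4 (λ k q q′ r → q :≤ k ⇒ con 1 :+ 5 :* q :≡ 10 :* k :+ con 2 :+ 5 :* q′ :+ r ⇒ ⊢ :⊥)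
            (k ∷ q ∷ q′ ∷ r ∷ []) q≤ e)
  block-determined {q = q} {q′} r r<5 (right refl refl) (left refl refl) q≤ q′< e =
    ⊥-elim (linear 4 (λ k q q′ r → q′ :< k ⇒ r :< con 5 ⇒ 10 :* k :+ con 2 :+ 5 :* q :≡ con 1 :+ 5 :* q′ :+ r ⇒ ⊢ :⊥)
            (k ∷ q ∷ q′ ∷ r ∷ []) q′< r<5 e)

  block-bounds : ∀ {J X q} → Block J X → q ≤ k → J + 5 * q ≤ 1 + 5 * k ⊎ 10 * k + 2 ≤ J + 5 * q
  block-bounds {q = q} (left refl refl) q≤ = inj₁ (s≤s (*-monoʳ-≤ 5 q≤))
  block-bounds {q = q} (right refl refl) q≤ = inj₂ (m≤m+n (10 * k + 2) (5 * q))

  block-end : ∀ {J X q} → Block J X → q ≤ k → J + 5 * q ≤ 15 * k + 2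
  block-end {q = q} (left refl refl) q≤ = linear 2 (λ k q → q :≤ k ⇒ ⊢ con 1 :+ 5 :* q :≤ 15 :* k :+ con 2) (k ∷ q ∷ []) q≤
  block-end {q = q} (right refl refl) q≤ = linear 2 (λ k q → q :≤ k ⇒ ⊢ 10 :* k :+ con 2 :+ 5 :* q :≤ 15 :* k :+ con 2)
          (k ∷ q ∷ []) q≤

  -- The index leaves only one description of the spot: inside a block its residue modulo 5 decides,
  -- and between blocks its size.
  rung-pos : ∀ {J X q j x y s} → Block J X → q ≤ k → j ≡ J + 5 * q → Pos j x y s → x ≡ X + 4 * q × y ≡ 1
  rung-pos {q = q} (left refl refl) q≤ refl (cap () _ _)
  rung-pos {q = q} (right refl refl) q≤ refl (cap e _ _) = ⊥-elim (linear 2 (λ k q → 10 :* k :+ con 2 :+ 5 :* q :≡ con 0 ⇒ ⊢ :⊥)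
          (k ∷ q ∷ []) e)
  rung-pos {X = X} {q = q} b q≤ refl (rung q′ b′ q′< e refl refl) with block-determined 0 (s≤s z≤n) b b′ q≤ q′< (trans e (sym (+-identityʳ _)))
  ... | refl , e′ = cong (λ w → X + 4 * w) (sym (*-cancelˡ-≡ q q′ 5 (trans e′ (+-identityʳ _)))) , refl
  rung-pos {q = q} b q≤ refl (rail₁ q′ b′ q′< e _ _) = ⊥-elim (5-clash q q′ 1 ≤-refl (m≤m+n 2 3) (proj₂ (block-determined 1 (m≤m+n 2 3) b b′ q≤ q′< e)))
  rung-pos {q = q} b q≤ refl (rail₂ q′ b′ q′< e _ _) = ⊥-elim (5-clash q q′ 2 (m≤m+n 1 1) (m≤m+n 3 2) (proj₂ (block-determined 2 (m≤m+n 3 2) b b′ q≤ q′< e)))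
  rung-pos {q = q} b q≤ refl (rail₃ q′ b′ q′< e _ _) = ⊥-elim (5-clash q q′ 3 (m≤m+n 1 2) (m≤m+n 4 1) (proj₂ (block-determined 3 (m≤m+n 4 1) b b′ q≤ q′< e)))
  rung-pos {q = q} b q≤ refl (rail₄ q′ b′ q′< e _ _) = ⊥-elim (5-clash q q′ 4 (m≤m+n 1 3) ≤-refl (proj₂ (block-determined 4 ≤-refl b b′ q≤ q′< e)))
  rung-pos {q = q} (left refl refl) q≤ refl (rung-mid e refl refl) = cong (λ w → 1 + 4 * w) (sym (*-cancelˡ-≡ q k 5 (suc-injective e))) , refl
  rung-pos {q = q} (right refl refl) q≤ refl (rung-mid e _ _) = ⊥-elim (linear 2 (λ k q → 10 :* k :+ con 2 :+ 5 :* q :≡ con 1 :+ 5 :* k ⇒ ⊢ :⊥)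
          (k ∷ q ∷ []) e)
  rung-pos {J} {q = q} b q≤ refl (mid t 1≤t t< e _ _) = ⊥-elim ([ (λ l → linear 3 (λ k t j → j :≤ con 1 :+ 5 :* k ⇒ j :≡ con 1 :+ 5 :* k :+ t ⇒ con 1 :≤ t ⇒ ⊢ :⊥)
          (k ∷ t ∷ J + 5 * q ∷ []) l e 1≤t)
    , (λ l → linear 3 (λ k t j → 10 :* k :+ con 2 :≤ j ⇒ j :≡ con 1 :+ 5 :* k :+ t ⇒ t :+ con 1 :< 5 :* k ⇒ ⊢ :⊥)
            (k ∷ t ∷ J + 5 * q ∷ []) l e t<) ]′ (block-bounds b q≤))
  rung-pos {J} {q = q} b q≤ refl (mid-last t 1≤t t≡ e _ _) = ⊥-elim ([ (λ l → linear 3 (λ k t j → j :≤ con 1 :+ 5 :* k ⇒ j :≡ con 1 :+ 5 :* k :+ t ⇒ con 1 :≤ t ⇒ ⊢ :⊥)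
          (k ∷ t ∷ J + 5 * q ∷ []) l e 1≤t)
    , (λ l → linear 3 (λ k t j → 10 :* k :+ con 2 :≤ j ⇒ j :≡ con 1 :+ 5 :* k :+ t ⇒ t :+ con 1 :≡ 5 :* k ⇒ ⊢ :⊥)
            (k ∷ t ∷ J + 5 * q ∷ []) l e t≡) ]′ (block-bounds b q≤))
  rung-pos {J} {q = q} b q≤ refl (mid-end e _ _) = ⊥-elim ([ (λ l → linear 2 (λ k j → con 1 :≤ k ⇒ j :≤ con 1 :+ 5 :* k ⇒ j :≡ con 1 :+ 10 :* k ⇒ ⊢ :⊥)
          (k ∷ J + 5 * q ∷ []) 1≤k l e)
    , (λ l → linear 2 (λ k j → 10 :* k :+ con 2 :≤ j ⇒ j :≡ con 1 :+ 10 :* k ⇒ ⊢ :⊥)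
            (k ∷ J + 5 * q ∷ []) l e) ]′ (block-bounds b q≤))
  rung-pos {q = q} (left refl refl) q≤ refl (rung-last e _ _) = ⊥-elim (linear 2 (λ k q → q :≤ k ⇒ con 1 :+ 5 :* q :≡ 15 :* k :+ con 2 ⇒ ⊢ :⊥)
          (k ∷ q ∷ []) q≤ e)
  rung-pos {q = q} {x = x} (right refl refl) q≤ refl (rung-last e e′ e″) =
    linear 3 (λ k q x → 10 :* k :+ con 2 :+ 5 :* q :≡ 15 :* k :+ con 2 ⇒ x :≡ 13 :* k :+ con 1 ⇒ ⊢ x :≡ 9 :* k :+ con 1 :+ 4 :* q)
            (k ∷ q ∷ x ∷ []) e e′ , e″
  rung-pos b q≤ refl (beyond l) = ⊥-elim (<⇒≱ l (block-end b q≤))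

  -- Only rail vertices with y ≥ 1 can face the other rail; modulo 4 they have x = 1 on the rungs and x = 0 just before.
  data Shape (j x y : ℕ) : Set where
    is-cap   : j ≡ 0 → x ≡ 0 → y ≡ 2 → Shape j x y
    is-rung  : ∀ {J X} q → Block J X → q ≤ k → j ≡ J + 5 * q → x ≡ X + 4 * q → y ≡ 1 → Shape j x y
    pre-rung : ∀ w → x ≡ 4 * w → y ≡ 1 → Shape j x y
    is-low   : y ≡ 0 → Shape j x y

  -- Divisibility of `k` by 4 puts the rungs of both lobes into the same residue class.
  block-mod : ∀ {J X q} → Block J X → ∃ λ w → X + 4 * q ≡ 1 + 4 * w
  block-mod {q = q} (left refl refl) = q , refl
  block-mod {q = q} (right refl refl) = 9 * κ + q ,
    linear 3 (λ k κ q → k :≡ 4 :* κ ⇒ ⊢ 9 :* k :+ con 1 :+ 4 :* q :≡ con 1 :+ 4 :* (9 :* κ :+ q)) (k ∷ κ ∷ q ∷ []) k≡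

  shape : ∀ {j x y s} → j ≤ 15 * k + 2 → Pos j x y s → Shape j x y
  shape _ (cap e e′ e″) = is-cap e e′ e″
  shape _ (rung q b q< e e′ e″) = is-rung q b (<⇒≤ q<) e e′ e″
  shape _ (rail₁ _ _ _ _ _ e) = is-low e
  shape _ (rail₂ _ _ _ _ _ e) = is-low e
  shape _ (rail₃ _ _ _ _ _ e) = is-low e
  shape {x = x} _ (rail₄ {X = X} q b _ _ e e′) = let (w , e″) = block-mod {q = q} b in pre-rung (suc w)
    (linear 4 (λ x X q w → x :≡ X :+ 4 :* q :+ con 3 ⇒ X :+ 4 :* q :≡ con 1 :+ 4 :* w ⇒ ⊢ x :≡ 4 :* (con 1 :+ w))
            (x ∷ X ∷ q ∷ w ∷ []) e e″) e′
  shape _ (rung-mid e e′ e″) = is-rung k (left refl refl) ≤-refl e e′ e″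
  shape _ (mid _ _ _ _ _ e) = is-low e
  shape _ (mid-last _ _ _ _ _ e) = is-low e
  shape {x = x} _ (mid-end _ e e′) = pre-rung (9 * κ) (linear 3 (λ x k κ → k :≡ 4 :* κ ⇒ x :≡ 9 :* k ⇒ ⊢ x :≡ 4 :* (9 :* κ))
          (x ∷ k ∷ κ ∷ []) k≡ e) e′
  shape {j} {x} _ (rung-last e e′ e″) = is-rung k (right refl refl) ≤-refl
    (linear 2 (λ j k → j :≡ 15 :* k :+ con 2 ⇒ ⊢ j :≡ 10 :* k :+ con 2 :+ 5 :* k) (j ∷ k ∷ []) e)
    (linear 2 (λ x k → x :≡ 13 :* k :+ con 1 ⇒ ⊢ x :≡ 9 :* k :+ con 1 :+ 4 :* k) (x ∷ k ∷ []) e′) e″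
  shape l (beyond g) = ⊥-elim (<⇒≱ g l)

  last-X : X (15 * k + 2) ≡ 13 * k + 1 × Y (15 * k + 2) ≡ 1
  last-X = let (p , q) = rung-pos (right refl refl) ≤-refl (linear 1 (λ k → ⊢ 15 :* k :+ con 2 :≡ 10 :* k :+ con 2 :+ 5 :* k) (k ∷ [])) (posn (15 * k + 2)) in
    trans p (linear 1 (λ k → ⊢ 9 :* k :+ con 1 :+ 4 :* k :≡ 13 :* k :+ con 1) (k ∷ [])) , q

  X-bound : ∀ {j} → j ≤ 15 * k + 2 → X j ≤ 13 * k + 1
  X-bound {j} l with m≤n⇒m<n∨m≡n l
  ... | inj₂ refl = ≤-reflexive (proj₁ last-X)
  ... | inj₁ lt = linear 5 (λ x y x′ y′ b → 3 :* x :+ y :< 3 :* x′ :+ y′ ⇒ x′ :≡ b ⇒ y′ :≡ con 1 ⇒ ⊢ x :≤ b)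
    (X j ∷ Y j ∷ X (15 * k + 2) ∷ Y (15 * k + 2) ∷ 13 * k + 1 ∷ []) (height-< lt) (proj₁ last-X) (proj₂ last-X)

  near-shift : ∀ {x y x′ y′} p q → Near x y x′ y′ → Near (x + p) (y + q) (x′ + p) (y′ + q)
  near-shift p q (east e f)       = east (cong (_+ p) e) (cong (_+ q) f)
  near-shift p q (west e f)       = west (cong (_+ p) e) (cong (_+ q) f)
  near-shift p q (north e f)      = north (cong (_+ p) e) (cong (_+ q) f)
  near-shift p q (south e f)      = south (cong (_+ p) e) (cong (_+ q) f)
  near-shift p q (south-east e f) = south-east (cong (_+ p) e) (cong (_+ q) f)
  near-shift p q (north-west e f) = north-west (cong (_+ p) e) (cong (_+ q) f)

  near-unshift : ∀ {x y x′ y′} p q → Near (x + p) (y + q) (x′ + p) (y′ + q) → Near x y x′ y′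
  near-unshift p q (east e f)       = east (+-cancelʳ-≡ p _ _ e) (+-cancelʳ-≡ q _ _ f)
  near-unshift p q (west e f)       = west (+-cancelʳ-≡ p _ _ e) (+-cancelʳ-≡ q _ _ f)
  near-unshift p q (north e f)      = north (+-cancelʳ-≡ p _ _ e) (+-cancelʳ-≡ q _ _ f)
  near-unshift p q (south e f)      = south (+-cancelʳ-≡ p _ _ e) (+-cancelʳ-≡ q _ _ f)
  near-unshift p q (south-east e f) = south-east (+-cancelʳ-≡ p _ _ e) (+-cancelʳ-≡ q _ _ f)
  near-unshift p q (north-west e f) = north-west (+-cancelʳ-≡ p _ _ e) (+-cancelʳ-≡ q _ _ f)

  -- Adding the reflected point to both sides: adjacency across the rails depends only on the sums of the coordinates.
  Sums : ℕ → ℕ → Set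
  Sums sx sy = Near sx sy c 3

  near-sums : ∀ {x y x′ y′ px py} → px + x′ ≡ c → py + y′ ≡ 3 → Near x y px py → Sums (x + x′) (y + y′)
  near-sums {x} {y} {x′} {y′} e f ν = subst₂ (Near (x + x′) (y + y′)) e f (near-shift x′ y′ ν)

  sums-near : ∀ {x y x′ y′ px py} → px + x′ ≡ c → py + y′ ≡ 3 → Sums (x + x′) (y + y′) → Near x y px py
  sums-near {x} {y} {x′} {y′} e f σ = near-unshift x′ y′ (subst₂ (Near (x + x′) (y + y′)) (sym e) (sym f) σ)

  -- Each rail is indexed from its own cap, so the two indices run in opposite directions along the
  -- strip and the ends of a rung have the constant index sum `15 * k + 3`.
  data Cross (j j′ : ℕ) : Set where
    cap-last  : j ≡ 0 → j′ ≡ 15 * k + 2 → Cross j j′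
    last-cap  : j ≡ 15 * k + 2 → j′ ≡ 0 → Cross j j′
    rung-low  : ∀ q → q ≤ k → j ≡ 1 + 5 * q → j + j′ ≡ 15 * k + 3 → Cross j j′
    rung-high : ∀ q → q ≤ k → j ≡ 10 * k + 2 + 5 * q → j + j′ ≡ 15 * k + 3 → Cross j j′

  cross-sym : ∀ {j j′} → Cross j j′ → Cross j′ j
  cross-sym (cap-last e e′) = last-cap e′ e
  cross-sym (last-cap e e′) = cap-last e′ e
  cross-sym {j} {j′} (rung-low q q≤ e s) = rung-high (k ∸ q) (m∸n≤m k q)
    (linear 5 (λ k q r j j′ → r :+ q :≡ k ⇒ j :≡ con 1 :+ 5 :* q ⇒ j :+ j′ :≡ 15 :* k :+ con 3 ⇒ ⊢ j′ :≡ 10 :* k :+ con 2 :+ 5 :* r)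
            (k ∷ q ∷ k ∸ q ∷ j ∷ j′ ∷ []) (m∸n+n≡m q≤) e s)
    (trans (+-comm j′ j) s)
  cross-sym {j} {j′} (rung-high q q≤ e s) = rung-low (k ∸ q) (m∸n≤m k q)
    (linear 5 (λ k q r j j′ → r :+ q :≡ k ⇒ j :≡ 10 :* k :+ con 2 :+ 5 :* q ⇒ j :+ j′ :≡ 15 :* k :+ con 3 ⇒ ⊢ j′ :≡ con 1 :+ 5 :* r)
            (k ∷ q ∷ k ∸ q ∷ j ∷ j′ ∷ []) (m∸n+n≡m q≤) e s)
    (trans (+-comm j′ j) s)

  bound-clash : ∀ {x} n → x ≤ 13 * k + 1 → x ≢ n + c
  bound-clash {x} n b e = linear 3 (λ k x n → x :≤ 13 :* k :+ con 1 ⇒ x :≡ n :+ (13 :* k :+ con 2) ⇒ ⊢ :⊥) (k ∷ x ∷ n ∷ []) b e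

  c≡ : c ≡ 4 * (13 * κ) + 2
  c≡ = linear 2 (λ k κ → k :≡ 4 :* κ ⇒ ⊢ 13 :* k :+ con 2 :≡ 4 :* (13 :* κ) :+ con 2) (k ∷ κ ∷ []) k≡

  c-mod : ∀ u n {r} → 4 * u + n ≡ c → n + r ≡ 2 → 1 ≤ r → r < 4 → ⊥
  c-mod u n {r} e s 1≤r r<4 = 4-clash u (13 * κ) r 1≤r r<4
    (linear 5 (λ u n r v c → 4 :* u :+ n :≡ c ⇒ n :+ r :≡ con 2 ⇒ c :≡ 4 :* v :+ con 2 ⇒ ⊢ 4 :* u :≡ 4 :* v :+ r)
            (u ∷ n ∷ r ∷ 13 * κ ∷ c ∷ []) e s c≡)

  cap-rung : ∀ {J X q} → Block J X → q ≤ k → 1 + (X + 4 * q) ≡ c → J + 5 * q ≡ 15 * k + 2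
  cap-rung {q = q} (left refl refl) q≤ e = ⊥-elim (linear 2 (λ k q → con 1 :≤ k ⇒ q :≤ k ⇒ con 1 :+ (con 1 :+ 4 :* q) :≡ 13 :* k :+ con 2 ⇒ ⊢ :⊥)
          (k ∷ q ∷ []) 1≤k q≤ e)
  cap-rung {q = q} (right refl refl) q≤ e = linear 2 (λ k q → con 1 :+ (9 :* k :+ con 1 :+ 4 :* q) :≡ 13 :* k :+ con 2 ⇒ ⊢ 10 :* k :+ con 2 :+ 5 :* q :≡ 15 :* k :+ con 2)
          (k ∷ q ∷ []) e

  rung-rung : ∀ {J X q J′ X′ q′} → Block J X → Block J′ X′ → q ≤ k → q′ ≤ k → X + 4 * q + (X′ + 4 * q′) ≡ c →
              Cross (J + 5 * q) (J′ + 5 * q′)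
  rung-rung {q = q} {q′ = q′} (left refl refl) (left refl refl) q≤ q′≤ e =
    ⊥-elim (linear 3 (λ k q q′ → con 1 :≤ k ⇒ q :≤ k ⇒ q′ :≤ k ⇒ con 1 :+ 4 :* q :+ (con 1 :+ 4 :* q′) :≡ 13 :* k :+ con 2 ⇒ ⊢ :⊥)
            (k ∷ q ∷ q′ ∷ []) 1≤k q≤ q′≤ e)
  rung-rung {q = q} {q′ = q′} (right refl refl) (right refl refl) q≤ q′≤ e =
    ⊥-elim (linear 3 (λ k q q′ → con 1 :≤ k ⇒ 9 :* k :+ con 1 :+ 4 :* q :+ (9 :* k :+ con 1 :+ 4 :* q′) :≡ 13 :* k :+ con 2 ⇒ ⊢ :⊥)
            (k ∷ q ∷ q′ ∷ []) 1≤k e)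
  rung-rung {q = q} {q′ = q′} (left refl refl) (right refl refl) q≤ q′≤ e = rung-low q q≤ refl
    (linear 3 (λ k q q′ → con 1 :+ 4 :* q :+ (9 :* k :+ con 1 :+ 4 :* q′) :≡ 13 :* k :+ con 2 ⇒ ⊢ con 1 :+ 5 :* q :+ (10 :* k :+ con 2 :+ 5 :* q′) :≡ 15 :* k :+ con 3)
            (k ∷ q ∷ q′ ∷ []) e)
  rung-rung {q = q} {q′ = q′} (right refl refl) (left refl refl) q≤ q′≤ e = rung-high q q≤ refl
    (linear 3 (λ k q q′ → 9 :* k :+ con 1 :+ 4 :* q :+ (con 1 :+ 4 :* q′) :≡ 13 :* k :+ con 2 ⇒ ⊢ 10 :* k :+ con 2 :+ 5 :* q :+ (con 1 :+ 5 :* q′) :≡ 15 :* k :+ con 3)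
            (k ∷ q ∷ q′ ∷ []) e)

  sums-sym : ∀ x y x′ y′ → Sums (x + x′) (y + y′) → Sums (x′ + x) (y′ + y)
  sums-sym x y x′ y′ = subst₂ Sums (+-comm x x′) (+-comm y y′)

  module _ {j j′ x y x′ y′ : ℕ} where

    cap-crossing : x ≡ 0 → y ≡ 2 → j ≡ 0 → Shape j′ x′ y′ → x′ ≤ 13 * k + 1 → Sums (x + x′) (y + y′) → Cross j j′
    cap-crossing refl refl refl (is-cap _ refl refl) b (south e _) = ⊥-elim (bound-clash 0 z≤n (sym e))
    cap-crossing refl refl refl (is-cap _ refl refl) b (south-east e _) = ⊥-elim (linear 1 (λ k → 13 :* k :+ con 2 :≡ con 1 ⇒ ⊢ :⊥)
            (k ∷ []) e)
    cap-crossing refl refl refl (is-rung q β q≤ refl refl refl) b (east e _) = cap-last refl (cap-rung β q≤ (sym e))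
    cap-crossing refl refl refl (is-rung q β q≤ refl refl refl) b (west e _) = ⊥-elim (bound-clash 1 b e)
    cap-crossing refl refl refl (pre-rung w refl refl) b (east e _) = ⊥-elim (c-mod w 1 (trans (+-comm (4 * w) 1) (sym e)) refl ≤-refl (m≤m+n 2 2))
    cap-crossing refl refl refl (pre-rung w refl refl) b (west e _) = ⊥-elim (bound-clash 1 b e)
    cap-crossing refl refl refl (is-low refl) b (north e _) = ⊥-elim (bound-clash 0 b (sym e))
    cap-crossing refl refl refl (is-low refl) b (north-west e _) = ⊥-elim (bound-clash 1 b e)

  no-sums₀ : ∀ {sx} → ¬ Sums sx 0
  no-sums₀ (east _ ())
  no-sums₀ (west _ ())
  no-sums₀ (north _ ())
  no-sums₀ (south _ ())
  no-sums₀ (south-east _ ())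
  no-sums₀ (north-west _ ())

  no-sums₁ : ∀ {sx} → ¬ Sums sx 1
  no-sums₁ (east _ ())
  no-sums₁ (west _ ())
  no-sums₁ (north _ ())
  no-sums₁ (south _ ())
  no-sums₁ (south-east _ ())
  no-sums₁ (north-west _ ())

  sums₂ : ∀ {sx} → Sums sx 2 → sx ≡ c ⊎ sx ≡ 1 + c
  sums₂ (north e _)      = inj₁ (sym e)
  sums₂ (north-west e _) = inj₂ e

  rung-level : ∀ {J X q} → Block J X → ∀ w′ → X + 4 * q + 4 * w′ ≢ c × X + 4 * q + 4 * w′ ≢ 1 + c
  rung-level {X = X} {q} b w′ = let (w , f) = block-mod {q = q} b in
    (λ e → c-mod (w + w′) 1
      (linear 4 (λ u w w′ c → u :+ 4 :* w′ :≡ c ⇒ u :≡ con 1 :+ 4 :* w ⇒ ⊢ 4 :* (w :+ w′) :+ con 1 :≡ c)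
              (X + 4 * q ∷ w ∷ w′ ∷ c ∷ []) e f)
      refl ≤-refl (m≤m+n 2 2)) ,
    (λ e → c-mod (w + w′) 0
      (linear 4 (λ u w w′ c → u :+ 4 :* w′ :≡ con 1 :+ c ⇒ u :≡ con 1 :+ 4 :* w ⇒ ⊢ 4 :* (w :+ w′) :+ con 0 :≡ c)
              (X + 4 * q ∷ w ∷ w′ ∷ c ∷ []) e f)
      refl (m≤m+n 1 1) (m≤m+n 3 1))

  -- Away from the caps the ordinates must add up to 2, and then the abscissas to `c` or `1 + c`,
  -- which are 2 and 3 modulo 4. A rung contributes 1 and a vertex before a rung 0, so two rungs
  -- with sum `c` are the only possibility.
  crossing : ∀ {j j′ x y x′ y′} → Shape j x y → Shape j′ x′ y′ → x ≤ 13 * k + 1 → x′ ≤ 13 * k + 1 → Sums (x + x′) (y + y′) → Cross j j′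
  crossing (is-cap e e′ e″) S b b′ s = cap-crossing e′ e″ e S b′ s
  crossing {x = x} {y} {x′} {y′} S@(is-rung _ _ _ _ _ _) (is-cap e e′ e″) b b′ s = cross-sym (cap-crossing e′ e″ e S b (sums-sym x y x′ y′ s))
  crossing {x = x} {y} {x′} {y′} S@(pre-rung _ _ _) (is-cap e e′ e″) b b′ s = cross-sym (cap-crossing e′ e″ e S b (sums-sym x y x′ y′ s))
  crossing {x = x} {y} {x′} {y′} S@(is-low _) (is-cap e e′ e″) b b′ s = cross-sym (cap-crossing e′ e″ e S b (sums-sym x y x′ y′ s))
  crossing (is-low refl) (is-low refl) b b′ s = ⊥-elim (no-sums₀ s)
  crossing (is-low refl) (is-rung _ _ _ _ _ refl) b b′ s = ⊥-elim (no-sums₁ s)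
  crossing (is-low refl) (pre-rung _ _ refl) b b′ s = ⊥-elim (no-sums₁ s)
  crossing (is-rung _ _ _ _ _ refl) (is-low refl) b b′ s = ⊥-elim (no-sums₁ s)
  crossing (pre-rung _ _ refl) (is-low refl) b b′ s = ⊥-elim (no-sums₁ s)
  crossing (is-rung {X = Z} q β q≤ refl refl refl) (is-rung {X = Z′} q′ β′ q′≤ refl refl refl) b b′ s =
    [ rung-rung β β′ q≤ q′≤ , (λ e → ⊥-elim (odd (block-mod {q = q} β) (block-mod {q = q′} β′) e)) ]′ (sums₂ s)
    where
    odd : (∃ λ w → Z + 4 * q ≡ 1 + 4 * w) → (∃ λ w → Z′ + 4 * q′ ≡ 1 + 4 * w) → Z + 4 * q + (Z′ + 4 * q′) ≡ 1 + c → ⊥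
    odd (w , f) (w′ , f′) e = c-mod (w + w′) 1
      (linear 5 (λ u u′ w w′ c → u :+ u′ :≡ con 1 :+ c ⇒ u :≡ con 1 :+ 4 :* w ⇒ u′ :≡ con 1 :+ 4 :* w′ ⇒ ⊢ 4 :* (w :+ w′) :+ con 1 :≡ c)
              (Z + 4 * q ∷ Z′ + 4 * q′ ∷ w ∷ w′ ∷ c ∷ []) e f f′) refl ≤-refl (m≤m+n 2 2)
  crossing (is-rung q β _ refl refl refl) (pre-rung w refl refl) b b′ s =
    ⊥-elim ([ proj₁ (rung-level {q = q} β w) , proj₂ (rung-level {q = q} β w) ]′ (sums₂ s))
  crossing (pre-rung w refl refl) (is-rung {X = Z} q β _ refl refl refl) b b′ s =
    ⊥-elim ([ (λ e → proj₁ (rung-level {q = q} β w) (trans (+-comm (Z + 4 * q) (4 * w)) e)) , (λ e → proj₂ (rung-level {q = q} β w) (trans (+-comm (Z + 4 * q) (4 * w)) e)) ]′ (sums₂ s))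
  crossing (pre-rung w refl refl) (pre-rung w′ refl refl) b b′ s = ⊥-elim ([
    (λ e → c-mod (w + w′) 0
      (linear 3 (λ w w′ c → 4 :* w :+ 4 :* w′ :≡ c ⇒ ⊢ 4 :* (w :+ w′) :+ con 0 :≡ c)
              (w ∷ w′ ∷ c ∷ []) e) refl (m≤m+n 1 1) (m≤m+n 3 1)) ,
    (λ e → 4-clash (w + w′) (13 * κ) 3 (m≤m+n 1 2) ≤-refl
      (linear 4 (λ w w′ v c → 4 :* w :+ 4 :* w′ :≡ con 1 :+ c ⇒ c :≡ 4 :* v :+ con 2 ⇒ ⊢ 4 :* (w :+ w′) :≡ 4 :* v :+ con 3)
              (w ∷ w′ ∷ 13 * κ ∷ c ∷ []) e c≡)) ]′ (sums₂ s))

  -- The two rails in the plane: index j on the bottom rail is vertex a + j, on the top rail vertex 4a + j modulo 6a.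
  data TopIndex (v j : ℕ) : Set where
    t₁ : j < 2 * a → v ≡ 4 * a + j → TopIndex v j
    t₂ : 2 * a ≤ j → v + 2 * a ≡ j → TopIndex v j

  data Place (v px py : ℕ) : Set where
    bottom : ∀ j → j < 3 * a → v ≡ a + j → px ≡ X j → py ≡ Y j → Place v px py
    top    : ∀ j → j < 3 * a → TopIndex v j → px + X j ≡ c → py + Y j ≡ 3 → Place v px py

  3a≡ : 3 * a ≡ suc (15 * k + 2)
  3a≡ = linear 2 (λ a k → a :≡ 5 :* k :+ con 1 ⇒ ⊢ 3 :* a :≡ con 1 :+ (15 :* k :+ con 2)) (a ∷ k ∷ []) a≡

  ≤-last : ∀ {j} → j < 3 * a → j ≤ 15 * k + 2
  ≤-last {j} l = ≤-pred (subst (suc j ≤_) 3a≡ l)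

  shape-of : ∀ {j} → j < 3 * a → Shape j (X j) (Y j)
  shape-of {j} l = shape (≤-last l) (posn j)

  X≤c : ∀ {j} → j < 3 * a → X j ≤ c
  X≤c {j} l = ≤-trans (X-bound (≤-last l)) (+-monoʳ-≤ (13 * k) (s≤s z≤n))

  Y≤3 : ∀ {j} → j < 3 * a → Y j ≤ 3
  Y≤3 {j} l = go (shape-of l)
    where
    go : ∀ {x y} → Shape j x y → y ≤ 3
    go (is-cap _ _ refl) = m≤m+n 2 1
    go (is-rung _ _ _ _ _ refl) = m≤m+n 1 2
    go (pre-rung _ _ refl) = m≤m+n 1 2
    go (is-low refl) = z≤n

  locate : ∀ v → v < 6 * a → ∃ λ px → ∃ λ py → Place v px py
  locate v v< = [ (λ a≤v → [ high a≤v , middle a≤v ]′ (≤-<-connex (4 * a) v)) , low ]′ (≤-<-connex a v)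
    where
    low : v < a → _
    low l = c ∸ X (v + 2 * a) , 3 ∸ Y (v + 2 * a) , top (v + 2 * a) l′ (t₂ (m≤n+m (2 * a) v) refl) (m∸n+n≡m (X≤c l′)) (m∸n+n≡m (Y≤3 l′))
      where
      l′ : v + 2 * a < 3 * a
      l′ = +-monoˡ-< (2 * a) l
    middle : a ≤ v → v < 4 * a → _
    middle l h = X (v ∸ a) , Y (v ∸ a) , bottom (v ∸ a)
      (linear 3 (λ a v j → a :+ j :≡ v ⇒ v :< 4 :* a ⇒ ⊢ j :< 3 :* a)
              (a ∷ v ∷ v ∸ a ∷ []) (m+[n∸m]≡n l) h) (sym (m+[n∸m]≡n l)) refl refl
    high : a ≤ v → 4 * a ≤ v → _
    high _ l = c ∸ X (v ∸ 4 * a) , 3 ∸ Y (v ∸ 4 * a) , top (v ∸ 4 * a) h′ (t₁ h (sym (m+[n∸m]≡n l))) (m∸n+n≡m (X≤c h′)) (m∸n+n≡m (Y≤3 h′))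
      where
      h : v ∸ 4 * a < 2 * a
      h = linear 3 (λ a v j → 4 :* a :+ j :≡ v ⇒ v :< 6 :* a ⇒ ⊢ j :< 2 :* a) (a ∷ v ∷ v ∸ 4 * a ∷ []) (m+[n∸m]≡n l) v<
      h′ : v ∸ 4 * a < 3 * a
      h′ = <-trans h 2a<3a

  reflect-near : ∀ {px py px′ py′ x y x′ y′} → px + x ≡ c → py + y ≡ 3 → px′ + x′ ≡ c → py′ + y′ ≡ 3 → Near px py px′ py′ → Near x′ y′ x y
  reflect-near {px} {py} {px′} {py′} {x} {y} {x′} {y′} e f e′ f′ ν =
    near-unshift c 3 (subst₂ (λ u v → Near u v (x + c) (y + 3)) (turn x e) (turn y f)
      (subst₂ (Near (px + (x + x′)) (py + (y + y′))) (trans (cong (px′ +_) (+-comm x x′)) (turn′ {px′} x e′)) (trans (cong (py′ +_) (+-comm y y′)) (turn′ {py′} y f′))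
        (near-shift (x + x′) (y + y′) ν)))
    where
    turn : ∀ {p w s} x → p + x ≡ s → p + (x + w) ≡ w + s
    turn {p} {w} x refl = trans (sym (+-assoc p x w)) (+-comm (p + x) w)
    turn′ : ∀ {p w s} x → p + w ≡ s → p + (w + x) ≡ x + s
    turn′ {p} {w} x refl = trans (sym (+-assoc p w x)) (+-comm (p + w) x)

  cross-sums : ∀ {j j′} → Cross j j′ → Sums (X j + X j′) (Y j + Y j′)
  cross-sums (cap-last refl refl) = east
    (sym (linear 2 (λ k x → x :≡ 13 :* k :+ con 1 ⇒ ⊢ con 1 :+ (con 0 :+ x) :≡ 13 :* k :+ con 2)
            (k ∷ X (15 * k + 2) ∷ []) (proj₁ last-X))) (sym (cong (2 +_) (proj₂ last-X)))
  cross-sums (last-cap refl refl) = east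
    (sym (linear 2 (λ k x → x :≡ 13 :* k :+ con 1 ⇒ ⊢ con 1 :+ (x :+ con 0) :≡ 13 :* k :+ con 2)
            (k ∷ X (15 * k + 2) ∷ []) (proj₁ last-X))) (sym (cong (_+ 2) (proj₂ last-X)))
  cross-sums {j} {j′} (rung-low q q≤ e s) =
    let (x≡ , y≡) = rung-pos (left refl refl) q≤ e (posn j)
        (x′≡ , y′≡) = rung-pos (right refl refl) (m∸n≤m k q)
          (linear 5 (λ k q r j j′ → r :+ q :≡ k ⇒ j :≡ con 1 :+ 5 :* q ⇒ j :+ j′ :≡ 15 :* k :+ con 3 ⇒ ⊢ j′ :≡ 10 :* k :+ con 2 :+ 5 :* r)
                  (k ∷ q ∷ k ∸ q ∷ j ∷ j′ ∷ []) (m∸n+n≡m q≤) e s) (posn j′) in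
    north (sym (linear 5 (λ k q r x x′ → r :+ q :≡ k ⇒ x :≡ con 1 :+ 4 :* q ⇒ x′ :≡ 9 :* k :+ con 1 :+ 4 :* r ⇒ ⊢ x :+ x′ :≡ 13 :* k :+ con 2)
            (k ∷ q ∷ k ∸ q ∷ X j ∷ X j′ ∷ []) (m∸n+n≡m q≤) x≡ x′≡))
      (cong suc (sym (cong₂ _+_ y≡ y′≡)))
  cross-sums {j} {j′} (rung-high q q≤ e s) = subst₂ Sums (+-comm (X j′) (X j)) (+-comm (Y j′) (Y j)) low
    where
    low : Sums (X j′ + X j) (Y j′ + Y j)
    low = cross-sums {j′} {j} (rung-low (k ∸ q) (m∸n≤m k q)
      (linear 5 (λ k q r j j′ → r :+ q :≡ k ⇒ j :≡ 10 :* k :+ con 2 :+ 5 :* q ⇒ j :+ j′ :≡ 15 :* k :+ con 3 ⇒ ⊢ j′ :≡ con 1 :+ 5 :* r)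
              (k ∷ q ∷ k ∸ q ∷ j ∷ j′ ∷ []) (m∸n+n≡m q≤) e s)
      (trans (+-comm j′ j) s))

  bottom-edge : ∀ {u v j j′} → j < 3 * a → j′ < 3 * a → u ≡ a + j → v ≡ a + j′ → Edge< u v → j′ ≡ suc j
  bottom-edge {j = j} {j′} l l′ refl refl (rail e) = +-cancelˡ-≡ a _ _ (trans e (sym (+-suc a j)))
  bottom-edge {j = j} {j′} l l′ refl refl (wrap e _) = ⊥-elim (linear 2 (λ a j → con 1 :≤ a ⇒ a :+ j :≡ con 0 ⇒ ⊢ :⊥)
          (a ∷ j ∷ []) 1≤a e)
  bottom-edge {j = j} {j′} l l′ refl refl (chordL q q≤k e _) = ⊥-elim (linear 4 (λ a k j q → a :≡ 5 :* k :+ con 1 ⇒ q :≤ k ⇒ a :+ j :≡ 5 :* q ⇒ ⊢ :⊥)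
          (a ∷ k ∷ j ∷ q ∷ []) a≡ q≤k e)
  bottom-edge {j = j} {j′} l l′ refl refl (chordR q q≤k e s) = ⊥-elim (linear 5 (λ a k j j′ q → a :≡ 5 :* k :+ con 1 ⇒ q :≤ k ⇒ a :+ j :≡ 3 :* a :+ 5 :* q ⇒ a :+ j :+ (a :+ j′) :≡ 8 :* a ⇒ j′ :< 3 :* a ⇒ ⊢ :⊥)
          (a ∷ k ∷ j ∷ j′ ∷ q ∷ []) a≡ q≤k e s l′)

  top-range : ∀ {v j} → j < 3 * a → TopIndex v j → v < a ⊎ 4 * a ≤ v
  top-range {v} {j} l (t₁ _ refl) = inj₂ (m≤m+n (4 * a) j)
  top-range {v} l (t₂ _ refl) = inj₁ (+-cancelʳ-< (2 * a) v a l)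

  chordL-range : ∀ {u v q} → q ≤ k → u ≡ 5 * q → u + v ≡ 2 * a → u < a × a < v × v ≤ 2 * a
  chordL-range {u} {v} {q} q≤k e s =
    linear 4 (λ a k q u → a :≡ 5 :* k :+ con 1 ⇒ q :≤ k ⇒ u :≡ 5 :* q ⇒ ⊢ u :< a) (a ∷ k ∷ q ∷ u ∷ []) a≡ q≤k e ,
    linear 5 (λ a k q u v → a :≡ 5 :* k :+ con 1 ⇒ q :≤ k ⇒ u :≡ 5 :* q ⇒ u :+ v :≡ 2 :* a ⇒ ⊢ a :< v)
            (a ∷ k ∷ q ∷ u ∷ v ∷ []) a≡ q≤k e s ,
    m+n≤o⇒n≤o u (≤-reflexive s)

  chordR-range : ∀ {u v q} → q ≤ k → u ≡ 3 * a + 5 * q → u + v ≡ 8 * a → 3 * a ≤ u × u < 4 * a × 4 * a < v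
  chordR-range {u} {v} {q} q≤k e s =
    linear 3 (λ a q u → u :≡ 3 :* a :+ 5 :* q ⇒ ⊢ 3 :* a :≤ u) (a ∷ q ∷ u ∷ []) e ,
    linear 4 (λ a k q u → a :≡ 5 :* k :+ con 1 ⇒ q :≤ k ⇒ u :≡ 3 :* a :+ 5 :* q ⇒ ⊢ u :< 4 :* a) (a ∷ k ∷ q ∷ u ∷ []) a≡ q≤k e ,
    linear 5 (λ a k q u v → a :≡ 5 :* k :+ con 1 ⇒ q :≤ k ⇒ u :≡ 3 :* a :+ 5 :* q ⇒ u :+ v :≡ 8 :* a ⇒ ⊢ 4 :* a :< v)
            (a ∷ k ∷ q ∷ u ∷ v ∷ []) a≡ q≤k e s

  top-edge : ∀ {u v j j′} → j < 3 * a → j′ < 3 * a → TopIndex u j → TopIndex v j′ → Edge< u v → j′ ≡ suc j ⊎ j ≡ suc j′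
  top-edge {j = j} l l′ (t₁ _ refl) (t₁ _ refl) (rail e) = inj₁ (+-cancelˡ-≡ (4 * a) _ _ (trans e (sym (+-suc (4 * a) j))))
  top-edge {u} l l′ (t₂ _ refl) (t₂ _ refl) (rail refl) = inj₁ refl
  top-edge {v = v} {j} l l′ (t₁ _ refl) (t₂ _ refl) (rail refl) = ⊥-elim (linear 2 (λ a j → con 1 :+ (4 :* a :+ j) :+ 2 :* a :< 3 :* a ⇒ ⊢ :⊥)
          (a ∷ j ∷ []) l′)
  top-edge {u} {v} {j′ = j′} l l′ (t₂ _ refl) (t₁ _ refl) (rail e) = ⊥-elim (linear 3 (λ a u j → 4 :* a :+ j :≡ con 1 :+ u ⇒ u :+ 2 :* a :< 3 :* a ⇒ con 1 :≤ a ⇒ ⊢ :⊥)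
          (a ∷ u ∷ j′ ∷ []) e l 1≤a)
  top-edge {j = j} l l′ (t₁ _ refl) _ (wrap e _) = ⊥-elim (linear 2 (λ a j → con 1 :≤ a ⇒ 4 :* a :+ j :≡ con 0 ⇒ ⊢ :⊥)
          (a ∷ j ∷ []) 1≤a e)
  top-edge {j′ = j′} l l′ (t₂ _ refl) (t₁ _ refl) (wrap refl e) = inj₂ (linear 2 (λ a j → con 1 :+ (4 :* a :+ j) :≡ 6 :* a ⇒ ⊢ con 0 :+ 2 :* a :≡ con 1 :+ j)
          (a ∷ j′ ∷ []) e)
  top-edge {v = v} l l′ (t₂ _ refl) (t₂ _ refl) (wrap _ e) = ⊥-elim (linear 2 (λ a v → con 1 :≤ a ⇒ v :+ 2 :* a :< 3 :* a ⇒ con 1 :+ v :≡ 6 :* a ⇒ ⊢ :⊥)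
          (a ∷ v ∷ []) 1≤a l′ e)
  top-edge {v = v} l l′ _ t (chordL q q≤k e s) = ⊥-elim (let (_ , p , r) = chordL-range q≤k e s in [ (λ h → <-asym h p) , (λ h → linear 2 (λ a v → con 1 :≤ a ⇒ 4 :* a :≤ v ⇒ v :≤ 2 :* a ⇒ ⊢ :⊥) (a ∷ v ∷ []) 1≤a h r) ]′ (top-range l′ t))
  top-edge {u} l l′ t _ (chordR q q≤k e s) = ⊥-elim (let (p , r , _) = chordR-range q≤k e s in [ (λ h → linear 2 (λ a u → u :< a ⇒ 3 :* a :≤ u ⇒ ⊢ :⊥) (a ∷ u ∷ []) h p) , (λ h → <⇒≱ r h) ]′ (top-range l t))

  last-index : ∀ {j} → suc j ≡ 3 * a → j ≡ 15 * k + 2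
  last-index e = suc-injective (trans e 3a≡)

  bottom-top-edge : ∀ {u v j j′} → j < 3 * a → j′ < 3 * a → u ≡ a + j → TopIndex v j′ → Edge< u v → Cross j j′
  bottom-top-edge {j = j} {j′} l l′ refl (t₁ _ refl) (rail e) = last-cap (last-index (linear 3 (λ a j j′ → j :< 3 :* a ⇒ 4 :* a :+ j′ :≡ con 1 :+ (a :+ j) ⇒ ⊢ con 1 :+ j :≡ 3 :* a)
          (a ∷ j ∷ j′ ∷ []) l e))
    (linear 3 (λ a j j′ → j :< 3 :* a ⇒ 4 :* a :+ j′ :≡ con 1 :+ (a :+ j) ⇒ ⊢ j′ :≡ con 0) (a ∷ j ∷ j′ ∷ []) l e)
  bottom-top-edge {j = j} l l′ refl (t₂ _ refl) (rail refl) = ⊥-elim (linear 2 (λ a j → con 1 :+ (a :+ j) :+ 2 :* a :< 3 :* a ⇒ ⊢ :⊥)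
          (a ∷ j ∷ []) l′)
  bottom-top-edge {j = j} l l′ refl _ (wrap e _) = ⊥-elim (linear 2 (λ a j → con 1 :≤ a ⇒ a :+ j :≡ con 0 ⇒ ⊢ :⊥)
          (a ∷ j ∷ []) 1≤a e)
  bottom-top-edge {j = j} l l′ refl _ (chordL q q≤k e s) = ⊥-elim (<⇒≱ (proj₁ (chordL-range q≤k e s)) (m≤m+n a j))
  bottom-top-edge {j = j} {j′} l l′ refl (t₁ _ refl) (chordR q q≤k e s) = rung-high q q≤k
    (linear 4 (λ a k j q → a :≡ 5 :* k :+ con 1 ⇒ a :+ j :≡ 3 :* a :+ 5 :* q ⇒ ⊢ j :≡ 10 :* k :+ con 2 :+ 5 :* q)
            (a ∷ k ∷ j ∷ q ∷ []) a≡ e)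
    (linear 4 (λ a k j j′ → a :≡ 5 :* k :+ con 1 ⇒ a :+ j :+ (4 :* a :+ j′) :≡ 8 :* a ⇒ ⊢ j :+ j′ :≡ 15 :* k :+ con 3)
            (a ∷ k ∷ j ∷ j′ ∷ []) a≡ s)
  bottom-top-edge {v = v} l l′ refl (t₂ _ refl) (chordR q q≤k e s) = ⊥-elim (let (_ , _ , h) = chordR-range q≤k e s in linear 2 (λ a v → v :+ 2 :* a :< 3 :* a ⇒ 4 :* a :< v ⇒ ⊢ :⊥) (a ∷ v ∷ []) l′ h)

  top-bottom-edge : ∀ {u v j j′} → j < 3 * a → j′ < 3 * a → TopIndex u j → v ≡ a + j′ → Edge< u v → Cross j′ j
  top-bottom-edge {u} {j′ = j′} l l′ (t₂ _ refl) refl (rail e) = cap-last (linear 3 (λ a u j → u :+ 2 :* a :< 3 :* a ⇒ a :+ j :≡ con 1 :+ u ⇒ ⊢ j :≡ con 0)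
          (a ∷ u ∷ j′ ∷ []) l e)
    (last-index (linear 3 (λ a u j → u :+ 2 :* a :< 3 :* a ⇒ a :+ j :≡ con 1 :+ u ⇒ ⊢ con 1 :+ (u :+ 2 :* a) :≡ 3 :* a)
            (a ∷ u ∷ j′ ∷ []) l e))
  top-bottom-edge {j = j} {j′} l l′ (t₁ _ refl) refl (rail e) = ⊥-elim (linear 3 (λ a j j′ → j′ :< 3 :* a ⇒ a :+ j′ :≡ con 1 :+ (4 :* a :+ j) ⇒ ⊢ :⊥)
          (a ∷ j ∷ j′ ∷ []) l′ e)
  top-bottom-edge {j′ = j′} l l′ _ refl (wrap _ e) = ⊥-elim (linear 2 (λ a j → con 1 :≤ a ⇒ j :< 3 :* a ⇒ con 1 :+ (a :+ j) :≡ 6 :* a ⇒ ⊢ :⊥)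
          (a ∷ j′ ∷ []) 1≤a l′ e)
  top-bottom-edge {u} {j′ = j′} l l′ (t₂ _ refl) refl (chordL q q≤k e s) = rung-low (k ∸ q) (m∸n≤m k q)
    (linear 6 (λ a k q r u j → a :≡ 5 :* k :+ con 1 ⇒ r :+ q :≡ k ⇒ u :≡ 5 :* q ⇒ u :+ (a :+ j) :≡ 2 :* a ⇒ ⊢ j :≡ con 1 :+ 5 :* r)
            (a ∷ k ∷ q ∷ k ∸ q ∷ u ∷ j′ ∷ []) a≡ (m∸n+n≡m q≤k) e s)
    (linear 4 (λ a k u j → a :≡ 5 :* k :+ con 1 ⇒ u :+ (a :+ j) :≡ 2 :* a ⇒ ⊢ j :+ (u :+ 2 :* a) :≡ 15 :* k :+ con 3)
            (a ∷ k ∷ u ∷ j′ ∷ []) a≡ s)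
  top-bottom-edge {j = j} l l′ (t₁ _ refl) refl (chordL q q≤k e s) = ⊥-elim (let (h , _) = chordL-range q≤k e s in linear 2 (λ a j → 4 :* a :+ j :< a ⇒ ⊢ :⊥) (a ∷ j ∷ []) h)
  top-bottom-edge {u} l l′ t refl (chordR q q≤k e s) = ⊥-elim (let (p , r , _) = chordR-range q≤k e s in [ (λ h → linear 2 (λ a u → u :< a ⇒ 3 :* a :≤ u ⇒ ⊢ :⊥) (a ∷ u ∷ []) h p) , (λ h → <⇒≱ r h) ]′ (top-range l t))

  edge⇒near : ∀ {u v px py px′ py′} → Place u px py → Place v px′ py′ → Edge< u v → Near px py px′ py′
  edge⇒near (bottom j l e refl refl) (bottom j′ l′ e′ refl refl) uv with bottom-edge l l′ e e′ uv
  ... | refl = rail-near j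
  edge⇒near (top j l t ex ey) (top j′ l′ t′ ex′ ey′) uv with top-edge l l′ t t′ uv
  ... | inj₁ refl = near-sym (reflect-near (trans (+-comm (X j) _) ex) (trans (+-comm (Y j) _) ey) (trans (+-comm (X j′) _) ex′) (trans (+-comm (Y j′) _) ey′) (rail-near j))
  ... | inj₂ refl = reflect-near (trans (+-comm (X j′) _) ex′) (trans (+-comm (Y j′) _) ey′) (trans (+-comm (X j) _) ex) (trans (+-comm (Y j) _) ey) (rail-near j′)
  edge⇒near (bottom j l e refl refl) (top j′ l′ t′ ex′ ey′) uv = sums-near ex′ ey′ (cross-sums (bottom-top-edge l l′ e t′ uv))
  edge⇒near (top j l t ex ey) (bottom j′ l′ e′ refl refl) uv = near-sym (sums-near ex ey (cross-sums (top-bottom-edge l l′ t e′ uv)))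

  top-adj : ∀ {u v j} → suc j < 3 * a → TopIndex u j → TopIndex v (suc j) → Adj u v
  top-adj {j = j} l (t₁ _ refl) (t₁ _ refl) = inj₁ (rail (+-suc (4 * a) j))
  -- Index `2 * a` on the top rail is vertex 0; here the rail passes over the wrap edge.
  top-adj {v = v} {j} l (t₁ h refl) (t₂ h′ e) = inj₂ (wrap (linear 3 (λ a v j → j :< 2 :* a ⇒ v :+ 2 :* a :≡ con 1 :+ j ⇒ ⊢ v :≡ con 0)
          (a ∷ v ∷ j ∷ []) h e)
    (linear 2 (λ a j → j :< 2 :* a ⇒ 2 :* a :≤ con 1 :+ j ⇒ ⊢ con 1 :+ (4 :* a :+ j) :≡ 6 :* a) (a ∷ j ∷ []) h h′))
  top-adj {j = j} l (t₂ h refl) (t₁ h′ _) = ⊥-elim (<⇒≱ h′ (≤-trans h (n≤1+n _)))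
  top-adj {u} {v} l (t₂ _ refl) (t₂ _ e) = inj₁ (rail (+-cancelʳ-≡ (2 * a) v (suc u) e))

  cross-adj : ∀ {u v j j′} → u ≡ a + j → TopIndex v j′ → Cross j j′ → Adj u v
  cross-adj {v = v} refl (t₂ _ e) (cap-last refl refl) = inj₂ (rail (linear 3 (λ a k v → a :≡ 5 :* k :+ con 1 ⇒ v :+ 2 :* a :≡ 15 :* k :+ con 2 ⇒ ⊢ a :+ con 0 :≡ con 1 :+ v)
          (a ∷ k ∷ v ∷ []) a≡ e))
  cross-adj refl (t₁ h _) (cap-last refl refl) = ⊥-elim (linear 2 (λ a k → a :≡ 5 :* k :+ con 1 ⇒ con 1 :≤ k ⇒ 15 :* k :+ con 2 :< 2 :* a ⇒ ⊢ :⊥)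
          (a ∷ k ∷ []) a≡ 1≤k h)
  cross-adj refl (t₁ _ refl) (last-cap refl refl) = inj₁ (rail (linear 2 (λ a k → a :≡ 5 :* k :+ con 1 ⇒ ⊢ 4 :* a :+ con 0 :≡ con 1 :+ (a :+ (15 :* k :+ con 2)))
          (a ∷ k ∷ []) a≡))
  cross-adj refl (t₂ h _) (last-cap refl refl) = ⊥-elim (linear 1 (λ a → con 1 :≤ a ⇒ 2 :* a :≤ con 0 ⇒ ⊢ :⊥) (a ∷ []) 1≤a h)
  cross-adj {v = v} {j} {j′} refl (t₂ _ e) (rung-low q q≤k e′ s) = inj₂ (chordL (k ∸ q) (m∸n≤m k q)
    (linear 7 (λ a k q r v j j′ → a :≡ 5 :* k :+ con 1 ⇒ r :+ q :≡ k ⇒ v :+ 2 :* a :≡ j′ ⇒ j :≡ con 1 :+ 5 :* q ⇒ j :+ j′ :≡ 15 :* k :+ con 3 ⇒ ⊢ v :≡ 5 :* r)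
            (a ∷ k ∷ q ∷ k ∸ q ∷ v ∷ j ∷ j′ ∷ []) a≡ (m∸n+n≡m q≤k) e e′ s)
    (linear 5 (λ a k v j j′ → a :≡ 5 :* k :+ con 1 ⇒ v :+ 2 :* a :≡ j′ ⇒ j :+ j′ :≡ 15 :* k :+ con 3 ⇒ ⊢ v :+ (a :+ j) :≡ 2 :* a)
            (a ∷ k ∷ v ∷ j ∷ j′ ∷ []) a≡ e s))
  cross-adj {j = j} {j′} refl (t₁ h _) (rung-low q q≤k e s) = ⊥-elim (linear 5 (λ a k q j j′ → a :≡ 5 :* k :+ con 1 ⇒ q :≤ k ⇒ j′ :< 2 :* a ⇒ j :≡ con 1 :+ 5 :* q ⇒ j :+ j′ :≡ 15 :* k :+ con 3 ⇒ ⊢ :⊥)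
          (a ∷ k ∷ q ∷ j ∷ j′ ∷ []) a≡ q≤k h e s)
  cross-adj {j = j} {j′} refl (t₁ _ refl) (rung-high q q≤k e s) = inj₁ (chordR q q≤k
    (linear 4 (λ a k q j → a :≡ 5 :* k :+ con 1 ⇒ j :≡ 10 :* k :+ con 2 :+ 5 :* q ⇒ ⊢ a :+ j :≡ 3 :* a :+ 5 :* q)
            (a ∷ k ∷ q ∷ j ∷ []) a≡ e)
    (linear 4 (λ a k j j′ → a :≡ 5 :* k :+ con 1 ⇒ j :+ j′ :≡ 15 :* k :+ con 3 ⇒ ⊢ a :+ j :+ (4 :* a :+ j′) :≡ 8 :* a)
            (a ∷ k ∷ j ∷ j′ ∷ []) a≡ s))
  cross-adj {j = j} {j′} refl (t₂ h _) (rung-high q q≤k e s) = ⊥-elim (linear 5 (λ a k q j j′ → a :≡ 5 :* k :+ con 1 ⇒ con 1 :≤ k ⇒ 2 :* a :≤ j′ ⇒ j :≡ 10 :* k :+ con 2 :+ 5 :* q ⇒ j :+ j′ :≡ 15 :* k :+ con 3 ⇒ ⊢ :⊥)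
          (a ∷ k ∷ q ∷ j ∷ j′ ∷ []) a≡ 1≤k h e s)

  near⇒adj : ∀ {u v px py px′ py′} → Place u px py → Place v px′ py′ → Near px py px′ py′ → Adj u v
  near⇒adj (bottom j l e refl refl) (bottom j′ l′ e′ refl refl) ν =
    [ (λ s → inj₁ (rail (trans e′ (trans (cong (a +_) s) (trans (+-suc a j) (cong suc (sym e)))))))
    , (λ s → inj₂ (rail (trans e (trans (cong (a +_) s) (trans (+-suc a j′) (cong suc (sym e′))))))) ]′ (same-rail j j′ ν)
  near⇒adj (top j l t ex ey) (top j′ l′ t′ ex′ ey′) ν with same-rail j′ j (reflect-near ex ey ex′ ey′ ν)
  ... | inj₁ refl = swap (top-adj l t′ t)
  ... | inj₂ refl = top-adj l′ t t′
  near⇒adj (bottom j l e refl refl) (top j′ l′ t′ ex′ ey′) ν = cross-adj e t′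
    (crossing (shape-of l) (shape-of l′) (X-bound (≤-last l)) (X-bound (≤-last l′)) (near-sums ex′ ey′ ν))
  near⇒adj (top j l t ex ey) (bottom j′ l′ e′ refl refl) ν = swap (cross-adj e′ t
    (crossing (shape-of l′) (shape-of l) (X-bound (≤-last l′)) (X-bound (≤-last l)) (near-sums ex ey (near-sym ν))))

  -- Without a cap the ordinates add up to at most 2. A cap has abscissa 0 and could only meet
  -- abscissa `c`, which is beyond the end of the rail.
  rails-disjoint : ∀ {j j′ x y x′ y′} → Shape j x y → Shape j′ x′ y′ → x ≤ 13 * k + 1 → x′ ≤ 13 * k + 1 → x + x′ ≡ c → y + y′ ≢ 3
  rails-disjoint (is-cap _ refl _) _ _ b e _ = bound-clash 0 b e
  rails-disjoint {x = x} _ (is-cap _ refl _) b _ e _ = bound-clash 0 b (trans (sym (+-identityʳ x)) e)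
  rails-disjoint (is-rung _ _ _ _ _ refl) (is-rung _ _ _ _ _ refl) _ _ _ ()
  rails-disjoint (is-rung _ _ _ _ _ refl) (pre-rung _ _ refl) _ _ _ ()
  rails-disjoint (is-rung _ _ _ _ _ refl) (is-low refl) _ _ _ ()
  rails-disjoint (pre-rung _ _ refl) (is-rung _ _ _ _ _ refl) _ _ _ ()
  rails-disjoint (pre-rung _ _ refl) (pre-rung _ _ refl) _ _ _ ()
  rails-disjoint (pre-rung _ _ refl) (is-low refl) _ _ _ ()
  rails-disjoint (is-low refl) (is-rung _ _ _ _ _ refl) _ _ _ ()
  rails-disjoint (is-low refl) (pre-rung _ _ refl) _ _ _ ()
  rails-disjoint (is-low refl) (is-low refl) _ _ _ ()

  top-unique : ∀ {u v j} → TopIndex u j → TopIndex v j → u ≡ v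
  top-unique (t₁ _ refl) (t₁ _ refl) = refl
  top-unique (t₁ h _) (t₂ h′ _) = ⊥-elim (<⇒≱ h h′)
  top-unique (t₂ h′ _) (t₁ h _) = ⊥-elim (<⇒≱ h h′)
  top-unique {u} {v} (t₂ _ e) (t₂ _ e′) = +-cancelʳ-≡ (2 * a) u v (trans e (sym e′))

  place-injective : ∀ {u v px py} → Place u px py → Place v px py → u ≡ v
  place-injective (bottom j _ e p q) (bottom j′ _ e′ p′ q′)
    with height-injective {j} {j′} (cong₂ (λ x y → 3 * x + y) (trans (sym p) p′) (trans (sym q) q′))
  ... | refl = trans e (sym e′)
  place-injective {px = px} {py} (top j _ t p q) (top j′ _ t′ p′ q′)
    with height-injective {j} {j′} (cong₂ (λ x y → 3 * x + y) (+-cancelˡ-≡ px _ _ (trans p (sym p′))) (+-cancelˡ-≡ py _ _ (trans q (sym q′))))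
  ... | refl = top-unique t t′
  place-injective (bottom j l _ refl refl) (top j′ l′ _ p q) =
    ⊥-elim (rails-disjoint (shape-of l) (shape-of l′) (X-bound (≤-last l)) (X-bound (≤-last l′)) p q)
  place-injective (top j l _ p q) (bottom j′ l′ _ refl refl) =
    ⊥-elim (rails-disjoint (shape-of l′) (shape-of l) (X-bound (≤-last l′)) (X-bound (≤-last l)) p q)

-- Exponential growth

^-split : ∀ b e r J → b ^ (e * J + r) ≡ (b ^ e) ^ J * b ^ r
^-split b e r J = trans (^-distribˡ-+-* b (e * J) r) (cong (_* b ^ r) (sym (^-*-assoc b e J)))

^-distrib-* : ∀ x y J → (x * y) ^ J ≡ x ^ J * y ^ J
^-distrib-* x y zero    = refl
^-distrib-* x y (suc J) = trans (cong (x * y *_) (^-distrib-* x y J)) ([m*n]*[o*p]≡[m*o]*[n*p] x y (x ^ J) (y ^ J))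

-- The pure rearrangement, with the large powers as indeterminates: `light` bounds the balanced
-- weight `w`, `heavy` the other weight `y` from below, `geo` compares the growth per unit of `J`,
-- and its spare factor `q` pays in `poly` for everything subexponential.
compare : ∀ a b c d e f s v z q w y P .{{_ : NonZero (s * f)}} → w * (s * f) ≤ P * (v * e) → z ≤ 1000 * y →
          1000 * c * e * P ≤ d * f * q → a * v * q ≤ b * s * z → a * c * w ≤ b * d * y
compare a b c d e f s v z q w y P light heavy poly geo =
  *-cancelʳ-≤ (a * c * w) (b * d * y) (s * f) (*-cancelˡ-≤ 1000 (begin
    1000 * (a * c * w * (s * f))     ≡⟨ e₁ a c w s f ⟩
    1000 * (a * c) * (w * (s * f))   ≤⟨ *-monoʳ-≤ (1000 * (a * c)) light ⟩
    1000 * (a * c) * (P * (v * e))   ≡⟨ e₂ a c P v e ⟩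
    a * v * (1000 * c * e * P)       ≤⟨ *-monoʳ-≤ (a * v) poly ⟩
    a * v * (d * f * q)              ≡⟨ e₃ (a * v) d f q ⟩
    a * v * q * (d * f)              ≤⟨ *-monoˡ-≤ (d * f) geo ⟩
    b * s * z * (d * f)              ≤⟨ *-monoˡ-≤ (d * f) (*-monoʳ-≤ (b * s) heavy) ⟩
    b * s * (1000 * y) * (d * f)     ≡⟨ e₄ b s y d f ⟩
    1000 * (b * d * y * (s * f))     ∎))
  where
  open ≤-Reasoning
  e₁ : ∀ a c w s f → 1000 * (a * c * w * (s * f)) ≡ 1000 * (a * c) * (w * (s * f))
  e₁ = solve-∀
  e₂ : ∀ a c P v e → 1000 * (a * c) * (P * (v * e)) ≡ a * v * (1000 * c * e * P)
  e₂ = solve-∀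
  e₃ : ∀ x d f q → x * (d * f * q) ≡ x * q * (d * f)
  e₃ = solve-∀
  e₄ : ∀ b s y d f → b * s * (1000 * y) * (d * f) ≡ 1000 * (b * d * y * (s * f))
  e₄ = solve-∀

n<2^n : ∀ n → n < 2 ^ n
n<2^n zero    = s≤s z≤n
n<2^n (suc n) = linear 2 (λ n p → n :< p ⇒ ⊢ con 1 :+ n :< p :+ (p :+ con 0)) (n ∷ 2 ^ n ∷ []) (n<2^n n)

-- Growth per unit of J: the trees of the near-balanced partitions against the binomial bound for the balanced ones,
-- with room for the factor (161/160)^160 and for 4.
growth : 161 ^ 160 * 31 ^ 496 * 4 ≤ 160 ^ 160 * 30 ^ 480 * 10 ^ 32
growth = ≤ᵇ⇒≤ _ _ tt

growth^ : ∀ J → (161 ^ 160) ^ J * (31 ^ 496) ^ J * 4 ^ J ≤ (160 ^ 160) ^ J * (30 ^ 480) ^ J * (10 ^ 32) ^ J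
growth^ J = power (161 ^ 160) (31 ^ 496) 4 (160 ^ 160) (30 ^ 480) (10 ^ 32) growth
  where
  power : ∀ u v w u′ v′ w′ → u * v * w ≤ u′ * v′ * w′ → u ^ J * v ^ J * w ^ J ≤ u′ ^ J * v′ ^ J * w′ ^ J
  power u v w u′ v′ w′ h = subst₂ _≤_ (expand u v w) (expand u′ v′ w′) (^-monoˡ-≤ J h)
    where
    expand : ∀ u v w → (u * v * w) ^ J ≡ u ^ J * v ^ J * w ^ J
    expand u v w = trans (^-distrib-* (u * v) w J) (cong (_* w ^ J) (^-distrib-* u v J))

-- The small powers are what the exponents leave beyond their multiples of `J`; 4401 is `27 * 163`,
-- and 43 is the least exponent of 2 that suffices.
constants : 1000 * 161 ^ 2 * 31 ^ 7 * 4401 ≤ 160 ^ 2 * 30 ^ 3 * 2 ^ 43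
constants = ≤ᵇ⇒≤ _ _ tt

-- Of `4 ^ J` one factor `2 ^ J` outgrows the linear number of arc codes and the other one the
-- constants.
polynomial : ∀ J → 43 ≤ J → 1000 * 161 ^ 2 * 31 ^ 7 * (27 * (160 * J + 3)) ≤ 160 ^ 2 * 30 ^ 3 * 4 ^ J
polynomial J 43≤J = absorb (1000 * 161 ^ 2 * 31 ^ 7) (160 ^ 2 * 30 ^ 3) (27 * (160 * J + 3)) (2 ^ J) (4 ^ J)
  (linear 2 (λ J p → J :< p ⇒ ⊢ 27 :* (160 :* J :+ con 3) :≤ 4401 :* p) (J ∷ 2 ^ J ∷ []) (n<2^n J))
  (≤-trans constants (*-monoʳ-≤ (160 ^ 2 * 30 ^ 3) (^-monoʳ-≤ 2 43≤J)))
  (^-distrib-* 2 2 J)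
  where
  absorb : ∀ C D P p q → P ≤ 4401 * p → C * 4401 ≤ D * p → q ≡ p * p → C * P ≤ D * q
  absorb C D P p q h h′ refl = begin
    C * P          ≤⟨ *-monoʳ-≤ C h ⟩
    C * (4401 * p) ≡⟨ sym (*-assoc C 4401 p) ⟩
    C * 4401 * p   ≤⟨ *-monoˡ-≤ p h′ ⟩
    D * p * p      ≡⟨ *-assoc D p p ⟩
    D * (p * p)    ∎
    where open ≤-Reasoning

exponential-gap : ∀ J w₀ w₁ → 43 ≤ J → w₀ * 30 ^ (480 * J + 3) ≤ 27 * (160 * J + 3) * 31 ^ (496 * J + 7) →
                  10 ^ (32 * J) ≤ 1000 * w₁ → 161 ^ (160 * J + 2) * w₀ ≤ 160 ^ (160 * J + 2) * w₁
exponential-gap J w₀ w₁ 43≤J light heavy = subst₂ (λ x y → x * w₀ ≤ y * w₁) (sym (^-split 161 160 2 J)) (sym (^-split 160 160 2 J))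
  (compare ((161 ^ 160) ^ J) ((160 ^ 160) ^ J) (161 ^ 2) (160 ^ 2) (31 ^ 7) (30 ^ 3) ((30 ^ 480) ^ J) ((31 ^ 496) ^ J)
    ((10 ^ 32) ^ J) (4 ^ J) w₀ w₁ (27 * (160 * J + 3)) {{subst NonZero (^-split 30 480 3 J) (m^n≢0 30 (480 * J + 3))}}
    (subst₂ (λ x y → w₀ * x ≤ 27 * (160 * J + 3) * y) (^-split 30 480 3 J) (^-split 31 496 7 J) light)
    (subst (_≤ 1000 * w₁) (sym (^-*-assoc 10 32 J)) heavy) (polynomial J 43≤J) (growth^ J))

-- Integer coordinates, the members of the family and the theorem

open import Data.Integer using (+_; -[1+_]; _-_; _⊖_)

⊖≡+ : ∀ m n d → m ⊖ n ≡ + d → m ≡ d + n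
⊖≡+ m       zero    d e = trans (ℤ.+-injective e) (sym (+-identityʳ d))
⊖≡+ zero    (suc n) d ()
⊖≡+ (suc m) (suc n) d e = trans (cong suc (⊖≡+ m n d (trans (sym (ℤ.[1+m]⊖[1+n]≡m⊖n m n)) e))) (sym (+-suc d n))

⊖≡-1 : ∀ m n → m ⊖ n ≡ -[1+ 0 ] → n ≡ 1 + m
⊖≡-1 m       zero          ()
⊖≡-1 zero    (suc zero)    e = refl
⊖≡-1 zero    (suc (suc n)) ()
⊖≡-1 (suc m) (suc n)       e = cong suc (⊖≡-1 m n (trans (sym (ℤ.[1+m]⊖[1+n]≡m⊖n m n)) e))

1+n⊖n : ∀ n → suc n ⊖ n ≡ + 1
1+n⊖n zero    = refl
1+n⊖n (suc n) = trans (ℤ.[1+m]⊖[1+n]≡m⊖n (suc n) n) (1+n⊖n n)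

n⊖1+n : ∀ n → n ⊖ suc n ≡ -[1+ 0 ]
n⊖1+n zero    = refl
n⊖1+n (suc n) = trans (ℤ.[1+m]⊖[1+n]≡m⊖n n (suc n)) (n⊖1+n n)

module _ {m n : ℕ} where

  diff-0 : + m - + n ≡ + 0 ⇔ m ≡ n
  diff-0 = mk⇔ (λ e → ⊖≡+ m n 0 (trans (sym (ℤ.m-n≡m⊖n m n)) e)) λ { refl → trans (ℤ.m-n≡m⊖n m m) (ℤ.n⊖n≡0 m) }

  diff-1 : + m - + n ≡ + 1 ⇔ m ≡ 1 + n
  diff-1 = mk⇔ (λ e → ⊖≡+ m n 1 (trans (sym (ℤ.m-n≡m⊖n m n)) e)) λ { refl → trans (ℤ.m-n≡m⊖n m n) (1+n⊖n n) }

  diff-neg : + m - + n ≡ -[1+ 0 ] ⇔ n ≡ 1 + m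
  diff-neg = mk⇔ (λ e → ⊖≡-1 m n (trans (sym (ℤ.m-n≡m⊖n m n)) e)) λ { refl → trans (ℤ.m-n≡m⊖n m n) (n⊖1+n m) }

module Member (J : ℕ) (1≤J : 1 ≤ J) where

  -- A multiple of 4 suits the embedding. With 16 the parts have `160 * J + 2` vertices, so a unit
  -- of `J` multiplies the power of 161/160 by less than e, well within the gap of about 20 between
  -- the two weights.
  k = 16 * J
  a = 5 * k + 1
  κ = 4 * J
  n = 16 * J ∸ 1

  16J : ∃ λ r → 16 * J ≡ 2 + r
  16J = 16 * J ∸ 2 , sym (m+[n∸m]≡n (linear 1 (λ J → con 1 :≤ J ⇒ ⊢ con 2 :≤ 16 :* J) (J ∷ []) 1≤J))

  k≡4κ : k ≡ 4 * κ
  k≡4κ = linear 1 (λ J → ⊢ 16 :* J :≡ 4 :* (4 :* J)) (J ∷ [])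

  1≤k : 1 ≤ k
  1≤k = ≤-trans 1≤J (m≤m+n J _)

  k≡1+n : k ≡ suc n
  k≡1+n = sym (m+[n∸m]≡n 1≤k)

  private
    module E = Edges k a refl
    module Geo = Geometry κ k a k≡4κ 1≤k refl

  module _ (m : ℕ) (m≡ : m ≡ 6 * a) where

    private
      module B = Balance k a refl m m≡
      module U = Upper k a refl m m≡
      module P = Paths k a refl m m≡
      module H = Heavy n k a k≡1+n refl m m≡
    open B using (G; toℕ<6a)

    hamiltonian : Hamiltonian G
    hamiltonian = id , id , (λ i j e → E.adj-true (inj₁ (E.rail e))) ,
      λ i j i≡0 e → E.adj-true (inj₂ (E.wrap i≡0 (trans e m≡)))

    private
      px py : Fin m → ℕ
      px v = proj₁ (Geo.locate (toℕ v) (toℕ<6a v))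
      py v = proj₁ (proj₂ (Geo.locate (toℕ v) (toℕ<6a v)))

      place : ∀ v → Geo.Place (toℕ v) (px v) (py v)
      place v = proj₂ (proj₂ (Geo.locate (toℕ v) (toℕ<6a v)))

    open Function.Equivalence using (to; from)

    near⇔tri : ∀ {x y x′ y′} → Geo.Near x y x′ y′ ⇔ TriAdj (+ x , + y) (+ x′ , + y′)
    near⇔tri = mk⇔ near⇒tri tri⇒near
      where
      near⇒tri : ∀ {x y x′ y′} → Geo.Near x y x′ y′ → TriAdj (+ x , + y) (+ x′ , + y′)
      near⇒tri (Geo.east e f)       = inj₁ (from diff-1 e , from diff-0 f)
      near⇒tri (Geo.west e f)       = inj₂ (inj₁ (from diff-neg e , from diff-0 f))
      near⇒tri (Geo.north e f)      = inj₂ (inj₂ (inj₁ (from diff-0 e , from diff-1 f)))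
      near⇒tri (Geo.south e f)      = inj₂ (inj₂ (inj₂ (inj₁ (from diff-0 e , from diff-neg f))))
      near⇒tri (Geo.south-east e f) = inj₂ (inj₂ (inj₂ (inj₂ (inj₁ (from diff-1 e , from diff-neg f)))))
      near⇒tri (Geo.north-west e f) = inj₂ (inj₂ (inj₂ (inj₂ (inj₂ (from diff-neg e , from diff-1 f)))))
      tri⇒near : ∀ {x y x′ y′} → TriAdj (+ x , + y) (+ x′ , + y′) → Geo.Near x y x′ y′
      tri⇒near (inj₁ (e , f))                             = Geo.east (to diff-1 e) (to diff-0 f)
      tri⇒near (inj₂ (inj₁ (e , f)))                      = Geo.west (to diff-neg e) (to diff-0 f)
      tri⇒near (inj₂ (inj₂ (inj₁ (e , f))))               = Geo.north (to diff-0 e) (to diff-1 f)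
      tri⇒near (inj₂ (inj₂ (inj₂ (inj₁ (e , f)))))        = Geo.south (to diff-0 e) (to diff-neg f)
      tri⇒near (inj₂ (inj₂ (inj₂ (inj₂ (inj₁ (e , f)))))) = Geo.south-east (to diff-1 e) (to diff-neg f)
      tri⇒near (inj₂ (inj₂ (inj₂ (inj₂ (inj₂ (e , f)))))) = Geo.north-west (to diff-neg e) (to diff-1 f)

    triangular : TriangularInduced G
    triangular = (λ v → + px v , + py v) , injective , λ u v → mk⇔
      (λ e → to near⇔tri ([ Geo.edge⇒near (place u) (place v) , (λ vu → Geo.near-sym (Geo.edge⇒near (place v) (place u) vu)) ]′ (E.adj-sound e)))
      (λ t → E.adj-true (Geo.near⇒adj (place u) (place v) (from near⇔tri t)))
      where
      injective : ∀ {u v} → (+ px u , + py u) ≡ (+ px v , + py v) → u ≡ v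
      injective {u} {v} e = Fin.toℕ-injective (Geo.place-injective (place u)
        (subst₂ (Geo.Place (toℕ v)) (sym (ℤ.+-injective (cong proj₁ e))) (sym (ℤ.+-injective (cong proj₂ e))) (place v)))

    disconnected : ReComDisconnected G (2 * a)
    disconnected = f , g , P.arc-balanced a E.1≤a (m≤m+n a _) , P.arc-balanced (2 * a) 1≤2a ≤-refl , λ s → not-top (B.top-star s is-top)
      where
      1≤2a = ≤-trans E.1≤a (m≤m+n a _)
      f g : Labeling m
      -- For `p = a` the part of 0 runs from `5 * a` around to `a ∸ 1`, so it contains `5 * a`. For
      -- `p = 2 * a` it ends up on one side of 0 only, and the second part contains both `2 * a` and
      -- `3 * a`.
      f = U.arcLabeling (i0 , i1 , i2 , a)
      g = U.arcLabeling (i0 , i1 , i2 , 2 * a)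
      at : ∀ c {i} (i< : i < 6 * a) → B.extend (U.arcLabeling c) i ≡ U.arcColour c i
      at c i< = trans (B.extend-vertex (U.arcLabeling c) i<) (cong (U.arcColour c) (B.toℕ-vertex i<))
      first : ∀ p → 1 ≤ p → U.arcColour (i0 , i1 , i2 , p) 0 ≡ i0
      first p 1≤p with 0 <? p
      ... | yes _ = refl
      ... | no g  = ⊥-elim (g 1≤p)
      last : U.arcColour (i0 , i1 , i2 , a) (5 * a) ≡ i0
      last with 5 * a <? a | 5 * a <? a + 2 * a | 5 * a <? a + 4 * a
      ... | yes _ | _ | _ = refl
      ... | no _ | yes l | _ = ⊥-elim (<⇒≱ l (*-monoˡ-≤ a {3} {5} (s≤s (s≤s (s≤s z≤n)))))
      ... | no _ | no _ | yes l = ⊥-elim (<-irrefl refl l)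
      ... | no _ | no _ | no _ = refl
      last′ : U.arcColour (i0 , i1 , i2 , 2 * a) (5 * a) ≡ i2
      last′ with 5 * a <? 2 * a | 5 * a <? 2 * a + 2 * a | 5 * a <? 2 * a + 4 * a
      ... | yes l | _ | _ = ⊥-elim (<⇒≱ l (*-monoˡ-≤ a {2} {5} (s≤s (s≤s z≤n))))
      ... | no _ | yes l | _ = ⊥-elim (<⇒≱ l (linear 1 (λ a → ⊢ 2 :* a :+ 2 :* a :≤ 5 :* a) (a ∷ [])))
      ... | no _ | no _ | yes _ = refl
      ... | no _ | no _ | no g = ⊥-elim (g (linear 1 (λ a → con 1 :≤ a ⇒ ⊢ 5 :* a :< 2 :* a :+ 4 :* a) (a ∷ []) E.1≤a))
      is-top : B.Top f
      is-top = trans (at (i0 , i1 , i2 , a) E.0<6a) (trans (first a E.1≤a) (sym (trans (at (i0 , i1 , i2 , a) E.5a<6a) last)))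
      not-top : ¬ B.Top g
      not-top t with trans (sym (trans (at (i0 , i1 , i2 , 2 * a) E.0<6a) (first (2 * a) 1≤2a))) (trans t (trans (at (i0 , i1 , i2 , 2 * a) E.5a<6a) last′))
      ... | ()

    gap : 43 ≤ J → 161 ^ (2 * a) * W G (2 * a) (2 * a) (2 * a) ≤ 160 ^ (2 * a) * W G (2 * a ∸ 1) (2 * a) (2 * a + 1)
    gap 43≤J = subst (λ e → 161 ^ e * W₀ ≤ 160 ^ e * W₁) (sym 2a≡) (exponential-gap J W₀ W₁ 43≤J light heavy)
      where
      W₀ = W G (2 * a) (2 * a) (2 * a)
      W₁ = W G (2 * a ∸ 1) (2 * a) (2 * a + 1)
      N = 2 * a ∸ 1
      r = proj₁ 16J
      2a≡ : 2 * a ≡ 160 * J + 2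
      2a≡ = linear 1 (λ J → ⊢ 2 :* (5 :* (16 :* J) :+ con 1) :≡ 160 :* J :+ con 2) (J ∷ [])
      1+N : 1 + N ≡ 2 * a
      1+N = m+[n∸m]≡n {1} (≤-trans E.1≤a (m≤m+n a _))
      3N : N + N + N ≡ 480 * J + 3
      3N = linear 2 (λ N J → con 1 :+ N :≡ 160 :* J :+ con 2 ⇒ ⊢ N :+ N :+ N :≡ 480 :* J :+ con 3) (N ∷ J ∷ []) (trans 1+N 2a≡)
      30^ : 30 ^ N * 30 ^ N * 30 ^ N ≡ 30 ^ (480 * J + 3)
      30^ = trans (cong (_* 30 ^ N) (sym (^-distribˡ-+-* 30 N N))) (trans (sym (^-distribˡ-+-* 30 (N + N) N)) (cong (30 ^_) 3N))
      31^ : 31 ^ (6 * a + suc k) ≡ 31 ^ (496 * J + 7)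
      31^ = cong (31 ^_) (linear 1 (λ J → ⊢ 6 :* (5 :* (16 :* J) :+ con 1) :+ (con 1 :+ 16 :* J) :≡ 496 :* J :+ con 7) (J ∷ []))
      codes : length U.arcCodes ≡ 27 * (160 * J + 3)
      codes = trans U.length-arcCodes (cong (27 *_) (trans (cong suc 2a≡) (sym (+-suc (160 * J) 2))))
      light : W₀ * 30 ^ (480 * J + 3) ≤ 27 * (160 * J + 3) * 31 ^ (496 * J + 7)
      -- The value `t = 30` is optimal: the forests use about 30 of every 31 edges that the bound
      -- allows inside the parts, so `t` to `suc t` is the ratio of `480 * J` to `496 * J`.
      light = ≤-trans (*-monoˡ-≤ _ (m/n≤m (Wlab G (2 * a) (2 * a) (2 * a)) 6))
        (subst (Wlab G (2 * a) (2 * a) (2 * a) * 30 ^ (480 * J + 3) ≤_) (cong₂ _*_ codes 31^)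
          (subst (λ x → Wlab G (2 * a) (2 * a) (2 * a) * x ≤ length U.arcCodes * 31 ^ (6 * a + suc k)) 30^ (U.balanced-weight 30)))
      -- A tenth of the `10 ^ n * 10 ^ n` forests found, where `n` is `suc r`; giving up a factor 10
      -- covers the division by 6 in `W`.
      Y = 10 ^ r * 10 ^ suc r
      n≡ : n ≡ suc r
      n≡ = suc-injective (trans (sym k≡1+n) (proj₂ 16J))
      6Y≤ : Y * 6 ≤ Wlab G (2 * a ∸ 1) (2 * a) (2 * a + 1)
      6Y≤ = ≤-trans (*-monoʳ-≤ Y (m≤m+n 6 4)) (≤-trans (≤-reflexive eq) (subst (λ e → 10 ^ e * 1 * 10 ^ e ≤ Wlab G (2 * a ∸ 1) (2 * a) (2 * a + 1)) n≡ H.near-weight))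
        where
        eq : Y * 10 ≡ 10 ^ suc r * 1 * 10 ^ suc r
        eq = trans (*-comm Y 10) (trans (sym (*-assoc 10 (10 ^ r) (10 ^ suc r))) (cong (_* 10 ^ suc r) (sym (*-identityʳ (10 ^ suc r)))))
      Y≤W₁ : Y ≤ W₁
      Y≤W₁ = subst (_≤ W₁) (m*n/n≡m Y 6) (/-monoˡ-≤ 6 6Y≤)
      heavy : 10 ^ (32 * J) ≤ 1000 * W₁
      heavy = ≤-trans (≤-reflexive eq) (*-monoʳ-≤ 1000 Y≤W₁)
        where
        eq : 10 ^ (32 * J) ≡ 1000 * Y
        eq = trans (cong (10 ^_) (linear 2 (λ J r → 16 :* J :≡ con 2 :+ r ⇒ ⊢ 32 :* J :≡ con 3 :+ (r :+ (con 1 :+ r)))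
                (J ∷ r ∷ []) (proj₂ 16J)))
          (trans (^-distribˡ-+-* 10 3 (r + suc r)) (cong (1000 *_) (^-distribˡ-+-* 10 r (suc r))))

size : ℕ → ℕ
size J = 2 * (5 * (16 * J) + 1)

Index : ℕ → Set
Index n = Σ[ J ∈ ℕ ] (1 ≤ J × n ≡ size J)

family : ∀ n → Index n → Graph (3 * n)
family n (J , _) = Edges.graph (16 * J) (5 * (16 * J) + 1) refl (3 * n)

3*size : ∀ J → 3 * size J ≡ 6 * (5 * (16 * J) + 1)
3*size J = linear 1 (λ J → ⊢ 3 :* (2 :* (5 :* (16 :* J) :+ con 1)) :≡ 6 :* (5 :* (16 :* J) :+ con 1)) (J ∷ [])

family-good : GoodFamily Index family
family-good = (λ { n (J , _ , refl) → linear 1 (λ J → ⊢ con 1 :≤ 2 :* (5 :* (16 :* J) :+ con 1)) (J ∷ []) })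
  , (λ N → size (suc N) , linear 1 (λ N → ⊢ N :≤ 2 :* (5 :* (16 :* (con 1 :+ N)) :+ con 1)) (N ∷ []) , suc N , s≤s z≤n , refl)
  , (λ { n (J , 1≤J , refl) → Paths.graph-connected (16 * J) _ refl (3 * size J) (3*size J) })
  , 161 , 160 , s≤s z≤n , ≤-refl , size 43 , λ { n (J , 1≤J , refl) N≤ → Member.gap J 1≤J (3 * size J) (3*size J) (large J N≤) }
  where
  large : ∀ J → size 43 ≤ size J → 43 ≤ J
  large J l = linear 1 (λ J → 2 :* (5 :* (16 :* con 43) :+ con 1) :≤ 2 :* (5 :* (16 :* J) :+ con 1) ⇒ ⊢ con 43 :≤ J) (J ∷ []) l

theorem1 : (Σ[ I ∈ (ℕ → Set) ] Σ[ G ∈ (∀ n → I n → Graph (3 * n)) ] GoodFamily I G)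
    × (Σ[ I ∈ (ℕ → Set) ] Σ[ G ∈ (∀ n → I n → Graph (3 * n)) ] (GoodFamily I G × (∀ n (h : I n) → TriangularInduced (G n h) × Hamiltonian (G n h) × ReComDisconnected (G n h) n)))
theorem1 = (Index , family , family-good) , (Index , family , family-good , λ { n (J , 1≤J , refl) →
  Member.triangular J 1≤J (3 * size J) (3*size J) ,
  Member.hamiltonian J 1≤J (3 * size J) (3*size J) ,
  Member.disconnected J 1≤J (3 * size J) (3*size J) })
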